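{- For $\varepsilon>0$ and $f\in\Omega$ let $X_\varepsilon(f)$ be the Haar measure of the $\varepsilon$-neighbourhood $\{x\in K^d:\inf_{y\in N(f)}\|x-y\|_\infty\le\varepsilon\}$ of the random Kakeya set $N(f)\subset R^d$. Then the expected value $\mathbb E[X_\varepsilon]$ is equivalent to $$\frac{2\,(q^d-1)}{(q-1)(q^{d-1}-1)}\cdot\frac{1}{|\log_q\varepsilon|}$$ when $\varepsilon\to 0$ (i.e. the ratio of the two quantities tends to $1$).
   Context: $K$ is a field complete with respect to a discrete valuation $\mathrm{val}$ normalized by $\mathrm{val}(\pi)=1$ for a uniformizer $\pi$; $R$ is its ring of integers, $\mathfrak m=\pi R$ its maximal ideal, and the residue field $k=R/\mathfrak m$ is finite with $q$ elements. The norm is $|x|=q^{ -\mathrm{val}(x)}$, and $d\ge 2$ is an integer. $K^d$ is equipped with $\|(x_1,\dots,x_d)\|_\infty=\max_i|x_i|$ and with the Haar measure $\mu$ normalized by $\mu(R^d)=1$. $\mathbb S^{d-1}(K)=\{x\in K^d:\|x\|_\infty=1\}$. $\mathbb P^{d-1}(K)$ is the set of lines through $0$ in $K^d$, identified with $\mathbb S^{d-1}(K)/R^\times$, with the distance $\mathrm{dist}(a,b)=\inf\|\hat a-\hat b\|_\infty$, the infimum being over all representatives $\hat a,\hat b\in\mathbb S^{d-1}(K)$ of $a$ and $b$. For $a\in\mathbb P^{d-1}(K)$, $\mathrm{can}(a)=(a_1,\dots,a_d)\in\mathbb S^{d-1}(K)$ is the unique representative of $a$ for which there is an index $j$ with $a_j=1$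 and $|a_i|<1$ for all $i<j$. $\Omega$ is the set of $1$-Lipschitz functions $\mathbb P^{d-1}(K)\to R^d$. It is a group under pointwise addition, compact for the topology of uniform convergence, and is equipped with its Haar probability measure, with respect to which the expectation $\mathbb E$ is taken. For $f\in\Omega$ the associated (random) Kakeya set is $$N(f)=\bigcup_{a\in\mathbb P^{d-1}(K)}\{t\cdot\mathrm{can}(a)+f(a): t\in R\}\subset R^d.$$ -}

module Defs where

open import Level using (Level; 0ℓ)
open import Algebra.Apartness.Bundles using (HeytingField; HeytingCommutativeRing)
open import Algebra.Bundles using (CommutativeRing; Semiring)
open import Axiom.ExcludedMiddle using (ExcludedMiddle)
open import Data.Fin.Base as Fin using (Fin)
open import Data.Integer.Base as ℤ using (ℤ; +_; -[1+_]; 0ℤ; 1ℤ)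
import Data.Integer.Properties as ℤ
open import Data.Nat.Base as ℕ using (ℕ; zero; suc)
open import Data.Product.Base using (∃; ∃-syntax; _×_; _,_; proj₁)
open import Data.Vec.Functional using (Vector; map; zipWith; foldr)
open import Function.Bundles using (_⇔_)
open import Function.Definitions using (Bijective)
open import Relation.Binary.Bundles using (TotalOrder)
open import Relation.Binary.Core using (Rel)
open import Relation.Binary.PropositionalEquality.Core using (_≡_; _≢_)
open import Relation.Binary.Structures using (IsTotalOrder)
open import Relation.Nullary.Construct.Add.Supremum using (_⁺; [_]; ⊤⁺)
open import Relation.Nullary.Decidable.Core using (yes; no)
open import Relation.Nullary.Negation.Core using (¬_)
open import Relation.Unary using (Pred; Satisfiable; _∈_; _≐_; ∁; ∅; U; _∩_; ⋃)
import Algebra.Construct.NaturalChoice.Max as Max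
import Algebra.Construct.NaturalChoice.Min as Min
import Algebra.Definitions.RawMonoid as RawMonoidDefs
import Algebra.Definitions.RawSemiring as RawSemiringDefs
import Relation.Binary.Construct.Add.Supremum.Equality as SupEq
import Relation.Binary.Construct.Add.Supremum.NonStrict as SupOrder

-- `A ⁺` is `A` with a top element adjoined: `ℤ ⁺` is ℤ ∪ {∞}, the codomain of
-- a valuation, and `ℝ ⁺` is (-∞, ∞], the codomain of a measure.

lift⁺ : {A : Set} → (A → A → A) → A ⁺ → A ⁺ → A ⁺
lift⁺ _∙_ [ x ] [ y ] = [ x ∙ y ]
lift⁺ _∙_ [ _ ] ⊤⁺    = ⊤⁺
lift⁺ _∙_ ⊤⁺    _     = ⊤⁺

module _ {a ℓ p : Level} {A : Set a} (_≤_ : Rel A ℓ) where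

  UpperBound LowerBound IsLub IsGlb : Pred A p → Pred A _
  UpperBound P u = ∀ x → x ∈ P → x ≤ u
  LowerBound P l = ∀ x → x ∈ P → l ≤ x
  IsLub P s = UpperBound P s × (∀ u → UpperBound P u → s ≤ u)
  IsGlb P s = LowerBound P s × (∀ l → LowerBound P l → l ≤ s)

-- The real numbers, characterised up to isomorphism.  Equality is a setoid
-- equality, and classically the apartness of a Heyting field is its negation.

record CompleteOrderedField : Set₁ where
  infix 4 _≤_ _<_
  field
    heytingField : HeytingField 0ℓ 0ℓ 0ℓ

  open HeytingField heytingField public

  field
    _≤_          : Rel Carrier 0ℓ
    isTotalOrder : IsTotalOrder _≈_ _≤_
    +-monoʳ-≤    : ∀ x {y z} → y ≤ z → x + y ≤ x + z
    *-nonneg     : ∀ {x y} → 0# ≤ x → 0# ≤ y → 0# ≤ x * y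
    complete     : (P : Pred Carrier 0ℓ) → Satisfiable P →
                   ∃ (UpperBound _≤_ P) → ∃ (IsLub _≤_ P)

  _<_ : Rel Carrier 0ℓ
  x < y = x ≤ y × ¬ (x ≈ y)

  totalOrder : TotalOrder 0ℓ 0ℓ 0ℓ
  totalOrder = record { isTotalOrder = isTotalOrder }

  open Max totalOrder public using () renaming (_⊔_ to max)

  open CommutativeRing (HeytingCommutativeRing.commutativeRing heytingCommutativeRing)
    using (semiring)
  open Semiring semiring using (rawSemiring; +-rawMonoid)
  open RawSemiringDefs rawSemiring public using (_^_)
  open RawMonoidDefs +-rawMonoid using () renaming (_×_ to _×ℕ_)

  fromℕ : ℕ → Carrier
  fromℕ n = n ×ℕ 1#

  fromℤ : ℤ → Carrier
  fromℤ (+ n)    = fromℕ n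
  fromℤ -[1+ n ] = - fromℕ (suc n)

  abs : Carrier → Carrier
  abs x = max x (- x)

module ℤ⁺ where
  open SupOrder ℤ._≤_ public using (_≤⁺_; ≤⁺-isTotalOrder-≡)

  totalOrder : TotalOrder 0ℓ 0ℓ 0ℓ
  totalOrder = record { isTotalOrder = ≤⁺-isTotalOrder-≡ ℤ.≤-isTotalOrder }

  open Min totalOrder public using () renaming (_⊓_ to min)

-- Fields complete for a discrete valuation, normalised to take the value 1,
-- with residue field of cardinality q.

record LocalField : Set₁ where
  field
    heytingField : HeytingField 0ℓ 0ℓ 0ℓ

  open HeytingField heytingField public
  open ℤ⁺ using (_≤⁺_; min)

  field
    val       : Carrier → ℤ ⁺
    val-cong  : ∀ {x y} → x ≈ y → val x ≡ val y
    val-∞     : ∀ x → val x ≡ ⊤⁺ ⇔ x ≈ 0#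
    val-*     : ∀ x y → val (x * y) ≡ lift⁺ ℤ._+_ (val x) (val y)
    val-+     : ∀ x y → min (val x) (val y) ≤⁺ val (x + y)
    π         : Carrier
    val-π     : val π ≡ [ 1ℤ ]

  Cauchy : (ℕ → Carrier) → Set
  Cauchy s = ∀ (m : ℤ) → ∃[ N ] (∀ i j → N ℕ.≤ i → N ℕ.≤ j → [ m ] ≤⁺ val (s i - s j))

  _⟶_ : (ℕ → Carrier) → Carrier → Set
  s ⟶ x = ∀ (m : ℤ) → ∃[ N ] (∀ i → N ℕ.≤ i → [ m ] ≤⁺ val (s i - x))

  Integral : Pred Carrier 0ℓ
  Integral x = [ 0ℤ ] ≤⁺ val x

  IntegerRing : Set
  IntegerRing = ∃ Integral

  -- equality in the residue field, whose elements are represented in the ring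
  -- of integers
  _≡ₘ_ : Rel IntegerRing 0ℓ
  (x , _) ≡ₘ (y , _) = [ 1ℤ ] ≤⁺ val (x - y)

  IsUnit : Pred Carrier 0ℓ
  IsUnit u = Integral u × ∃[ v ] (Integral v × u * v ≈ 1#)

  field
    cauchy⇒convergent : ∀ s → Cauchy s → ∃[ x ] (s ⟶ x)
    q                 : ℕ
    residue           : Fin q → IntegerRing
    residue-bijective : Bijective _≡_ _≡ₘ_ residue

-- The ambient logic is classical.  By excluded middle, inverses, suprema and
-- infima are total operations, returning an arbitrary value where they are
-- mathematically undefined.

module ClassicalReals (em : ∀ {ℓ} → ExcludedMiddle ℓ) (R : CompleteOrderedField) where

  open CompleteOrderedField R public renaming (Carrier to ℝ)
  open SupEq _≈_ public using (_≈⁺_)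
  open SupOrder _≤_ public using (_≤⁺_)

  infix  8 _⁻¹
  infixl 7 _/_
  infixr 8 _^ᶻ_

  _⁻¹ : ℝ → ℝ
  x ⁻¹ with em {P = x # 0#}
  ... | yes x#0 = proj₁ (#⇒invertible x#0)
  ... | no  _   = 0#

  _/_ : ℝ → ℝ → ℝ
  x / y = x * y ⁻¹

  _^ᶻ_ : ℝ → ℤ → ℝ
  x ^ᶻ (+ n)    = x ^ n
  x ^ᶻ -[1+ n ] = (x ^ suc n) ⁻¹

  sup inf : ∀ {p} → Pred ℝ p → ℝ
  sup P with em {P = ∃ (IsLub _≤_ P)}
  ... | yes (s , _) = s
  ... | no  _       = 0#
  inf P with em {P = ∃ (IsGlb _≤_ P)}
  ... | yes (s , _) = s
  ... | no  _       = 0#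

  -- the supremum of the rationals m / n, n ≥ 1, such that b ^ (m / n) ≤ x
  log : ℝ → ℝ → ℝ
  log b x = sup λ r → ∃[ m ] ∃[ n ]
    (r ≈ fromℤ m / fromℕ (suc n) × b ^ᶻ m ≤ x ^ suc n)

  sup⁺ : ∀ {p} → Pred (ℝ ⁺) p → ℝ ⁺
  sup⁺ P with em {P = ∃ (IsLub _≤⁺_ P)}
  ... | yes (s , _) = s
  ... | no  _       = ⊤⁺

  _+⁺_ : ℝ ⁺ → ℝ ⁺ → ℝ ⁺
  _+⁺_ = lift⁺ _+_

  sum⁺ : ∀ {n} → Vector (ℝ ⁺) n → ℝ ⁺
  sum⁺ = foldr _+⁺_ [ 0# ]

  -- multiplication by a nonnegative real, with 0 · ∞ = 0
  _·⁺_ : ℝ → ℝ ⁺ → ℝ ⁺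
  c ·⁺ [ x ] = [ c * x ]
  c ·⁺ ⊤⁺ with em {P = c ≈ 0#}
  ... | yes _ = [ 0# ]
  ... | no  _ = ⊤⁺

  finitePart : ℝ ⁺ → ℝ
  finitePart [ x ] = x
  finitePart ⊤⁺    = 0#

  _∼₀⁺_ : (ℝ → ℝ) → (ℝ → ℝ) → Set
  F ∼₀⁺ G = ∀ η → 0# < η → ∃[ δ ] (0# < δ ×
    (∀ ε → 0# < ε → ε < δ → abs (F ε / G ε - 1#) < η))

  -- Measures on a space whose topology is given by the neighbourhoods
  -- { y | Near δ x y }, δ > 0, of its points x, and whose addition is given by
  -- its graph, `Sum x y z` meaning x + y = z.

  module Measures {X : Set} (Near : ℝ → X → X → Set) (Sum : X → X → X → Set) where

    IsOpen : Pred X 0ℓ → Set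
    IsOpen A = ∀ x → x ∈ A → ∃[ δ ] (0# < δ × (∀ y → Near δ x y → y ∈ A))

    data Borel : Pred X 0ℓ → Set₁ where
      isOpen : ∀ {A} → IsOpen A → Borel A
      compl  : ∀ {A} → Borel A → Borel (∁ A)
      union  : ∀ {A : ℕ → Pred X 0ℓ} → (∀ n → Borel (A n)) → Borel (⋃ ℕ A)
      resp   : ∀ {A B} → A ≐ B → Borel A → Borel B

    Disjoint : {I : Set} → (I → Pred X 0ℓ) → Set
    Disjoint A = ∀ i j → i ≢ j → ∀ x → ¬ (x ∈ A i ∩ A j)

    -- The value of μ on a set which is not Borel carries no information.
    record Measure : Set₁ where
      field
        μ          : Pred X 0ℓ → ℝ ⁺
        μ-cong     : ∀ {A B} → A ≐ B → μ A ≈⁺ μ B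
        μ-nonneg   : ∀ A → [ 0# ] ≤⁺ μ A
        μ-∅        : μ ∅ ≈⁺ [ 0# ]
        μ-additive : (A : ℕ → Pred X 0ℓ) → (∀ n → Borel (A n)) → Disjoint A →
                     IsLub _≤⁺_
                       (λ s → ∃[ n ] (s ≡ sum⁺ {n} (λ i → μ (A (Fin.toℕ i)))))
                       (μ (⋃ ℕ A))

    _⊕_ : Pred X 0ℓ → X → Pred X 0ℓ
    (A ⊕ g) z = ∃[ x ] (x ∈ A × Sum x g z)

    -- The Haar measure giving mass 1 to C.  In both uses below C is a compact
    -- open subgroup and X is second countable, so that finiteness on compact
    -- sets and regularity follow.
    record HaarMeasure (C : Pred X 0ℓ) : Set₁ where
      field
        measure : Measure
      open Measure measure public
      field
        invariant  : ∀ A → Borel A → ∀ g → μ (A ⊕ g) ≈⁺ μ A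
        normalised : μ C ≈⁺ [ 1# ]

    record SimpleFunction : Set₁ where
      field
        size     : ℕ
        coeff    : Fin size → ℝ
        coeff≥0  : ∀ i → 0# ≤ coeff i
        piece    : Fin size → Pred X 0ℓ
        borel    : ∀ i → Borel (piece i)
        disjoint : Disjoint piece

    -- The simple function is 0 outside its pieces, so for F ≥ 0 only the
    -- pieces matter.
    _≼_ : SimpleFunction → (X → ℝ ⁺) → Set
    φ ≼ F = ∀ i x → x ∈ piece i → [ coeff i ] ≤⁺ F x
      where open SimpleFunction φ

    -- Lebesgue integral of a nonnegative function
    integral : Measure → (X → ℝ ⁺) → ℝ ⁺
    integral m F = sup⁺ λ s → ∃[ φ ] (φ ≼ F ×
      (let open SimpleFunction φ in s ≡ sum⁺ (λ i → coeff i ·⁺ μ (piece i))))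
      where open Measure m

module Kakeya (em : ∀ {ℓ} → ExcludedMiddle ℓ) (R : CompleteOrderedField)
              (𝕂 : LocalField) (d : ℕ) where

  open ClassicalReals em R public
  open LocalField 𝕂 public using (q; val; Integral; IsUnit)
    renaming (Carrier to K; _≈_ to _≈ᴷ_; _+_ to _+ᴷ_; _*_ to _*ᴷ_; _-_ to _-ᴷ_; 1# to 1ᴷ)

  norm : K → ℝ
  norm x with val x
  ... | [ n ] = fromℕ q ^ᶻ (ℤ.- n)
  ... | ⊤⁺    = 0#

  Kᵈ : Set
  Kᵈ = Vector K d

  _≈ᵈ_ : Rel Kᵈ 0ℓ
  x ≈ᵈ y = ∀ i → x i ≈ᴷ y i

  _+ᵈ_ _-ᵈ_ : Kᵈ → Kᵈ → Kᵈ
  _+ᵈ_ = zipWith _+ᴷ_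
  _-ᵈ_ = zipWith _-ᴷ_

  _·ᵈ_ : K → Kᵈ → Kᵈ
  t ·ᵈ x = map (t *ᴷ_) x

  ‖_‖ : Kᵈ → ℝ
  ‖ x ‖ = foldr max 0# (map norm x)

  Rᵈ : Pred Kᵈ 0ℓ
  Rᵈ x = ∀ i → Integral (x i)

  𝕊 : Set
  𝕊 = ∃[ x ] (‖ x ‖ ≈ 1#)

  -- Projective space is the setoid (𝕊 , _~_): a line is given by a
  -- representative in 𝕊, and a ~ b says that b is another one.
  ℙ : Set
  ℙ = 𝕊

  _~_ : Rel ℙ 0ℓ
  (a , _) ~ (b , _) = ∃[ u ] (IsUnit u × b ≈ᵈ (u ·ᵈ a))

  dist : ℙ → ℙ → ℝ
  dist a b = inf λ r → ∃[ â ] ∃[ b̂ ]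
    (a ~ â × b ~ b̂ × r ≈ ‖ proj₁ â -ᵈ proj₁ b̂ ‖)

  -- can(a) = c
  IsCan : ℙ → 𝕊 → Set
  IsCan a c = a ~ c ×
    ∃[ j ] (proj₁ c j ≈ᴷ 1ᴷ × (∀ i → i Fin.< j → norm (proj₁ c i) < 1#))

  record Ω : Set where
    field
      to        : ℙ → Kᵈ
      cong      : ∀ {a b} → a ~ b → to a ≈ᵈ to b
      integral  : ∀ a → to a ∈ Rᵈ
      lipschitz : ∀ a b → ‖ to a -ᵈ to b ‖ ≤ dist a b

  open Ω using (to)

  module MeasuresKᵈ = Measures {Kᵈ} (λ δ x y → ‖ x -ᵈ y ‖ ≤ δ)
                                    (λ x y z → z ≈ᵈ (x +ᵈ y))

  module MeasuresΩ = Measures {Ω} (λ δ f g → ∀ a → ‖ to f a -ᵈ to g a ‖ ≤ δ)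
                                  (λ f g h → ∀ a → to h a ≈ᵈ (to f a +ᵈ to g a))

  HaarKᵈ HaarΩ : Set₁
  HaarKᵈ = MeasuresKᵈ.HaarMeasure Rᵈ
  HaarΩ  = MeasuresΩ.HaarMeasure U

  kakeya : Ω → Pred Kᵈ 0ℓ
  kakeya f x = ∃[ a ] ∃[ c ] ∃[ t ]
    (IsCan a c × Integral t × x ≈ᵈ ((t ·ᵈ proj₁ c) +ᵈ to f a))

  neighbourhood : ℝ → Pred Kᵈ 0ℓ → Pred Kᵈ 0ℓ
  neighbourhood ε N x = inf (λ r → ∃[ y ] (y ∈ N × r ≈ ‖ x -ᵈ y ‖)) ≤ ε

  X : HaarKᵈ → ℝ → Ω → ℝ ⁺
  X μ ε f = MeasuresKᵈ.HaarMeasure.μ μ (neighbourhood ε (kakeya f))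

  𝔼 : HaarΩ → (Ω → ℝ ⁺) → ℝ ⁺
  𝔼 P = MeasuresΩ.integral (MeasuresΩ.HaarMeasure.measure P)

{-# OPTIONS --safe #-}

-- For q ^ - (p + 1) ≤ ε < q ^ - p only f modulo π ^ (p + 1) matters.  A point
-- y lies on the line of direction a, modulo π ^ k, for at most one value of the
-- parameter modulo π ^ k, and when it does for a modulo π ^ k, each lift of a
-- modulo π ^ (k + 1) inherits this property with probability
-- q ^ - (d - 1) = 1 / m, independently.  So the directions of the lines
-- meeting y form a critical Galton-Watson tree with Binomial (m , 1 / m)
-- offspring, and y is hit with probability
--   1 - (1 - survival p / m) ^ ((q ^ d - 1) / (q - 1)),
-- where 1 / survival p grows like p (m - 1) / (2 m).
--
-- The Haar measure on Ω enters through its invariance alone: the volume is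
-- averaged over the translates of f by finitely many explicit maps, coded by
-- trees of digits, which vanish on the pivot coordinate of the direction.  The
-- number of these translates for which y is hit depends neither on y nor on f,
-- and so determines the expectation.
module Submission where

open import Defs
open import Algebra.Apartness.Bundles using (HeytingCommutativeRing)
open import Algebra.Bundles using (CommutativeMonoid; CommutativeRing)
open import Algebra.Solver.Ring.AlmostCommutativeRing using (fromCommutativeRing; _-Raw-AlmostCommutative⟶_)
open import Axiom.ExcludedMiddle using (ExcludedMiddle)
open import Data.Empty using (⊥; ⊥-elim)
open import Data.Fin.Base as Fin
  using (Fin; zero; suc; combine; remQuot; finToFun; funToFin; toℕ; _↑ˡ_; _↑ʳ_; punchIn; punchOut)
open import Data.Integer.Base as ℤ using (ℤ; +_; -[1+_]; 0ℤ; 1ℤ)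
open import Data.List.Base using (List; []; _∷_; _++_)
open import Data.Maybe.Base as Maybe using (Maybe)
open import Data.Nat.Base as ℕ using (ℕ; zero; suc; z≤n; s≤s; _∸_)
open import Data.Product.Base using (∃; ∃-syntax; _×_; _,_; proj₁; proj₂)
open import Data.Sum.Base using (inj₁; inj₂)
open import Data.Unit.Base using (⊤; tt)
open import Data.Vec.Functional using (Vector; insertAt; foldr)
open import Data.Vec.Functional.Properties using (insertAt-lookup; insertAt-punchIn)
open import Function.Base using (_∘_; _⟨_⟩_)
open import Function.Bundles using (Equivalence)
open import Level using (0ℓ)
open import Relation.Binary.Bundles using (TotalOrder)
open import Relation.Binary.Definitions using (tri<; tri≈; tri>)
open import Relation.Binary.PropositionalEquality as ≡ using (_≡_; _≢_)
open import Relation.Nullary.Construct.Add.Supremum using (_⁺; [_]; ⊤⁺)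
open import Relation.Nullary.Decidable using (yes; no; dec⇒maybe)
open import Relation.Nullary.Negation using (¬_; contradiction)
open import Relation.Unary using (Pred; _∈_; _≐_; Satisfiable; ∁; ∅; U; _∩_; _∪_; ⋃)
import Algebra.Construct.NaturalChoice.Max as Max
import Algebra.Construct.NaturalChoice.Min as Min
import Algebra.Properties.CommutativeMonoid.Sum
import Algebra.Solver.Ring
import Data.Fin.Properties as Fin
import Data.Integer.Properties as ℤ
import Data.Nat.Properties as ℕ
import Relation.Binary.Construct.Add.Point.Equality
import Relation.Binary.Construct.Add.Supremum.NonStrict
import Relation.Binary.Construct.NonStrictToStrict
import Relation.Binary.Reasoning.Setoid

-- The law of f under the Haar measure is never computed. Invariance identifies the integral of a
-- step function G with that of its average over the translates `h ⊖ g c`. For the volume this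
-- average is the same constant for every h, by exchanging the sum over c with the integral over y.
-- Step functions below and above the volume then force the value of the integral, which is defined
-- as a supremum.
--
-- The count is independent of y and h for the following reason. In affine coordinates of the
-- direction, y lies on the line exactly where a random contraction agrees with the map `target`,
-- which is built from y and h and is again a contraction. Nothing else about it matters: below each
-- first digit it is a contraction once more, and a uniform tree meets any prescribed digit with
-- probability 1 / m. Moving f (a) along can (a) only shifts the parameter t, so random maps
-- vanishing at the pivot are general enough.
--
-- With W = (q ^ d - 1) / (q - 1) directions modulo π, the hitting probability is about W * survival
-- p / m, hence about 2 W / ((m - 1) p), and |log ε| lies between p and p + 1.

-- Equality in the ring is not decidable, so the solver takes its coefficients
-- in ℤ; with coefficients in the ring itself it would not cancel x - x.
module IntegerCoefficients {c ℓ} (R : CommutativeRing c ℓ) where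

  open CommutativeRing R
  open import Algebra.Properties.Ring ring
  open import Algebra.Properties.AbelianGroup +-abelianGroup using (⁻¹-∙-comm)
  open import Algebra.Properties.Semiring.Mult.TCOptimised semiring renaming (_×_ to _×ᵗ_)
  open import Relation.Binary.Reasoning.Setoid setoid

  private
    ι : ℕ → Carrier
    ι n = n ×ᵗ 1#

  fromInteger : ℤ → Carrier
  fromInteger (+ n)    = ι n
  fromInteger -[1+ n ] = - ι (suc n)

  private
    ι-suc : ∀ n → ι (suc n) ≈ 1# + ι n
    ι-suc n = 1+× n 1#

    cancel-1 : ∀ x y → (1# + x) - (1# + y) ≈ x - y
    cancel-1 x y = begin
      (1# + x) - (1# + y)       ≈⟨ +-congˡ (⁻¹-∙-comm 1# y) ⟨
      (1# + x) + (- 1# - y)     ≈⟨ +-congʳ (+-comm 1# x) ⟩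
      (x + 1#) + (- 1# - y)     ≈⟨ +-assoc x 1# _ ⟩
      x + (1# + (- 1# - y))     ≈⟨ +-congˡ (+-assoc 1# (- 1#) (- y)) ⟨
      x + ((1# - 1#) - y)       ≈⟨ +-congˡ (+-congʳ (-‿inverseʳ 1#)) ⟩
      x + (0# - y)              ≈⟨ +-congˡ (+-identityˡ _) ⟩
      x - y                     ∎

    homo-⊖ : ∀ m n → fromInteger (m ℤ.⊖ n) ≈ ι m - ι n
    homo-⊖ m       zero    = sym (trans (+-congˡ -0#≈0#) (+-identityʳ _))
    homo-⊖ zero    (suc n) = sym (+-identityˡ _)
    homo-⊖ (suc m) (suc n) = begin
      fromInteger (suc m ℤ.⊖ suc n)  ≡⟨ ≡.cong fromInteger (ℤ.[1+m]⊖[1+n]≡m⊖n m n) ⟩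
      fromInteger (m ℤ.⊖ n)          ≈⟨ homo-⊖ m n ⟩
      ι m - ι n                      ≈⟨ cancel-1 (ι m) (ι n) ⟨
      (1# + ι m) - (1# + ι n)        ≈⟨ +-cong (ι-suc m) (-‿cong (ι-suc n)) ⟨
      ι (suc m) - ι (suc n)          ∎

    homo-+ : ∀ i j → fromInteger (i ℤ.+ j) ≈ fromInteger i + fromInteger j
    homo-+ (+ m)    (+ n)    = ×-homo-+ 1# m n
    homo-+ (+ m)    -[1+ n ] = homo-⊖ m (suc n)
    homo-+ -[1+ m ] (+ n)    = trans (homo-⊖ n (suc m)) (+-comm _ _)
    homo-+ -[1+ m ] -[1+ n ] = begin
      - ι (suc (suc (m ℕ.+ n)))       ≈⟨ -‿cong (reflexive (≡.cong (λ k → ι (suc k)) (≡.sym (ℕ.+-suc m n)))) ⟩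
      - ι (suc m ℕ.+ suc n)           ≈⟨ -‿cong (×-homo-+ 1# (suc m) (suc n)) ⟩
      - (ι (suc m) + ι (suc n))       ≈⟨ ⁻¹-∙-comm _ _ ⟨
      - ι (suc m) - ι (suc n)         ∎

    homo-neg : ∀ i → fromInteger (ℤ.- i) ≈ - fromInteger i
    homo-neg (+ zero)  = sym -0#≈0#
    homo-neg (+ suc n) = refl
    homo-neg -[1+ n ]  = sym (-‿involutive _)

    homo-*-+ : ∀ m n → fromInteger (+ m ℤ.* + n) ≈ ι m * ι n
    homo-*-+ m n = trans (reflexive (≡.cong fromInteger (≡.sym (ℤ.pos-* m n)))) (×1-homo-* m n)

    homo-* : ∀ i j → fromInteger (i ℤ.* j) ≈ fromInteger i * fromInteger j
    homo-* (+ m)    (+ n)    = homo-*-+ m n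
    homo-* (+ m)    -[1+ n ] = begin
      fromInteger (+ m ℤ.* -[1+ n ])      ≡⟨ ≡.cong fromInteger (ℤ.neg-distribʳ-* (+ m) (+ suc n)) ⟨
      fromInteger (ℤ.- (+ m ℤ.* + suc n)) ≈⟨ homo-neg (+ m ℤ.* + suc n) ⟩
      - fromInteger (+ m ℤ.* + suc n)     ≈⟨ -‿cong (homo-*-+ m (suc n)) ⟩
      - (ι m * ι (suc n))                 ≈⟨ -‿distribʳ-* _ _ ⟩
      ι m * - ι (suc n)                   ∎
    homo-* -[1+ m ] (+ n)    = begin
      fromInteger (-[1+ m ] ℤ.* + n)      ≡⟨ ≡.cong fromInteger (ℤ.neg-distribˡ-* (+ suc m) (+ n)) ⟨
      fromInteger (ℤ.- (+ suc m ℤ.* + n)) ≈⟨ homo-neg (+ suc m ℤ.* + n) ⟩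
      - fromInteger (+ suc m ℤ.* + n)     ≈⟨ -‿cong (homo-*-+ (suc m) n) ⟩
      - (ι (suc m) * ι n)                 ≈⟨ -‿distribˡ-* _ _ ⟩
      - ι (suc m) * ι n                   ∎
    homo-* -[1+ m ] -[1+ n ] = begin
      fromInteger (-[1+ m ] ℤ.* -[1+ n ]) ≈⟨ homo-*-+ (suc m) (suc n) ⟩
      ι (suc m) * ι (suc n)               ≈⟨ -‿involutive _ ⟨
      - - (ι (suc m) * ι (suc n))         ≈⟨ -‿cong (-‿distribʳ-* _ _) ⟩
      - (ι (suc m) * - ι (suc n))         ≈⟨ -‿distribˡ-* _ _ ⟩
      - ι (suc m) * - ι (suc n)           ∎

    morphism : ℤ.+-*-rawRing -Raw-AlmostCommutative⟶ fromCommutativeRing R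
    morphism = record
      { ⟦_⟧    = fromInteger
      ; +-homo = homo-+
      ; *-homo = homo-*
      ; -‿homo = homo-neg
      ; 0-homo = refl
      ; 1-homo = refl
      }

  open Algebra.Solver.Ring ℤ.+-*-rawRing (fromCommutativeRing R) morphism
    (λ i j → Maybe.map (λ i≡j → reflexive (≡.cong fromInteger i≡j)) (dec⇒maybe (i ℤ.≟ j))) public
    using (solve; _:=_; _:+_; _:*_; _:-_; :-_; con; Polynomial)

  :0 :1 : ∀ {n} → Polynomial n
  :0 = con ℤ.0ℤ
  :1 = con ℤ.1ℤ

-- Ordered-field arithmetic, powers, the Archimedean property, suprema and infima.

module Reals (em : ∀ {ℓ} → ExcludedMiddle ℓ) (R : CompleteOrderedField) where

  open ClassicalReals em R public hiding (zero; refl; sym; trans; isTotalOrder)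

  commutativeRing : CommutativeRing 0ℓ 0ℓ
  commutativeRing = HeytingCommutativeRing.commutativeRing heytingCommutativeRing

  open CommutativeRing commutativeRing public using
    (refl; sym; trans; ring; semiring; +-commutativeMonoid; *-commutativeMonoid)
  open IntegerCoefficients commutativeRing public
  open import Algebra.Properties.Ring ring public using (-0#≈0#; -‿distribˡ-*; -‿involutive)

  open TotalOrder totalOrder public using (total; antisym; ≤-respˡ-≈; ≤-respʳ-≈)
    renaming (refl to ≤-refl; reflexive to ≤-reflexive; trans to ≤-trans)
  open Max totalOrder public using (x≤x⊔y; x≤y⊔x; ⊔-lub)

  private module Strict = Relation.Binary.Construct.NonStrictToStrict _≈_ _≤_
  module ≈-Reasoning = Relation.Binary.Reasoning.Setoid (CommutativeRing.setoid commutativeRing)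

  <⇒≤ : ∀ {x y} → x < y → x ≤ y
  <⇒≤ = proj₁

  <⇒≱ : ∀ {x y} → x < y → ¬ (y ≤ x)
  <⇒≱ = Strict.<⇒≱ antisym

  ≰⇒> : ∀ {x y} → ¬ (x ≤ y) → y < x
  ≰⇒> = Strict.≰⇒> sym ≤-reflexive total

  ≮⇒≥ : ∀ {x y} → ¬ (x < y) → y ≤ x
  ≮⇒≥ = Strict.≮⇒≥ sym (λ _ _ → em) ≤-reflexive total

  <-irrefl : ∀ {x y} → x ≈ y → ¬ (x < y)
  <-irrefl = Strict.<-irrefl

  <-≤-trans : ∀ {x y z} → x < y → y ≤ z → x < z
  <-≤-trans = Strict.<-≤-trans sym ≤-trans antisym ≤-respʳ-≈

  ≤-<-trans : ∀ {x y z} → x ≤ y → y < z → x < z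
  ≤-<-trans = Strict.≤-<-trans ≤-trans antisym ≤-respˡ-≈

  <-trans : ∀ {x y z} → x < y → y < z → x < z
  <-trans x<y y<z = <-≤-trans x<y (<⇒≤ y<z)

  <-respˡ-≈ : ∀ {x y z} → x ≈ y → x < z → y < z
  <-respˡ-≈ x≈y = ≤-<-trans (≤-reflexive (sym x≈y))

  <-respʳ-≈ : ∀ {x y z} → x ≈ y → z < x → z < y
  <-respʳ-≈ x≈y z<x = <-≤-trans z<x (≤-reflexive x≈y)

  ≤-resp₂ : ∀ {x x′ y y′} → x ≈ x′ → y ≈ y′ → x ≤ y → x′ ≤ y′
  ≤-resp₂ x≈x′ y≈y′ x≤y = ≤-respˡ-≈ x≈x′ (≤-respʳ-≈ y≈y′ x≤y)

  +-mono-≤ : ∀ {w x y z} → w ≤ x → y ≤ z → w + y ≤ x + z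
  +-mono-≤ {w} {x} {y} {z} w≤x y≤z =
    ≤-trans (+-monoʳ-≤ w y≤z) (≤-resp₂ (+-comm z w) (+-comm z x) (+-monoʳ-≤ z w≤x))

  +-monoˡ-≤ : ∀ {x y} z → x ≤ y → x + z ≤ y + z
  +-monoˡ-≤ z x≤y = +-mono-≤ x≤y ≤-refl

  ≤⇒0≤- : ∀ {x y} → x ≤ y → 0# ≤ y - x
  ≤⇒0≤- {x} {y} x≤y = ≤-respˡ-≈ (-‿inverseʳ x) (+-monoˡ-≤ (- x) x≤y)

  0≤⇒≤ : ∀ {x y e} → 0# ≤ e → e ≈ y - x → x ≤ y
  0≤⇒≤ {x} {y} {e} 0≤e e≈ = ≤-resp₂ (+-identityʳ x)
    (trans (+-congˡ e≈) (solve 2 (λ x y → x :+ (y :- x) := y) refl x y)) (+-monoʳ-≤ x 0≤e)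

  neg-mono-≤ : ∀ {x y} → x ≤ y → - y ≤ - x
  neg-mono-≤ {x} {y} x≤y =
    0≤⇒≤ (≤⇒0≤- x≤y) (solve 2 (λ x y → y :- x := :- x :- :- y) refl x y)

  +-nonneg : ∀ {x y} → 0# ≤ x → 0# ≤ y → 0# ≤ x + y
  +-nonneg 0≤x 0≤y = ≤-respˡ-≈ (+-identityˡ 0#) (+-mono-≤ 0≤x 0≤y)

  *-monoˡ-≤ : ∀ {x y z} → 0# ≤ z → x ≤ y → z * x ≤ z * y
  *-monoˡ-≤ {x} {y} {z} 0≤z x≤y = 0≤⇒≤ (*-nonneg 0≤z (≤⇒0≤- x≤y))
    (solve 3 (λ x y z → z :* (y :- x) := z :* y :- z :* x) refl x y z)

  *-monoʳ-≤ : ∀ {x y z} → 0# ≤ z → x ≤ y → x * z ≤ y * z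
  *-monoʳ-≤ {x} {y} {z} 0≤z x≤y = ≤-resp₂ (*-comm z x) (*-comm z y) (*-monoˡ-≤ 0≤z x≤y)

  *-mono-≤ : ∀ {w x y z} → 0# ≤ y → 0# ≤ x → w ≤ x → y ≤ z → w * y ≤ x * z
  *-mono-≤ 0≤y 0≤x w≤x y≤z = ≤-trans (*-monoʳ-≤ 0≤y w≤x) (*-monoˡ-≤ 0≤x y≤z)

  1#≉0# : ¬ (1# ≈ 0#)
  1#≉0# 1≈0 = #-irrefl 1≈0 1#0
    where open import Algebra.Apartness.Properties.HeytingCommutativeRing heytingCommutativeRing using (1#0)

  square-nonneg : ∀ x → 0# ≤ x * x
  square-nonneg x with total 0# x
  ... | inj₁ 0≤x = *-nonneg 0≤x 0≤x
  ... | inj₂ x≤0 = ≤-respʳ-≈ (solve 1 (λ x → (:0 :- x) :* (:0 :- x) := x :* x) refl x)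
                     (*-nonneg (≤⇒0≤- x≤0) (≤⇒0≤- x≤0))

  0≤1 : 0# ≤ 1#
  0≤1 = ≤-respʳ-≈ (*-identityˡ 1#) (square-nonneg 1#)

  0<1 : 0# < 1#
  0<1 = 0≤1 , λ 0≈1 → 1#≉0# (sym 0≈1)

  <⇒0<- : ∀ {x y} → x < y → 0# < y - x
  <⇒0<- {x} {y} x<y = ≰⇒> λ y-x≤0 → <⇒≱ x<y
    (0≤⇒≤ (≤⇒0≤- y-x≤0) (solve 2 (λ x y → :0 :- (y :- x) := x :- y) refl x y))

  0<⇒< : ∀ {x y e} → 0# < e → e ≈ y - x → x < y
  0<⇒< {x} {y} {e} 0<e e≈ = ≰⇒> λ y≤x → <⇒≱ 0<e (0≤⇒≤ (≤⇒0≤- y≤x)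
    (trans (solve 2 (λ x y → x :- y := :0 :- (y :- x)) refl x y) (+-congˡ (-‿cong (sym e≈)))))

  +-monoʳ-< : ∀ x {y z} → y < z → x + y < x + z
  +-monoʳ-< x {y} {z} y<z = 0<⇒< (<⇒0<- y<z)
    (solve 3 (λ x y z → z :- y := (x :+ z) :- (x :+ y)) refl x y z)

  +-mono-≤-< : ∀ {w x y z} → w ≤ x → y < z → w + y < x + z
  +-mono-≤-< {w} {x} {y} {z} w≤x y<z = <-≤-trans (+-monoʳ-< w y<z) (+-monoˡ-≤ z w≤x)

  +-mono-<-≤ : ∀ {w x y z} → w < x → y ≤ z → w + y < x + z
  +-mono-<-≤ {w} {x} {y} {z} w<x y≤z =
    <-respˡ-≈ (+-comm y w) (<-respʳ-≈ (+-comm z x) (+-mono-≤-< y≤z w<x))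

  +-pos : ∀ {x y} → 0# < x → 0# < y → 0# < x + y
  +-pos 0<x 0<y = <-respˡ-≈ (+-identityˡ 0#) (+-mono-≤-< (<⇒≤ 0<x) 0<y)

  +-pos-nonneg : ∀ {x y} → 0# < x → 0# ≤ y → 0# < x + y
  +-pos-nonneg 0<x 0≤y = <-respˡ-≈ (+-identityˡ 0#) (+-mono-<-≤ 0<x 0≤y)

  #-from-≉ : ∀ {x y} → ¬ (x ≈ y) → x # y
  #-from-≉ {x} {y} x≉y with em {P = x # y}
  ... | yes x#y = x#y
  ... | no ¬x#y = contradiction (proj₁ (tight x y) ¬x#y) x≉y

  ⁻¹-inverseʳ : ∀ {x} → ¬ (x ≈ 0#) → x * x ⁻¹ ≈ 1#
  ⁻¹-inverseʳ {x} x≉0 with em {P = x # 0#}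
  ... | no ¬x#0 = contradiction (#-from-≉ x≉0) ¬x#0
  ... | yes x#0 with #⇒invertible x#0
  ...   | x′ , x′x≈1 , _ = trans (solve 2 (λ x y → x :* y := y :* (x :- :0)) refl x x′) x′x≈1

  pos⇒≉0 : ∀ {x} → 0# < x → ¬ (x ≈ 0#)
  pos⇒≉0 0<x x≈0 = proj₂ 0<x (sym x≈0)

  ⁻¹-inverse : ∀ {x} → 0# < x → x * x ⁻¹ ≈ 1#
  ⁻¹-inverse 0<x = ⁻¹-inverseʳ (pos⇒≉0 0<x)

  *-cancelˡ : ∀ {x y z} → ¬ (x ≈ 0#) → x * y ≈ x * z → y ≈ z
  *-cancelˡ {x} {y} {z} x≉0 xy≈xz = begin
    y               ≈⟨ lemma y ⟨
    x ⁻¹ * (x * y)  ≈⟨ *-congˡ xy≈xz ⟩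
    x ⁻¹ * (x * z)  ≈⟨ lemma z ⟩
    z               ∎
    where
    open ≈-Reasoning
    lemma : ∀ w → x ⁻¹ * (x * w) ≈ w
    lemma w = begin
      x ⁻¹ * (x * w)  ≈⟨ solve 3 (λ i x w → i :* (x :* w) := (x :* i) :* w) refl (x ⁻¹) x w ⟩
      x * x ⁻¹ * w    ≈⟨ *-congʳ (⁻¹-inverseʳ x≉0) ⟩
      1# * w          ≈⟨ *-identityˡ w ⟩
      w               ∎

  ⁻¹-unique : ∀ {x y} → 0# < x → x * y ≈ 1# → y ≈ x ⁻¹
  ⁻¹-unique 0<x xy≈1 = *-cancelˡ (pos⇒≉0 0<x) (trans xy≈1 (sym (⁻¹-inverse 0<x)))

  ⁻¹-cong : ∀ {x y} → 0# < x → x ≈ y → x ⁻¹ ≈ y ⁻¹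
  ⁻¹-cong 0<x x≈y = ⁻¹-unique (<-respʳ-≈ x≈y 0<x)
    (trans (*-congʳ (sym x≈y)) (⁻¹-inverse 0<x))

  *-pos : ∀ {x y} → 0# < x → 0# < y → 0# < x * y
  *-pos {x} {y} 0<x 0<y = *-nonneg (<⇒≤ 0<x) (<⇒≤ 0<y) ,
    λ 0≈xy → pos⇒≉0 0<y (*-cancelˡ (pos⇒≉0 0<x) (trans (sym 0≈xy) (sym (zeroʳ x))))

  ⁻¹-pos : ∀ {x} → 0# < x → 0# < x ⁻¹
  ⁻¹-pos {x} 0<x = ≰⇒> λ x⁻¹≤0 → <⇒≱ 0<1
    (≤-resp₂ (⁻¹-inverse 0<x) (zeroʳ x) (*-monoˡ-≤ (<⇒≤ 0<x) x⁻¹≤0))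

  *-monoˡ-< : ∀ {x y z} → 0# < z → x < y → z * x < z * y
  *-monoˡ-< {x} {y} {z} 0<z x<y = 0<⇒< (*-pos 0<z (<⇒0<- x<y))
    (solve 3 (λ x y z → z :* (y :- x) := z :* y :- z :* x) refl x y z)

  *-monoʳ-< : ∀ {x y z} → 0# < z → x < y → x * z < y * z
  *-monoʳ-< {x} {y} {z} 0<z x<y = <-respˡ-≈ (*-comm z x) (<-respʳ-≈ (*-comm z y) (*-monoˡ-< 0<z x<y))

  *-cancelˡ-≤ : ∀ {x y z} → 0# < z → z * x ≤ z * y → x ≤ y
  *-cancelˡ-≤ 0<z zx≤zy = ≮⇒≥ λ y<x → <⇒≱ (*-monoˡ-< 0<z y<x) zx≤zy

  ⁻¹-anti-≤ : ∀ {x y} → 0# < x → x ≤ y → y ⁻¹ ≤ x ⁻¹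
  ⁻¹-anti-≤ {x} {y} 0<x x≤y = *-cancelˡ-≤ (*-pos 0<x 0<y) (≤-resp₂
    (sym (trans (*-assoc x y _) (trans (*-congˡ (⁻¹-inverse 0<y)) (*-identityʳ x))))
    (sym (trans (solve 3 (λ x y i → x :* y :* i := x :* i :* y) refl x y (x ⁻¹))
      (trans (*-congʳ (⁻¹-inverse 0<x)) (*-identityˡ y)))) x≤y)
    where 0<y = <-≤-trans 0<x x≤y

  *⁻¹-≤ : ∀ {x y z} → 0# < y → x ≤ z * y → x * y ⁻¹ ≤ z
  *⁻¹-≤ {x} {y} {z} 0<y x≤zy = ≤-respʳ-≈
    (trans (*-assoc z y _) (trans (*-congˡ (⁻¹-inverse 0<y)) (*-identityʳ z)))
    (*-monoʳ-≤ (<⇒≤ (⁻¹-pos 0<y)) x≤zy)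

  ≤-*⁻¹ : ∀ {x y z} → 0# < y → z * y ≤ x → z ≤ x * y ⁻¹
  ≤-*⁻¹ {x} {y} {z} 0<y zy≤x = ≤-respˡ-≈
    (trans (*-assoc z y _) (trans (*-congˡ (⁻¹-inverse 0<y)) (*-identityʳ z)))
    (*-monoʳ-≤ (<⇒≤ (⁻¹-pos 0<y)) zy≤x)

  ⁻¹-distrib-* : ∀ {x y} → 0# < x → 0# < y → (x * y) ⁻¹ ≈ x ⁻¹ * y ⁻¹
  ⁻¹-distrib-* {x} {y} 0<x 0<y = sym (⁻¹-unique (*-pos 0<x 0<y) (begin
    x * y * (x ⁻¹ * y ⁻¹)    ≈⟨ solve 4 (λ x y i j → x :* y :* (i :* j) := (x :* i) :* (y :* j)) refl x y (x ⁻¹) (y ⁻¹) ⟩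
    x * x ⁻¹ * (y * y ⁻¹)    ≈⟨ *-cong (⁻¹-inverse 0<x) (⁻¹-inverse 0<y) ⟩
    1# * 1#                  ≈⟨ *-identityˡ 1# ⟩
    1#                       ∎))
    where open ≈-Reasoning

  1⁻¹≈1 : 1# ⁻¹ ≈ 1#
  1⁻¹≈1 = sym (⁻¹-unique 0<1 (*-identityˡ 1#))

  open import Algebra.Properties.Semiring.Exp semiring public using (^-homo-*; ^-assocʳ)
  open import Algebra.Properties.Semiring.Mult semiring using (×-homo-+; ×1-homo-*)

  fromℕ-+ : ∀ m n → fromℕ (m ℕ.+ n) ≈ fromℕ m + fromℕ n
  fromℕ-+ = ×-homo-+ 1#

  fromℕ-* : ∀ m n → fromℕ (m ℕ.* n) ≈ fromℕ m * fromℕ n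
  fromℕ-* = ×1-homo-*

  fromℕ-1 : fromℕ 1 ≈ 1#
  fromℕ-1 = +-identityʳ 1#

  fromℕ-^ : ∀ m n → fromℕ (m ℕ.^ n) ≈ fromℕ m ^ n
  fromℕ-^ m zero    = fromℕ-1
  fromℕ-^ m (suc n) = trans (fromℕ-* m (m ℕ.^ n)) (*-congˡ (fromℕ-^ m n))

  fromℕ-nonneg : ∀ n → 0# ≤ fromℕ n
  fromℕ-nonneg zero    = ≤-refl
  fromℕ-nonneg (suc n) = +-nonneg 0≤1 (fromℕ-nonneg n)

  fromℕ-mono-≤ : ∀ {m n} → m ℕ.≤ n → fromℕ m ≤ fromℕ n
  fromℕ-mono-≤ {n = n} z≤n = fromℕ-nonneg n
  fromℕ-mono-≤ (s≤s m≤n)   = +-monoʳ-≤ 1# (fromℕ-mono-≤ m≤n)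

  fromℕ-pos : ∀ {n} → 0 ℕ.< n → 0# < fromℕ n
  fromℕ-pos {n} 0<n = <-≤-trans 0<1 (≤-respˡ-≈ fromℕ-1 (fromℕ-mono-≤ 0<n))

  1≤fromℕ : ∀ {n} → 1 ℕ.≤ n → 1# ≤ fromℕ n
  1≤fromℕ 1≤n = ≤-respˡ-≈ fromℕ-1 (fromℕ-mono-≤ 1≤n)

  ^-nonneg : ∀ {x} n → 0# ≤ x → 0# ≤ x ^ n
  ^-nonneg zero    0≤x = 0≤1
  ^-nonneg (suc n) 0≤x = *-nonneg 0≤x (^-nonneg n 0≤x)

  ^-pos : ∀ {x} n → 0# < x → 0# < x ^ n
  ^-pos zero    0<x = 0<1
  ^-pos (suc n) 0<x = *-pos 0<x (^-pos n 0<x)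

  1≤^ : ∀ {x} n → 1# ≤ x → 1# ≤ x ^ n
  1≤^ zero    1≤x = ≤-refl
  1≤^ (suc n) 1≤x = ≤-respˡ-≈ (*-identityˡ 1#) (*-mono-≤ 0≤1 (≤-trans 0≤1 1≤x) 1≤x (1≤^ n 1≤x))

  ^-monoʳ-≤ : ∀ {x m n} → 1# ≤ x → m ℕ.≤ n → x ^ m ≤ x ^ n
  ^-monoʳ-≤ {x} {n = n} 1≤x z≤n = 1≤^ n 1≤x
  ^-monoʳ-≤ 1≤x (s≤s m≤n) = *-monoˡ-≤ (≤-trans 0≤1 1≤x) (^-monoʳ-≤ 1≤x m≤n)

  ^-monoʳ-< : ∀ {x m n} → 1# < x → m ℕ.< n → x ^ m < x ^ n
  ^-monoʳ-< {x} {m} {n} 1<x m<n = <-≤-trans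
    (<-respˡ-≈ (*-identityˡ _) (*-monoʳ-< (^-pos m (≤-<-trans 0≤1 1<x)) 1<x))
    (^-monoʳ-≤ (<⇒≤ 1<x) m<n)

  ^-cancelʳ-≤ : ∀ {x m n} → 1# < x → x ^ m ≤ x ^ n → m ℕ.≤ n
  ^-cancelʳ-≤ {m = m} {n} 1<x xm≤xn with m ℕ.≤? n
  ... | yes m≤n = m≤n
  ... | no  m≰n = contradiction xm≤xn (<⇒≱ (^-monoʳ-< 1<x (ℕ.≰⇒> m≰n)))

  ^-monoˡ-≤ : ∀ {x y} n → 0# ≤ x → x ≤ y → x ^ n ≤ y ^ n
  ^-monoˡ-≤ zero    0≤x x≤y = ≤-refl
  ^-monoˡ-≤ (suc n) 0≤x x≤y = *-mono-≤ (^-nonneg n 0≤x) (≤-trans 0≤x x≤y) x≤y (^-monoˡ-≤ n 0≤x x≤y)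

  ^-monoˡ-< : ∀ {x y} n → 0# ≤ x → x < y → x ^ suc n < y ^ suc n
  ^-monoˡ-< {x} {y} n 0≤x x<y = ≤-<-trans
    (*-monoˡ-≤ 0≤x (^-monoˡ-≤ n 0≤x (<⇒≤ x<y)))
    (*-monoʳ-< (^-pos n (≤-<-trans 0≤x x<y)) x<y)

  1^n≈1 : ∀ n → 1# ^ n ≈ 1#
  1^n≈1 zero    = refl
  1^n≈1 (suc n) = trans (*-identityˡ _) (1^n≈1 n)

  ^-⁻¹ : ∀ {x} n → 0# < x → (x ^ n) ⁻¹ ≈ (x ⁻¹) ^ n
  ^-⁻¹ zero    0<x = 1⁻¹≈1
  ^-⁻¹ (suc n) 0<x = trans (⁻¹-distrib-* 0<x (^-pos n 0<x)) (*-congˡ (^-⁻¹ n 0<x))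

  -- Otherwise the naturals have a least upper bound s, and s - 1 is an upper bound as well, because
  -- n + 1 ≤ s for every n.
  archimedean : ∀ x → ∃[ n ] x < fromℕ n
  archimedean x with em {P = ∃[ n ] x < fromℕ n}
  ... | yes x<n = x<n
  ... | no ¬x<n with complete (λ y → ∃[ n ] y ≈ fromℕ n) (0# , 0 , refl)
                     (x , λ { _ (n , y≈n) → ≤-respˡ-≈ (sym y≈n) (≮⇒≥ λ x<n → ¬x<n (n , x<n)) })
  ...   | s , upper , least = ⊥-elim (<⇒≱ s-1<s (least (s - 1#) λ { y (n , y≈n) →
            0≤⇒≤ (≤⇒0≤- (upper (fromℕ (suc n)) (suc n , refl)))
              (trans (solve 2 (λ s n → s :- (:1 :+ n) := s :- :1 :- n) refl s (fromℕ n)) (+-congˡ (-‿cong (sym y≈n)))) }))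
    where
    s-1<s : s - 1# < s
    s-1<s = 0<⇒< 0<1 (solve 1 (λ s → :1 := s :- (s :- :1)) refl s)

  archimedean-⁻¹ : ∀ {η} → 0# < η → ∃[ n ] fromℕ (suc n) ⁻¹ < η
  archimedean-⁻¹ {η} 0<η with archimedean (η ⁻¹)
  ... | n , η⁻¹<n = n , ≰⇒> λ η≤ → <⇒≱ η⁻¹<n (≤-trans
        (fromℕ-mono-≤ (ℕ.n≤1+n n))
        (≤-trans (≤-reflexive (sym (⁻¹⁻¹ (fromℕ-pos {suc n} (s≤s z≤n))))) (⁻¹-anti-≤ 0<η η≤)))
    where
    ⁻¹⁻¹ : ∀ {x} → 0# < x → (x ⁻¹) ⁻¹ ≈ x
    ⁻¹⁻¹ {x} 0<x = sym (⁻¹-unique (⁻¹-pos 0<x) (trans (*-comm (x ⁻¹) x) (⁻¹-inverse 0<x)))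

  bernoulli : ∀ {x} n → 1# ≤ x → 1# + fromℕ n * (x - 1#) ≤ x ^ n
  bernoulli {x} zero    1≤x = ≤-reflexive (solve 1 (λ y → :1 :+ :0 :* y := :1) refl (x - 1#))
  bernoulli {x} (suc n) 1≤x = ≤-trans
    (0≤⇒≤ (*-nonneg (fromℕ-nonneg n) (square-nonneg (x - 1#)))
      (solve 2 (λ x n → n :* ((x :- :1) :* (x :- :1)) :=
        x :* (:1 :+ n :* (x :- :1)) :- (:1 :+ (:1 :+ n) :* (x :- :1))) refl x (fromℕ n)))
    (*-monoˡ-≤ (≤-trans 0≤1 1≤x) (bernoulli n 1≤x))

  ^-unbounded : ∀ {x} → 1# < x → ∀ y → ∃[ n ] y < x ^ n
  ^-unbounded {x} 1<x y with archimedean (y * (x - 1#) ⁻¹)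
  ... | n , y/z<n = n , <-≤-trans (≤-<-trans
      (≤-reflexive (sym (trans (*-assoc y _ _) (trans (*-congˡ (trans (*-comm _ _) (⁻¹-inverse 0<z))) (*-identityʳ y)))))
      (*-monoʳ-< 0<z y/z<n))
    (≤-trans (0≤⇒≤ 0≤1 (solve 1 (λ w → :1 := (:1 :+ w) :- w) refl _)) (bernoulli n (<⇒≤ 1<x)))
    where 0<z = <⇒0<- 1<x

  abs-< : ∀ {x y} → - y < x → x < y → abs x < y
  abs-< {x} {y} -y<x x<y with em {P = y ≤ abs x}
  ... | no  y≰   = ≰⇒> y≰
  ... | yes y≤ with total x (- x)
  ...   | inj₁ x≤-x = contradiction (≤-trans y≤ (⊔-lub x≤-x ≤-refl)) (<⇒≱ (0<⇒< (<⇒0<- -y<x)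
                        (solve 2 (λ x y → x :- :- y := y :- :- x) refl x y)))
  ...   | inj₂ -x≤x = contradiction (≤-trans y≤ (⊔-lub ≤-refl -x≤x)) (<⇒≱ x<y)

  abs-nonpos : ∀ {x} → x ≤ 0# → abs x ≈ - x
  abs-nonpos {x} x≤0 = antisym
    (⊔-lub (≤-trans x≤0 (≤-respˡ-≈ -0#≈0# (neg-mono-≤ x≤0))) ≤-refl) (x≤y⊔x x (- x))

  sup-isLub : ∀ {p} {P : Pred ℝ p} {s} → IsLub _≤_ P s → sup P ≈ s
  sup-isLub {P = P} {s} s-lub@(s-upper , s-least) with em {P = ∃ (IsLub _≤_ P)}
  ... | yes (t , t-upper , t-least) = antisym (t-least s s-upper) (s-least t t-upper)
  ... | no ¬lub = contradiction (s , s-lub) ¬lub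

  sup-bounds : {P : Pred ℝ 0ℓ} {x u : ℝ} → x ∈ P → UpperBound _≤_ P u → x ≤ sup P × sup P ≤ u
  sup-bounds {P} {x} {u} x∈P bound with complete P (x , x∈P) (u , bound)
  ... | s , s-lub = ≤-respʳ-≈ (sym (sup-isLub s-lub)) (proj₁ s-lub x x∈P) ,
                    ≤-respˡ-≈ (sym (sup-isLub s-lub)) (proj₂ s-lub u bound)

  -- Completeness is available for suprema only, so the infimum is obtained as the supremum of the
  -- lower bounds. The hypotheses exclude the default value of `inf`.
  inf-isGlb : {P : Pred ℝ 0ℓ} → Satisfiable P → LowerBound _≤_ P 0# → IsGlb _≤_ P (inf P)
  inf-isGlb {P} (x , x∈P) 0≤P with em {P = ∃ (IsGlb _≤_ P)}
  ... | yes (_ , s-glb) = s-glb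
  ... | no ¬glb with complete (λ y → ∀ z → z ∈ P → y ≤ z) (0# , 0≤P) (x , λ y y≤P → y≤P x x∈P)
  ...   | s , upper , least = contradiction
            (s , (λ z z∈P → least z λ y y≤P → y≤P z z∈P) , λ l l≤P → upper l l≤P) ¬glb

-- Divisibility by powers of the uniformizer.

module Valuation (em : ∀ {ℓ} → ExcludedMiddle ℓ) (𝕂 : LocalField) where

  open LocalField 𝕂 public using (Carrier; _≈_; _#_; _+_; _*_; -_; _-_; 0#; 1#; val; val-cong; π; IsUnit; IntegerRing; _≡ₘ_; q; residue; residue-bijective;
     +-cong; +-congˡ; +-congʳ; *-cong; *-congˡ; *-congʳ; -‿cong; *-assoc; *-comm; *-identityˡ; *-identityʳ; zeroʳ; -‿inverseʳ)
  open LocalField 𝕂 using (val-∞; val-*; val-+; val-π; #-irrefl; tight; #⇒invertible; heytingCommutativeRing)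
  open ℤ⁺ using (_≤⁺_)
  open Relation.Binary.Construct.Add.Supremum.NonStrict ℤ._≤_ using ([_]; _≤⊤⁺; ≤⁺-trans; [≤]-injective)
  open import Algebra.Properties.AbelianGroup ℤ.+-0-abelianGroup using (∙-cancelˡ)

  commutativeRing : CommutativeRing 0ℓ 0ℓ
  commutativeRing = HeytingCommutativeRing.commutativeRing heytingCommutativeRing

  open CommutativeRing commutativeRing public using (refl; sym; trans)
  open IntegerCoefficients commutativeRing public

  1#≉0# : ¬ (1# ≈ 0#)
  1#≉0# 1≈0 = #-irrefl 1≈0 1#0
    where open import Algebra.Apartness.Properties.HeytingCommutativeRing heytingCommutativeRing using (1#0)

  private
    [≡] : ∀ {i j : ℤ} → _≡_ {A = ℤ ⁺} [ i ] [ j ] → i ≡ j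
    [≡] ≡.refl = ≡.refl

    i+i≡i⇒i≡0 : ∀ i → i ℤ.+ i ≡ i → i ≡ 0ℤ
    i+i≡i⇒i≡0 i i+i≡i = ∙-cancelˡ i i 0ℤ (≡.trans i+i≡i (≡.sym (ℤ.+-identityʳ i)))

    i+i≡0⇒i≡0 : ∀ i → i ℤ.+ i ≡ 0ℤ → i ≡ 0ℤ
    i+i≡0⇒i≡0 (+ zero) eq = ≡.refl

  val-0 : val 0# ≡ ⊤⁺
  val-0 = Equivalence.from (val-∞ 0#) refl

  val-1 : val 1# ≡ [ 0ℤ ]
  val-1 with val 1# in eq | val-* 1# 1# | val-cong (*-identityˡ 1#)
  ... | ⊤⁺    | _  | _  = contradiction (Equivalence.to (val-∞ 1#) eq) 1#≉0#
  ... | [ i ] | e₁ | e₂ = ≡.cong [_] (i+i≡i⇒i≡0 i ([≡] (≡.trans (≡.sym e₁) e₂)))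

  val-neg1 : val (- 1#) ≡ [ 0ℤ ]
  val-neg1 with val (- 1#) in eq | val-* (- 1#) (- 1#)
              | ≡.trans (val-cong (solve 0 ((:- :1) :* (:- :1) := :1) refl)) val-1
  ... | ⊤⁺    | e₁ | e₂ = contradiction (≡.trans (≡.sym e₁) e₂) λ ()
  ... | [ i ] | e₁ | e₂ = ≡.cong [_] (i+i≡0⇒i≡0 i ([≡] (≡.trans (≡.sym e₁) e₂)))

  val-neg : ∀ x → val (- x) ≡ val x
  val-neg x = ≡.trans (val-cong (solve 1 (λ x → :- x := (:- :1) :* x) refl x))
    (≡.trans (val-* (- 1#) x) (≡.trans (≡.cong (λ v → lift⁺ ℤ._+_ v (val x)) val-neg1) (identity (val x))))
    where
    identity : ∀ v → lift⁺ ℤ._+_ [ 0ℤ ] v ≡ v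
    identity [ i ] = ≡.cong [_] (ℤ.+-identityˡ i)
    identity ⊤⁺    = ≡.refl

  -- Divisibility by π ^ k in the ring of integers: `V 0` is integrality, `V 1` membership in the
  -- maximal ideal, and `V k (x - y)` congruence modulo π ^ k.
  V : ℕ → Carrier → Set
  V k x = [ + k ] ≤⁺ val x

  V-cong : ∀ {k x y} → x ≈ y → V k x → V k y
  V-cong {k} x≈y = ≡.subst ([ + k ] ≤⁺_) (val-cong x≈y)

  V-0# : ∀ {k} → V k 0#
  V-0# {k} = ≡.subst ([ + k ] ≤⁺_) (≡.sym val-0) (_ ≤⊤⁺)

  V0-1# : V 0 1#
  V0-1# = ≡.subst ([ 0ℤ ] ≤⁺_) (≡.sym val-1) [ ℤ.≤-refl ]

  ¬V1-1# : ¬ V 1 1#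
  ¬V1-1# v with ≡.subst ([ 1ℤ ] ≤⁺_) val-1 v
  ... | [ ℤ.+≤+ () ]

  V-+ : ∀ {k x y} → V k x → V k y → V k (x + y)
  V-+ {k} {x} {y} vx vy = ≤⁺-trans ℤ.≤-trans (⊓-glb vx vy) (val-+ x y)
    where open Min ℤ⁺.totalOrder using (⊓-glb)

  V-neg : ∀ {k x} → V k x → V k (- x)
  V-neg {k} {x} = ≡.subst ([ + k ] ≤⁺_) (≡.sym (val-neg x))

  V-minus : ∀ {k x y} → V k x → V k y → V k (x - y)
  V-minus vx vy = V-+ vx (V-neg vy)

  V-mono : ∀ {j k x} → j ℕ.≤ k → V k x → V j x
  V-mono j≤k = ≤⁺-trans ℤ.≤-trans [ ℤ.+≤+ j≤k ]

  V-* : ∀ {j k x y} → V j x → V k y → V (j ℕ.+ k) (x * y)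
  V-* {j} {k} {x} {y} vx vy = ≡.subst ([ + (j ℕ.+ k) ] ≤⁺_) (≡.sym (val-* x y)) (lemma vx vy)
    where
    lemma : ∀ {v w} → [ + j ] ≤⁺ v → [ + k ] ≤⁺ w → [ + (j ℕ.+ k) ] ≤⁺ lift⁺ ℤ._+_ v w
    lemma [ p ]    [ r ]    = [ ℤ.+-mono-≤ p r ]
    lemma [ p ]    (_ ≤⊤⁺) = _ ≤⊤⁺
    lemma (_ ≤⊤⁺) _        = _ ≤⊤⁺

  V-*ˡ : ∀ {k x y} → V 0 x → V k y → V k (x * y)
  V-*ˡ = V-*

  V-*ʳ : ∀ {k x y} → V k x → V 0 y → V k (x * y)
  V-*ʳ {x = x} {y} vx vy = V-cong (*-comm y x) (V-* vy vx)

  V-π* : ∀ {k x} → V k x → V (suc k) (π * x)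
  V-π* = V-* (≡.subst ([ 1ℤ ] ≤⁺_) (≡.sym val-π) [ ℤ.≤-refl ])

  V-π*⁻¹ : ∀ {k x} → V (suc k) (π * x) → V k x
  V-π*⁻¹ {k} {x} v = lemma (val x) (≡.subst ([ + suc k ] ≤⁺_)
    (≡.trans (val-* π x) (≡.cong (λ w → lift⁺ ℤ._+_ w (val x)) val-π)) v)
    where
    lemma : ∀ w → [ + suc k ] ≤⁺ lift⁺ ℤ._+_ [ 1ℤ ] w → [ + k ] ≤⁺ w
    lemma [ i ] [ p ] = [ ≡.subst (+ k ℤ.≤_) (ℤ.pred-suc i) (ℤ.pred-mono p) ]
    lemma ⊤⁺    _     = _ ≤⊤⁺

  -- A finite valuation i violates the condition at k = |i| + 1, so the valuation is infinite.
  V⇒≈0 : ∀ {x} → (∀ k → V k x) → x ≈ 0#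
  V⇒≈0 {x} v with val x in eq
  ... | ⊤⁺    = Equivalence.to (val-∞ x) eq
  ... | [ i ] = contradiction ([≤]-injective (v (suc ℤ.∣ i ∣)))
                  (ℤ.<⇒≱ (ℤ.≤-<-trans (i≤+∣i∣ i) (ℤ.+<+ ℕ.≤-refl)))
    where
    i≤+∣i∣ : ∀ i → i ℤ.≤ + ℤ.∣ i ∣
    i≤+∣i∣ (+ n)    = ℤ.≤-refl
    i≤+∣i∣ -[1+ n ] = ℤ.-≤+

  inverse : ∀ {x} → ¬ (x ≈ 0#) → ∃[ y ] x * y ≈ 1#
  inverse {x} x≉0 with em {P = x # 0#}
  ... | no ¬x#0 = contradiction (proj₁ (tight x 0#) ¬x#0) x≉0
  ... | yes x#0 with #⇒invertible x#0
  ...   | y , yx≈1 , _ = y , trans (solve 2 (λ x y → x :* y := y :* (x :- :0)) refl x y) yx≈1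

  divide-π : ∀ {x} → V 1 x → ∃[ y ] (V 0 y × x ≈ π * y)
  divide-π {x} vx with inverse {π} (λ π≈0 → contradiction (≡.trans (≡.sym val-π) (≡.trans (val-cong π≈0) val-0)) λ ())
  ... | i , πi≈1 = i * x , V-π*⁻¹ (V-cong x≈ vx) , x≈
    where
    x≈ : x ≈ π * (i * x)
    x≈ = sym (trans (sym (*-assoc π i x)) (trans (*-congʳ πi≈1) (*-identityˡ x)))

  V-unit* : ∀ {u x k} → IsUnit u → V k (u * x) → V k x
  V-unit* {u} {x} (_ , v , vv , uv≈1) vux = V-cong
    (trans (solve 3 (λ u v x → v :* (u :* x) := (u :* v) :* x) refl u v x)
      (trans (*-congʳ uv≈1) (*-identityˡ x))) (V-*ˡ vv vux)

  ¬V1⇒unit : ∀ {u} → V 0 u → ¬ V 1 u → IsUnit u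
  ¬V1⇒unit {u} vu ¬v1 with inverse {u} (λ u≈0 → ¬v1 (V-cong (sym u≈0) V-0#))
  ... | i , ui≈1 = vu , i , lemma (val u) (val i) (≡.trans (≡.sym (val-* u i)) (≡.trans (val-cong ui≈1) val-1)) vu ¬v1 , ui≈1
    where
    lemma : ∀ v w → lift⁺ ℤ._+_ v w ≡ [ 0ℤ ] → [ 0ℤ ] ≤⁺ v → ¬ [ 1ℤ ] ≤⁺ v → [ 0ℤ ] ≤⁺ w
    lemma [ + zero ]  [ j ] eq _ _ = [ ℤ.≤-reflexive (≡.trans (≡.sym ([≡] eq)) (ℤ.+-identityˡ j)) ]
    lemma [ + suc _ ] [ j ] eq _ ¬v1 = contradiction [ ℤ.+≤+ (s≤s z≤n) ] ¬v1
    lemma [ -[1+ _ ] ] [ _ ] _ [ () ] _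

  unit-1# : IsUnit 1#
  unit-1# = V0-1# , 1# , V0-1# , *-identityˡ 1#

  unit-* : ∀ {u v} → IsUnit u → IsUnit v → IsUnit (u * v)
  unit-* {u} {v} (vu , u′ , vu′ , uu′) (vv , v′ , vv′ , vv′≈) = V-*ˡ vu vv , u′ * v′ , V-*ˡ vu′ vv′ ,
    trans (solve 4 (λ u v a b → u :* v :* (a :* b) := (u :* a) :* (v :* b)) refl u v u′ v′)
      (trans (*-cong uu′ vv′≈) (*-identityˡ 1#))

  unit-inverse : ∀ {u} → IsUnit u → ∃[ v ] (IsUnit v × u * v ≈ 1#)
  unit-inverse {u} (vu , v , vv , uv≈1) = v , (vv , u , vu , trans (*-comm v u) uv≈1) , uv≈1

  -- With a single residue class, 0 and 1 would be congruent modulo π; with none, 1 would have no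
  -- class. The auxiliary `lemma` abstracts over q, a record field, so that it can be split.
  1<q : 1 ℕ.< q
  1<q = lemma q residue residue-bijective
    where
    open import Data.Fin.Base using (zero; suc)
    open import Function.Definitions using (Bijective)
    lemma : ∀ n (ρ : Fin n → IntegerRing) → Bijective _≡_ _≡ₘ_ ρ → 1 ℕ.< n
    lemma zero ρ (_ , surj) with () ← proj₁ (surj (1# , V0-1#))
    lemma (suc zero) ρ (_ , surj) with surj (1# , V0-1#) | surj (0# , V-0#)
    ... | zero , e₁ | zero , e₀ = contradiction
      (V-cong (solve 2 (λ z r → (r :- :0) :- (r :- :1) := :1) refl 0# _) (V-minus (e₀ ≡.refl) (e₁ ≡.refl))) ¬V1-1#
    lemma (suc (suc n)) ρ _ = s≤s (s≤s z≤n)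

-- Finite sums and tuples of digits coded by `Fin`.

module FiniteSums {c ℓ} (M : CommutativeMonoid c ℓ) where

  open CommutativeMonoid M
  open Algebra.Properties.CommutativeMonoid.Sum M public
  open Relation.Binary.Reasoning.Setoid setoid

  sum-single : ∀ {n} (i : Fin n) (f : Fin n → Carrier) → (∀ j → j ≢ i → f j ≈ ε) → sum f ≈ f i
  sum-single {suc n} i f f≈ε = begin
    sum f                        ≈⟨ sum-remove {i = i} f ⟩
    f i ∙ sum (f ∘ punchIn i)    ≈⟨ ∙-congˡ (sum-cong-≋ λ j → f≈ε (punchIn i j) (Fin.punchInᵢ≢i i j)) ⟩
    f i ∙ sum {n} (λ _ → ε)      ≈⟨ ∙-congˡ (sum-replicate-zero n) ⟩
    f i ∙ ε                      ≈⟨ identityʳ (f i) ⟩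
    f i                          ∎

  sum-↑ : ∀ m {n} (f : Fin (m ℕ.+ n) → Carrier) →
          sum f ≈ sum (λ i → f (i ↑ˡ n)) ∙ sum (λ j → f (m ↑ʳ j))
  sum-↑ zero    f = sym (identityˡ _)
  sum-↑ (suc m) f = trans (∙-congˡ (sum-↑ m (f ∘ suc))) (sym (assoc _ _ _))

  sum-combine : ∀ m n (f : Fin (m ℕ.* n) → Carrier) →
                sum f ≈ sum {m} (λ i → sum {n} (λ j → f (combine i j)))
  sum-combine zero    n f = refl
  sum-combine (suc m) n f = trans (sum-↑ n f) (∙-congˡ (sum-combine m n (f ∘ (n ↑ʳ_))))

finToFun-combine-zero : ∀ {b n} (i : Fin b) (j : Fin (b ℕ.^ n)) →
                        finToFun {b} {suc n} (combine i j) zero ≡ i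
finToFun-combine-zero i j = ≡.cong proj₁ (Fin.remQuot-combine i j)

finToFun-combine-suc : ∀ {b n} (i : Fin b) (j : Fin (b ℕ.^ n)) k →
                       finToFun {b} {suc n} (combine i j) (suc k) ≡ finToFun j k
finToFun-combine-suc {b} i j k = ≡.cong (λ p → finToFun (proj₂ p) k) (Fin.remQuot-combine {b} i j)

funToFin-cong : ∀ {m n} {f g : Fin m → Fin n} → (∀ i → f i ≡ g i) → funToFin f ≡ funToFin g
funToFin-cong {zero}  f≗g = ≡.refl
funToFin-cong {suc m} f≗g = ≡.cong₂ combine (f≗g zero) (funToFin-cong (f≗g ∘ suc))

finToFun-injective : ∀ {m n} {x y : Fin (n ℕ.^ m)} → (∀ i → finToFun {n} {m} x i ≡ finToFun y i) → x ≡ y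
finToFun-injective {m} {n} {x} {y} eq = ≡.trans (≡.sym (Fin.funToFin-finToFin {m} {n} x))
  (≡.trans (funToFin-cong eq) (Fin.funToFin-finToFin {m} {n} y))

-- Digit strings and random contractions of them.

-- A space of infinite strings of digits: x ≈[ k ] y says that the first k
-- digits of x and y agree.
record DigitSpace (m : ℕ) : Set₁ where
  field
    Point          : Set
    _≈[_]_         : Point → ℕ → Point → Set
    ≈-refl         : ∀ {k x} → x ≈[ k ] x
    ≈-sym          : ∀ {k x y} → x ≈[ k ] y → y ≈[ k ] x
    ≈-trans        : ∀ {k x y z} → x ≈[ k ] y → y ≈[ k ] z → x ≈[ k ] z
    ≈-zero         : ∀ x y → x ≈[ 0 ] y
    cons           : Fin m → Point → Point
    cons-cong      : ∀ {k δ x y} → x ≈[ k ] y → cons δ x ≈[ suc k ] cons δ y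
    cons-injective : ∀ {k δ ε x y} → cons δ x ≈[ suc k ] cons ε y → δ ≡ ε × x ≈[ k ] y
    head           : Point → Fin m
    tail           : Point → Point
    cons-head-tail : ∀ {k} x → x ≈[ k ] cons (head x) (tail x)
    origin         : Point

  head-tail-cong : ∀ {k x y} → x ≈[ suc k ] y → head x ≡ head y × tail x ≈[ k ] tail y
  head-tail-cong x≈y = cons-injective (≈-trans (≈-sym (cons-head-tail _)) (≈-trans x≈y (cons-head-tail _)))

  head-tail-cons : ∀ {k δ x} → head (cons δ x) ≡ δ × tail (cons δ x) ≈[ k ] x
  head-tail-cons = cons-injective (≈-sym (cons-head-tail _))

  Contraction : (Point → Point) → Set
  Contraction T = ∀ {k x y} → x ≈[ k ] y → T x ≈[ k ] T y

-- A tuple of s strings is read as one string over the product alphabet, whose letters are coded by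
-- `funToFin`; agreement to k digits is then agreement in every component.
power : ∀ {m} → DigitSpace m → ∀ s → DigitSpace (m ℕ.^ s)
power {m} D s = record
  { Point          = Fin s → Point
  ; _≈[_]_         = λ x k y → ∀ i → x i ≈[ k ] y i
  ; ≈-refl         = λ i → ≈-refl
  ; ≈-sym          = λ x≈y i → ≈-sym (x≈y i)
  ; ≈-trans        = λ x≈y y≈z i → ≈-trans (x≈y i) (y≈z i)
  ; ≈-zero         = λ x y i → ≈-zero (x i) (y i)
  ; cons           = λ δ x i → cons (finToFun δ i) (x i)
  ; cons-cong      = λ x≈y i → cons-cong (x≈y i)
  ; cons-injective = λ {k} {δ} {ε} x≈y →
      finToFun-injective {s} {m} {δ} {ε} (λ i → proj₁ (cons-injective (x≈y i))) , λ i → proj₂ (cons-injective (x≈y i))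
  ; head           = λ x → funToFin (head ∘ x)
  ; tail           = λ x i → tail (x i)
  ; cons-head-tail = λ {k} x i → ≡.subst (λ δ → x i ≈[ k ] cons δ (tail (x i)))
      (≡.sym (Fin.finToFun-funToFin (head ∘ x) i)) (cons-head-tail (x i))
  ; origin         = λ i → origin
  }
  where open DigitSpace D

-- The number of contractions of the strings of r digits: each of the m first digits receives an
-- image digit and, independently, a contraction of the tails.
treeCount : ℕ → ℕ → ℕ
treeCount m zero    = 1
treeCount m (suc r) = (m ℕ.* treeCount m r) ℕ.^ m

module RandomContractions {m : ℕ} (D : DigitSpace m) where

  open DigitSpace D

  -- The code c of a tree of depth suc r assigns to every digit δ the pair of
  -- a digit and the code of a tree of depth r.
  branch : ∀ r → Fin (treeCount m (suc r)) → Fin m → Fin m × Fin (treeCount m r)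
  branch r c δ = remQuot (treeCount m r) (finToFun c δ)

  evaluate : ∀ r → Fin (treeCount m r) → Point → Point
  evaluate zero    c x = origin
  evaluate (suc r) c x = cons (proj₁ (branch r c (head x))) (evaluate r (proj₂ (branch r c (head x))) (tail x))

  evaluate-contraction : ∀ r c → Contraction (evaluate r c)
  evaluate-contraction zero    c             x≈y = ≈-refl
  evaluate-contraction (suc r) c {zero}      x≈y = ≈-zero _ _
  evaluate-contraction (suc r) c {suc k} {x} {y} x≈y with head x | head y | head-tail-cong x≈y
  ... | δ | .δ | ≡.refl , tails≈ = cons-cong (evaluate-contraction r (proj₂ (branch r c δ)) tails≈)

  -- The strings on which T and the random map agree to k digits are determined by their first k
  -- digits, both maps being contractions. These prefixes form the branching tree, and `Match` says
  -- that it reaches depth r from a first digit in Q.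
  Match : ∀ r → (Point → Point) → Fin (treeCount m r) → (Fin m → Set) → Set
  Match r T c Q = ∃[ x ] (Q (head x) × T x ≈[ r ] evaluate r c x)

  -- For a contraction the first digit of the image depends on the first digit of the argument
  -- alone, so `origin` stands for an arbitrary tail.
  digit : (Point → Point) → Fin m → Fin m
  digit T δ = head (T (cons δ origin))

  subtree : (Point → Point) → Fin m → Point → Point
  subtree T δ x = tail (T (cons δ x))

  module _ {T : Point → Point} (contraction : Contraction T) where

    subtree-contraction : ∀ δ → Contraction (subtree T δ)
    subtree-contraction δ x≈y = proj₂ (head-tail-cong (contraction (cons-cong x≈y)))

    private
      T-cons : ∀ {k} δ x → T (cons δ x) ≈[ k ] cons (digit T δ) (subtree T δ x)
      T-cons {k} δ x = ≡.subst (λ e → T (cons δ x) ≈[ k ] cons e (subtree T δ x))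
        (proj₁ (head-tail-cong (contraction (cons-cong (≈-zero x origin))))) (cons-head-tail _)

    -- With `match-join` this is the branching recursion: the first digit δ must be mapped
    -- correctly, and the search then restarts below δ for a new contraction and an independent
    -- subtree.
    match-split : ∀ r c Q → Match (suc r) T c Q → ∃[ δ ] (Q δ × digit T δ ≡ proj₁ (branch r c δ) ×
                    Match r (subtree T δ) (proj₂ (branch r c δ)) (λ _ → ⊤))
    match-split r c Q (x , Qx , Tx≈) = head x , Qx , proj₁ split , tail x , tt , proj₂ split
      where split = cons-injective (≈-trans (≈-sym (T-cons (head x) (tail x)))
                      (≈-trans (contraction (≈-sym (cons-head-tail x))) Tx≈))

    match-join : ∀ r c Q δ → Q δ → digit T δ ≡ proj₁ (branch r c δ) →
                 Match r (subtree T δ) (proj₂ (branch r c δ)) (λ _ → ⊤) → Match (suc r) T c Q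
    match-join r c Q δ Qδ e≡ (x , _ , sub≈) = cons δ x , ≡.subst Q (≡.sym (proj₁ (head-tail-cons {0}))) Qδ ,
      ≈-trans (T-cons δ x) (≈-trans (≡.subst (λ e → cons (digit T δ) (subtree T δ x) ≈[ suc r ] cons e (subtree T δ x)) e≡ ≈-refl)
        (≈-trans (cons-cong sub≈) (≈-trans eval-cons (evaluate-contraction (suc r) c {suc r} ≈-refl))))
      where
      eval-cons : cons (proj₁ (branch r c δ)) (evaluate r (proj₂ (branch r c δ)) x) ≈[ suc r ] evaluate (suc r) c (cons δ x)
      eval-cons with head (cons δ x) | head-tail-cons {r} {δ} {x}
      ... | .δ | ≡.refl , tail≈ = cons-cong (evaluate-contraction r (proj₂ (branch r c δ)) (≈-sym tail≈))

-- Counting codes: independence and the extinction recursion.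

module Counting (em : ∀ {ℓ} → ExcludedMiddle ℓ) (R : CompleteOrderedField) where

  open Reals em R

  open import Algebra.Properties.Semiring.Sum semiring public using (*-distribˡ-sum; *-distribʳ-sum)
  open FiniteSums +-commutativeMonoid public using
    (sum; sum-cong-≋; sum-single; sum-combine; sum-replicate; ∑-distrib-+)
  open FiniteSums *-commutativeMonoid public using () renaming
    (sum to product; sum-cong-≋ to product-cong; sum-single to product-single;
     sum-combine to product-combine; sum-replicate to product-replicate; ∑-distrib-+ to product-distrib-*)

  select : Set → ℝ → ℝ → ℝ
  select P x y with em {P = P}
  ... | yes _ = x
  ... | no  _ = y

  select-yes : ∀ {P x y} → P → select P x y ≈ x
  select-yes {P} p with em {P = P}
  ... | yes _ = refl
  ... | no ¬p = contradiction p ¬p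

  select-no : ∀ {P x y} → ¬ P → select P x y ≈ y
  select-no {P} ¬p with em {P = P}
  ... | yes p = contradiction p ¬p
  ... | no  _ = refl

  select-cong : ∀ {P Q x y} → (P → Q) → (Q → P) → select P x y ≈ select Q x y
  select-cong {P} to from with em {P = P}
  ... | yes p = sym (select-yes (to p))
  ... | no ¬p = sym (select-no (¬p ∘ from))

  𝟙 : Set → ℝ
  𝟙 P = select P 1# 0#

  𝟙-cong : ∀ {P Q} → (P → Q) → (Q → P) → 𝟙 P ≈ 𝟙 Q
  𝟙-cong = select-cong

  𝟙-¬ : ∀ P → 𝟙 (¬ P) ≈ 1# - 𝟙 P
  𝟙-¬ P with em {P = P}
  ... | yes p = trans (select-no λ ¬p → ¬p p) (sym (-‿inverseʳ 1#))
  ... | no ¬p = trans (select-yes ¬p) (solve 0 (:1 := :1 :- :0) refl)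

  𝟙-∄ : ∀ {n} (P : Fin n → Set) → 𝟙 (¬ ∃ P) ≈ product (λ i → 𝟙 (¬ P i))
  𝟙-∄ {zero}  P = select-yes λ { (() , _) }
  𝟙-∄ {suc n} P with em {P = P zero}
  ... | yes p = trans (select-no λ ¬∃ → ¬∃ (zero , p))
                  (sym (trans (*-congʳ (select-no λ ¬p → ¬p p)) (zeroˡ _)))
  ... | no ¬p = trans (𝟙-cong (λ ¬∃ (i , pi) → ¬∃ (suc i , pi))
                               λ { ¬∃ (zero , p) → ¬p p ; ¬∃ (suc i , pi) → ¬∃ (i , pi) })
                  (trans (𝟙-∄ (P ∘ suc)) (sym (trans (*-congʳ (select-yes ¬p)) (*-identityˡ _))))

  sum-const : ∀ n x → sum {n} (λ _ → x) ≈ fromℕ n * x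
  sum-const zero    x = sym (zeroˡ x)
  sum-const (suc n) x = trans (+-congˡ (sum-const n x)) (solve 2 (λ n x → x :+ n :* x := (:1 :+ n) :* x) refl (fromℕ n) x)

  sum-difference : ∀ {n} (f g : Fin n → ℝ) → sum (λ i → f i - g i) ≈ sum f - sum g
  sum-difference {zero}  f g = sym (-‿inverseʳ 0#)
  sum-difference {suc n} f g = trans (+-congˡ (sum-difference (f ∘ suc) (g ∘ suc)))
    (solve 4 (λ a b c d → a :- b :+ (c :- d) := a :+ c :- (b :+ d)) refl _ _ _ _)

  -- Independence of the components of a uniform code: after division by b ^ n, the mean of a
  -- product is the product of the means.
  product-sum : ∀ b n (f : Fin n → Fin b → ℝ) →
                sum {b ℕ.^ n} (λ c → product (λ i → f i (finToFun c i))) ≈ product (λ i → sum (f i))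
  product-sum b zero    f = +-identityʳ 1#
  product-sum b (suc n) f = begin
    sum {b ℕ.^ suc n} (λ c → product (λ i → f i (finToFun c i)))
      ≈⟨ sum-combine b (b ℕ.^ n) (λ c → product (λ i → f i (finToFun c i))) ⟩
    sum {b} (λ i → sum {b ℕ.^ n} (λ j → product (λ k → f k (finToFun {b} {suc n} (combine i j) k))))
      ≈⟨ sum-cong-≋ (λ i → sum-cong-≋ {b ℕ.^ n} λ j → *-cong
           (reflexive (≡.cong (f zero) (finToFun-combine-zero {b} {n} i j)))
           (product-cong λ k → reflexive (≡.cong (f (suc k)) (finToFun-combine-suc {b} {n} i j k)))) ⟩
    sum {b} (λ i → sum {b ℕ.^ n} (λ j → f zero i * product (λ k → f (suc k) (finToFun j k))))
      ≈⟨ sum-cong-≋ (λ i → trans (sym (*-distribˡ-sum {b ℕ.^ n} (f zero i) _)) (*-congˡ (product-sum b n (f ∘ suc)))) ⟩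
    sum {b} (λ i → f zero i * product (λ k → sum (f (suc k))))
      ≈⟨ *-distribʳ-sum _ (f zero) ⟨
    sum (f zero) * product (λ k → sum (f (suc k)))  ∎
    where open ≈-Reasoning

  module Survival (m : ℕ) where

    -- The map sending x to (1 - (1 - x) / m) ^ m is the generating function of Binomial (m , 1 /
    -- m); each generation applies it once to the extinction probability 1 - `survival r`.
    survival : ℕ → ℝ
    survival zero    = 1#
    survival (suc r) = 1# - (1# - survival r * fromℕ m ⁻¹) ^ m

    -- The probability that a given potential child is absent or has no descendants r generations
    -- later.
    branchDeath : ℕ → ℝ
    branchDeath r = 1# - survival r * fromℕ m ⁻¹

  module _ {m : ℕ} (0<m : 0 ℕ.< m) (D : DigitSpace m) where

    open DigitSpace D
    open RandomContractions D
    open Survival m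

    private
      N = treeCount m

      fromℕ-pow : ∀ b n → product {n} (λ _ → fromℕ b) ≈ fromℕ (b ℕ.^ n)
      fromℕ-pow b n = trans (product-replicate n) (sym (fromℕ-^ b n))

    -- Whatever T is, among the m digits that c may assign to δ exactly one
    -- agrees with T.
    count-unmatched-branch : ∀ r {T} → Contraction T →
      sum (λ c → 𝟙 (¬ Match r T c (λ _ → ⊤))) ≈ fromℕ (N r) * (1# - survival r) →
      ∀ e (Q : Set) →
      sum {m ℕ.* N r} (λ x → 𝟙 (¬ (Q × e ≡ proj₁ (remQuot (N r) x) × Match r T (proj₂ (remQuot {m} (N r) x)) (λ _ → ⊤))))
        ≈ fromℕ (m ℕ.* N r) * select Q (branchDeath r) 1#
    count-unmatched-branch r {T} contraction unmatched e Q = begin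
      sum {m ℕ.* N r} (λ x → 𝟙 (¬ Event (remQuot (N r) x)))
        ≈⟨ sum-combine m (N r) (λ x → 𝟙 (¬ Event (remQuot (N r) x))) ⟩
      sum {m} (λ i → sum {N r} (λ j → 𝟙 (¬ Event (remQuot (N r) (combine i j)))))
        ≈⟨ sum-cong-≋ (λ i → sum-cong-≋ {N r} λ j → reflexive (≡.cong (λ p → 𝟙 (¬ Event p)) (Fin.remQuot-combine i j))) ⟩
      sum {m} (λ i → sum {N r} (λ j → 𝟙 (¬ Event (i , j))))
        ≈⟨ lemma ⟩
      fromℕ (m ℕ.* N r) * select Q (branchDeath r) 1#  ∎
      where
      open ≈-Reasoning
      Event : Fin m × Fin (N r) → Set
      Event (i , j) = Q × e ≡ i × Match r T j (λ _ → ⊤)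

      full : sum {m} (λ _ → fromℕ (N r)) ≈ fromℕ (m ℕ.* N r)
      full = trans (sum-const m _) (sym (fromℕ-* m (N r)))

      all : sum {N r} (λ _ → 1#) ≈ fromℕ (N r)
      all = trans (sum-const (N r) 1#) (*-identityʳ _)

      lemma : sum {m} (λ i → sum {N r} (λ j → 𝟙 (¬ Event (i , j)))) ≈ fromℕ (m ℕ.* N r) * select Q (branchDeath r) 1#
      lemma with em {P = Q}
      ... | no ¬q = trans (sum-cong-≋ {m} λ i → trans (sum-cong-≋ {N r} λ j → select-yes λ ev → ¬q (proj₁ ev)) all)
                      (trans full (sym (*-identityʳ _)))
      ... | yes q = begin
        sum {m} (λ i → sum {N r} (λ j → 𝟙 (¬ Event (i , j))))
          -- Only the row i = e loses anything: there N r * `survival r` of the subtrees match.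
          ≈⟨ sum-cong-≋ row ⟩
        sum {m} (λ i → fromℕ (N r) - select (e ≡ i) (fromℕ (N r) * survival r) 0#)
          ≈⟨ sum-difference {m} _ _ ⟩
        sum {m} (λ i → fromℕ (N r)) - sum (λ i → select (e ≡ i) (fromℕ (N r) * survival r) 0#)
          ≈⟨ +-cong full (-‿cong (trans (sum-single e _ λ i i≢e → select-no λ e≡i → i≢e (≡.sym e≡i)) (select-yes ≡.refl))) ⟩
        fromℕ (m ℕ.* N r) - fromℕ (N r) * survival r
          ≈⟨ +-congˡ (-‿cong (*-congʳ (trans (sym (*-identityˡ _)) (*-congʳ (sym (⁻¹-inverse (fromℕ-pos 0<m))))))) ⟩
        fromℕ (m ℕ.* N r) - fromℕ m * fromℕ m ⁻¹ * fromℕ (N r) * survival r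
          ≈⟨ +-congʳ (fromℕ-* m (N r)) ⟩
        fromℕ m * fromℕ (N r) - fromℕ m * fromℕ m ⁻¹ * fromℕ (N r) * survival r
          ≈⟨ solve 4 (λ m n i s → m :* n :- m :* i :* n :* s := (m :* n) :* (:1 :- s :* i)) refl (fromℕ m) (fromℕ (N r)) (fromℕ m ⁻¹) (survival r) ⟩
        (fromℕ m * fromℕ (N r)) * branchDeath r
          ≈⟨ *-congʳ (fromℕ-* m (N r)) ⟨
        fromℕ (m ℕ.* N r) * branchDeath r  ∎
        where
        row : ∀ i → sum {N r} (λ j → 𝟙 (¬ Event (i , j))) ≈ fromℕ (N r) - select (e ≡ i) (fromℕ (N r) * survival r) 0#
        row i with em {P = e ≡ i}
        ... | yes e≡i = trans (sum-cong-≋ {N r} λ j → 𝟙-cong (λ ¬ev match → ¬ev (q , e≡i , match)) λ ¬match ev → ¬match (proj₂ (proj₂ ev)))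
                          (trans unmatched (solve 2 (λ n s → n :* (:1 :- s) := n :- n :* s) refl _ _))
        ... | no  e≢i = trans (sum-cong-≋ {N r} λ j → select-yes λ ev → e≢i (proj₁ (proj₂ ev)))
                          (trans all (solve 1 (λ n → n := n :- :0) refl _))

    -- The count is the same for all contractions T. This generality is what the induction rests on,
    -- since each digit leads to a different `subtree T δ`.
    count-unmatched : ∀ r {T} → Contraction T →
      sum (λ c → 𝟙 (¬ Match r T c (λ _ → ⊤))) ≈ fromℕ (N r) * (1# - survival r)

    -- Distinct first digits have independent codes, so their chances of failure multiply; a digit
    -- excluded by Q fails surely and contributes the factor 1. The restriction Q will single out
    -- the directions belonging to one chart.
    count-unmatchedOn : ∀ r {T} → Contraction T → (Q : Fin m → Set) →
      sum (λ c → 𝟙 (¬ Match (suc r) T c Q)) ≈ fromℕ (N (suc r)) * product (λ δ → select (Q δ) (branchDeath r) 1#)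

    count-unmatched zero {T} contraction = trans
      (+-congʳ (select-no λ ¬match → ¬match (origin , tt , ≈-zero _ _)))
      (solve 0 (:0 :+ :0 := (:1 :+ :0) :* (:1 :- :1)) refl)
    count-unmatched (suc r) contraction = trans (count-unmatchedOn r contraction (λ _ → ⊤))
      (*-congˡ (trans (product-cong {m} λ δ → select-yes tt) (trans (product-replicate m)
        (solve 1 (λ x → x := :1 :- (:1 :- x)) refl _))))

    count-unmatchedOn r {T} contraction Q = begin
      sum (λ c → 𝟙 (¬ Match (suc r) T c Q))
        ≈⟨ sum-cong-≋ {N (suc r)} (λ c → 𝟙-cong
             (λ ¬match (δ , Qδ , e≡ , sub) → ¬match (match-join contraction r c Q δ Qδ e≡ sub))
             (λ ¬∃ match → ¬∃ (match-split contraction r c Q match))) ⟩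
      sum (λ c → 𝟙 (¬ ∃ λ δ → Event δ (finToFun c δ)))
        ≈⟨ sum-cong-≋ {N (suc r)} (λ c → 𝟙-∄ (λ δ → Event δ (finToFun c δ))) ⟩
      sum (λ c → product (λ δ → 𝟙 (¬ Event δ (finToFun c δ))))
        ≈⟨ product-sum (m ℕ.* N r) m (λ δ x → 𝟙 (¬ Event δ x)) ⟩
      product (λ δ → sum (λ x → 𝟙 (¬ Event δ x)))
        ≈⟨ product-cong (λ δ → count-unmatched-branch r (subtree-contraction contraction δ)
             (count-unmatched r (subtree-contraction contraction δ)) (digit T δ) (Q δ)) ⟩
      product (λ δ → fromℕ (m ℕ.* N r) * select (Q δ) (branchDeath r) 1#)
        ≈⟨ product-distrib-* {m} _ _ ⟩
      product {m} (λ δ → fromℕ (m ℕ.* N r)) * product (λ δ → select (Q δ) (branchDeath r) 1#)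
        ≈⟨ *-congʳ (fromℕ-pow (m ℕ.* N r) m) ⟩
      fromℕ (N (suc r)) * product (λ δ → select (Q δ) (branchDeath r) 1#)  ∎
      where
      open ≈-Reasoning
      Event : Fin m → Fin (m ℕ.* N r) → Set
      Event δ x = Q δ × digit T δ ≡ proj₁ (remQuot (N r) x) × Match r (subtree T δ) (proj₂ (remQuot {m} (N r) x)) (λ _ → ⊤)

  LeadingDigits : ∀ {q} → Fin q → ∀ s → ℕ → Fin (q ℕ.^ s) → Set
  LeadingDigits z s j δ = ∀ i → toℕ i ℕ.< j → finToFun {n = s} δ i ≡ z

  -- Exactly q ^ (s - j) letters carry the factor w: their first j components are forced to be z and
  -- the others are free.
  product-leadingDigits : ∀ {q} (z : Fin q) s {j} w → j ℕ.≤ s →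
    product {q ℕ.^ s} (λ δ → select (LeadingDigits z s j δ) w 1#) ≈ w ^ (q ℕ.^ (s ℕ.∸ j))
  product-leadingDigits {q} z s {zero} w z≤n =
    trans (product-cong {q ℕ.^ s} λ δ → select-yes λ i ()) (product-replicate (q ℕ.^ s))
  product-leadingDigits {q} z (suc s) {suc j} w (s≤s j≤s) = begin
    product {q ℕ.^ suc s} (λ δ → select (LeadingDigits z (suc s) (suc j) δ) w 1#)
      ≈⟨ product-combine q (q ℕ.^ s) (λ δ → select (LeadingDigits z (suc s) (suc j) δ) w 1#) ⟩
    product {q} (λ e → product {q ℕ.^ s} (λ δ → select (LeadingDigits z (suc s) (suc j) (combine e δ)) w 1#))
      ≈⟨ product-single z _ (λ e e≢z → trans
           (product-cong {q ℕ.^ s} λ δ → select-no λ leading →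
             e≢z (≡.trans (≡.sym (finToFun-combine-zero {q} {s} e δ)) (leading zero (s≤s z≤n))))
           (trans (product-replicate (q ℕ.^ s)) (1^n≈1 (q ℕ.^ s)))) ⟩
    product {q ℕ.^ s} (λ δ → select (LeadingDigits z (suc s) (suc j) (combine z δ)) w 1#)
      ≈⟨ product-cong {q ℕ.^ s} (λ δ → select-cong
           (λ leading i i<j → ≡.trans (≡.sym (finToFun-combine-suc {q} {s} z δ i)) (leading (suc i) (s≤s i<j)))
           (λ { leading zero    _         → finToFun-combine-zero {q} {s} z δ
              ; leading (suc i) (s≤s i<j) → ≡.trans (finToFun-combine-suc {q} {s} z δ i) (leading i i<j) })) ⟩
    product {q ℕ.^ s} (λ δ → select (LeadingDigits z s j δ) w 1#)
      ≈⟨ product-leadingDigits z s w j≤s ⟩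
    w ^ (q ℕ.^ (s ℕ.∸ j))  ∎
    where open ≈-Reasoning

  -- The number of points of the projective space of dimension d - 1 over a
  -- field with q elements.
  lineCount : ℕ → ℕ → ℕ
  lineCount q zero    = 0
  lineCount q (suc s) = q ℕ.^ s ℕ.+ lineCount q s

  -- Sorted by their first nonzero coordinate j, the lines over the residue field number q ^ (s - j)
  -- for each j, so the exponents add up to the total number of lines.
  product-powers : ∀ q s w → product {suc s} (λ j → w ^ (q ℕ.^ (s ℕ.∸ toℕ j))) ≈ w ^ lineCount q (suc s)
  product-powers q zero    w = trans (*-congˡ refl) (trans (*-identityʳ _) refl)
  product-powers q (suc s) w = trans (*-congˡ (product-powers q s w)) (sym (^-homo-* w (q ℕ.^ suc s) (lineCount q (suc s))))

-- Finite values among the extended reals.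

module ExtendedReals (em : ∀ {ℓ} → ExcludedMiddle ℓ) (R : CompleteOrderedField) where

  open Reals em R
  open Relation.Binary.Construct.Add.Supremum.NonStrict _≤_ public using ([_]; _≤⊤⁺)
  open Relation.Binary.Construct.Add.Supremum.NonStrict _≤_ using (≤⁺-antisym)
  open Relation.Binary.Construct.Add.Point.Equality _≈_ public using ([_]) renaming (∙≈∙ to ⊤⁺≈⊤⁺)

  finitePart-cong : ∀ {x y} → x ≈⁺ y → finitePart x ≈ finitePart y
  finitePart-cong [ x≈y ] = x≈y
  finitePart-cong ⊤⁺≈⊤⁺   = refl

  ≤⁺-finite : ∀ {x y} → x ≤⁺ y → y ≈⁺ [ finitePart y ] → x ≈⁺ [ finitePart x ]
  ≤⁺-finite [ _ ] _ = [ refl ]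

  finitePart-mono : ∀ {x y} → x ≤⁺ y → y ≈⁺ [ finitePart y ] → finitePart x ≤ finitePart y
  finitePart-mono [ x≤y ] _ = x≤y

  ≈⁺⇒finite : ∀ {x y} → x ≈⁺ [ y ] → x ≈⁺ [ finitePart x ]
  ≈⁺⇒finite [ _ ] = [ refl ]

  finite-≈⁺ : ∀ {x y} → x ≈⁺ y → y ≈⁺ [ finitePart y ] → x ≈⁺ [ finitePart x ]
  finite-≈⁺ [ _ ] _ = [ refl ]

  ·⁺-finite : ∀ c {x} → x ≈⁺ [ finitePart x ] → (c ·⁺ x) ≈⁺ [ c * finitePart x ]
  ·⁺-finite c [ _ ] = [ refl ]

  sup⁺-isLub : ∀ {p} {P : Pred (ℝ ⁺) p} {s} → IsLub _≤⁺_ P s → sup⁺ P ≈⁺ s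
  sup⁺-isLub {P = P} {s} s-lub@(s-upper , s-least) with em {P = ∃ (IsLub _≤⁺_ P)}
  ... | yes (t , t-upper , t-least) = ≤⁺-antisym antisym (t-least s s-upper) (s-least t t-upper)
  ... | no ¬lub = contradiction (s , s-lub) ¬lub

-- Step functions, the Lebesgue integral and invariance.

module MeasureTheory (em : ∀ {ℓ} → ExcludedMiddle ℓ) (R : CompleteOrderedField)
  {X : Set} (Near : ClassicalReals.ℝ em R → X → X → Set) (Sum : X → X → X → Set) where

  open Reals em R
  open Counting em R
  open ExtendedReals em R
  open Measures Near Sum

  borel-∅ : Borel ∅
  borel-∅ = isOpen λ _ ()

  -- Unions and additivity are given for sequences of sets; two sets become a sequence by padding
  -- with `∅`.
  pair : Pred X 0ℓ → Pred X 0ℓ → ℕ → Pred X 0ℓ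
  pair A B zero          = A
  pair A B (suc zero)    = B
  pair A B (suc (suc _)) = ∅

  borel-pair : ∀ {A B} → Borel A → Borel B → ∀ n → Borel (pair A B n)
  borel-pair A B zero          = A
  borel-pair A B (suc zero)    = B
  borel-pair A B (suc (suc _)) = borel-∅

  disjoint-pair : ∀ {A B} → (∀ x → ¬ (x ∈ A × x ∈ B)) → Disjoint (pair A B)
  disjoint-pair A∩B=∅ zero       zero       0≢0 x _         = 0≢0 ≡.refl
  disjoint-pair A∩B=∅ zero       (suc zero) _   x x∈        = A∩B=∅ x x∈
  disjoint-pair A∩B=∅ (suc zero) zero       _   x (x∈B , x∈A) = A∩B=∅ x (x∈A , x∈B)
  disjoint-pair A∩B=∅ (suc zero) (suc zero) 1≢1 x _         = 1≢1 ≡.refl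
  disjoint-pair A∩B=∅ (suc (suc _)) _          _ x (() , _)
  disjoint-pair A∩B=∅ zero       (suc (suc _)) _ x (_ , ())
  disjoint-pair A∩B=∅ (suc zero) (suc (suc _)) _ x (_ , ())

  borel-∪ : ∀ {A B} → Borel A → Borel B → Borel (A ∪ B)
  borel-∪ {A} {B} bA bB = resp ((λ {x} → to x) , λ {x} → from x) (union (borel-pair bA bB))
    where
    to : ∀ x → x ∈ ⋃ ℕ (pair A B) → x ∈ A ∪ B
    to x (zero , x∈A)         = inj₁ x∈A
    to x (suc zero , x∈B)     = inj₂ x∈B
    from : ∀ x → x ∈ A ∪ B → x ∈ ⋃ ℕ (pair A B)
    from x (inj₁ x∈A) = zero , x∈A
    from x (inj₂ x∈B) = suc zero , x∈B

  borel-∩ : ∀ {A B} → Borel A → Borel B → Borel (A ∩ B)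
  borel-∩ {A} {B} bA bB = resp ((λ {x} → to x) , λ {x} → from x) (compl (borel-∪ (compl bA) (compl bB)))
    where
    to : ∀ x → x ∈ ∁ (∁ A ∪ ∁ B) → x ∈ A ∩ B
    to x ¬∪ with em {P = x ∈ A} | em {P = x ∈ B}
    ... | yes x∈A | yes x∈B = x∈A , x∈B
    ... | no  x∉A | _       = ⊥-elim (¬∪ (inj₁ x∉A))
    ... | yes _   | no x∉B  = ⊥-elim (¬∪ (inj₂ x∉B))
    from : ∀ x → x ∈ A ∩ B → x ∈ ∁ (∁ A ∪ ∁ B)
    from x (x∈A , x∈B) (inj₁ x∉A) = x∉A x∈A
    from x (x∈A , x∈B) (inj₂ x∉B) = x∉B x∈B

  borel-U : Borel U
  borel-U = resp ((λ _ → tt) , λ _ ()) (compl borel-∅)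

  -- Unlike a `SimpleFunction`, a list of terms may have overlapping sets and negative weights, so
  -- that sums, multiples and differences of step functions come from concatenation and scaling
  -- alone.
  record Term : Set₁ where
    constructor term
    field
      weight : ℝ
      set    : Pred X 0ℓ
      borel  : Borel set

  valueAt : List Term → X → ℝ
  valueAt []                 x = 0#
  valueAt (term w A _ ∷ L) x = w * 𝟙 (x ∈ A) + valueAt L x

  scale : ℝ → List Term → List Term
  scale κ []                = []
  scale κ (term w A bA ∷ L) = term (κ * w) A bA ∷ scale κ L

  valueAt-++ : ∀ L L′ x → valueAt (L ++ L′) x ≈ valueAt L x + valueAt L′ x
  valueAt-++ []      L′ x = sym (+-identityˡ _)
  valueAt-++ (_ ∷ L) L′ x = trans (+-congˡ (valueAt-++ L L′ x)) (sym (+-assoc _ _ _))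

  valueAt-scale : ∀ κ L x → valueAt (scale κ L) x ≈ κ * valueAt L x
  valueAt-scale κ []               x = sym (zeroʳ κ)
  valueAt-scale κ (term w A _ ∷ L) x = trans (+-congˡ (valueAt-scale κ L x))
    (solve 4 (λ κ w i v → κ :* w :* i :+ κ :* v := κ :* (w :* i :+ v)) refl κ w _ _)

  module _ (m : Measure) where

    open Measure m

    mass : Pred X 0ℓ → ℝ
    mass A = finitePart (μ A)

    Finite : Pred X 0ℓ → Set
    Finite A = μ A ≈⁺ [ mass A ]

    mass-cong : ∀ {A B} → A ≐ B → mass A ≈ mass B
    mass-cong A≐B = finitePart-cong (μ-cong A≐B)

    mass-nonneg : ∀ A → 0# ≤ mass A
    mass-nonneg A with μ A | μ-nonneg A
    ... | [ x ] | [ 0≤x ] = 0≤x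
    ... | ⊤⁺    | _       = ≤-refl

    mass-∅ : mass ∅ ≈ 0#
    mass-∅ = finitePart-cong μ-∅

    private
      module _ {A E : Pred X 0ℓ} (bA : Borel A) (bE : Borel E) where
        parts : ℕ → Pred X 0ℓ
        parts = pair (E ∩ A) (E ∩ ∁ A)

        parts-cover : ⋃ ℕ parts ≐ E
        parts-cover = (λ {x} → to x) , λ {x} → from x
          where
          to : ∀ x → x ∈ ⋃ ℕ parts → x ∈ E
          to x (zero     , x∈E , _) = x∈E
          to x (suc zero , x∈E , _) = x∈E
          from : ∀ x → x ∈ E → x ∈ ⋃ ℕ parts
          from x x∈E with em {P = x ∈ A}
          ... | yes x∈A = zero , x∈E , x∈A
          ... | no  x∉A = suc zero , x∈E , x∉A

        parts-lub : IsLub _≤⁺_ (λ s → ∃[ n ] (s ≡ sum⁺ {n} (λ i → μ (parts (toℕ i))))) (μ (⋃ ℕ parts))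
        parts-lub = μ-additive parts (borel-pair (borel-∩ bE bA) (borel-∩ bE (compl bA)))
          (disjoint-pair λ { x ((_ , x∈A) , (_ , x∉A)) → x∉A x∈A })

    -- The first partial sum for the decomposition of E into E ∩ A and E ∩ ∁ A is at most the finite
    -- μ E.
    ∩-finite : ∀ {A E} → Borel A → Borel E → Finite E → Finite (E ∩ A)
    ∩-finite {A} {E} bA bE finite-E = summand (≤⁺-finite (proj₁ (parts-lub bA bE) _ (1 , ≡.refl))
        (finite-≈⁺ (μ-cong (parts-cover bA bE)) finite-E))
      where
      summand : ∀ {x} → (x +⁺ [ 0# ]) ≈⁺ [ finitePart (x +⁺ [ 0# ]) ] → x ≈⁺ [ finitePart x ]
      summand {[ _ ]} _ = [ refl ]

    -- Every partial sum for the padded decomposition is at most a + b, and the one of length 2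
    -- attains it, so a + b is the supremum.
    mass-split : ∀ {A E} → Borel A → Borel E → Finite E →
                 mass E ≈ mass (E ∩ A) + mass (E ∩ ∁ A)
    mass-split {A} {E} bA bE finite-E = trans (sym (finitePart-cong whole)) (antisym
        (finitePart-mono {y = [ a + b ]} (proj₂ (parts-lub bA bE) [ a + b ] λ { _ (n , ≡.refl) → partial n }) [ refl ])
        (≤-respˡ-≈ (trans (+-congˡ (+-identityʳ b)) refl)
          (≤-respˡ-≈ (finitePart-cong two) (finitePart-mono (proj₁ (parts-lub bA bE) _ (2 , ≡.refl)) (finite-≈⁺ whole finite-E)))))
      where
      a = mass (E ∩ A)
      b = mass (E ∩ ∁ A)
      whole : μ (⋃ ℕ (parts bA bE)) ≈⁺ μ E
      whole = μ-cong (parts-cover bA bE)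
      finite-a : Finite (E ∩ A)
      finite-a = ∩-finite bA bE finite-E
      finite-b : Finite (E ∩ ∁ A)
      finite-b = ∩-finite (compl bA) bE finite-E
      cong₂⁺ : ∀ {x x′ y y′} → x ≈⁺ x′ → y ≈⁺ y′ → (x +⁺ y) ≈⁺ (x′ +⁺ y′)
      cong₂⁺ [ p ]  [ r ]  = [ +-cong p r ]
      cong₂⁺ [ _ ]  ⊤⁺≈⊤⁺  = ⊤⁺≈⊤⁺
      cong₂⁺ ⊤⁺≈⊤⁺  _      = ⊤⁺≈⊤⁺
      zeros : ∀ n → sum⁺ {n} (λ _ → μ ∅) ≈⁺ [ 0# ]
      zeros zero    = [ refl ]
      zeros (suc n) = ≈⁺-trans (cong₂⁺ μ-∅ (zeros n)) [ +-identityˡ 0# ]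
        where ≈⁺-trans = Relation.Binary.Construct.Add.Point.Equality.≈∙-trans _≈_ trans
      two : (μ (E ∩ A) +⁺ (μ (E ∩ ∁ A) +⁺ [ 0# ])) ≈⁺ [ a + (b + 0#) ]
      two = cong₂⁺ finite-a (cong₂⁺ finite-b [ refl ])
      from-≈⁺ : ∀ {x y z} → x ≈⁺ [ y ] → y ≤ z → x ≤⁺ [ z ]
      from-≈⁺ [ x≈y ] y≤z = [ ≤-respˡ-≈ (sym x≈y) y≤z ]
      partial : ∀ n → sum⁺ {n} (λ i → μ (parts bA bE (toℕ i))) ≤⁺ [ a + b ]
      partial zero          = [ +-nonneg (mass-nonneg _) (mass-nonneg _) ]
      partial (suc zero)    = from-≈⁺ (cong₂⁺ finite-a [ refl ]) (+-monoʳ-≤ a (mass-nonneg _))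
      partial (suc (suc n)) = from-≈⁺ (cong₂⁺ finite-a (cong₂⁺ finite-b (zeros n))) (≤-reflexive (+-congˡ (+-identityʳ b)))

    totalOn : Pred X 0ℓ → List Term → ℝ
    totalOn E []               = 0#
    totalOn E (term w A _ ∷ L) = w * mass (E ∩ A) + totalOn E L

    totalOn-++ : ∀ E L L′ → totalOn E (L ++ L′) ≈ totalOn E L + totalOn E L′
    totalOn-++ E []      L′ = sym (+-identityˡ _)
    totalOn-++ E (_ ∷ L) L′ = trans (+-congˡ (totalOn-++ E L L′)) (sym (+-assoc _ _ _))

    totalOn-scale : ∀ E κ L → totalOn E (scale κ L) ≈ κ * totalOn E L
    totalOn-scale E κ []               = sym (zeroʳ κ)
    totalOn-scale E κ (term w A _ ∷ L) = trans (+-congˡ (totalOn-scale E κ L))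
      (solve 4 (λ κ w i v → κ :* w :* i :+ κ :* v := κ :* (w :* i :+ v)) refl κ w _ _)

    totalOn-split : ∀ {A E} → Borel A → Borel E → Finite E → ∀ L →
                    totalOn E L ≈ totalOn (E ∩ A) L + totalOn (E ∩ ∁ A) L
    totalOn-split bA bE finite-E [] = sym (+-identityˡ 0#)
    totalOn-split {A} {E} bA bE finite-E (term w B bB ∷ L) = trans
      (+-cong (*-congˡ (trans (mass-split bA (borel-∩ bE bB) (∩-finite bB bE finite-E))
        (+-cong (mass-cong swap) (mass-cong swap)))) (totalOn-split bA bE finite-E L))
      (solve 5 (λ w a b c d → w :* (a :+ b) :+ (c :+ d) := w :* a :+ c :+ (w :* b :+ d)) refl w _ _ _ _)
      where
      swap : ∀ {A B C : Pred X 0ℓ} → ((A ∩ B) ∩ C) ≐ ((A ∩ C) ∩ B)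
      swap = (λ { ((a , b) , c) → (a , c) , b }) , λ { ((a , c) , b) → (a , b) , c }

    -- Cutting E along the sets of L, one after the other, makes the integrand
    -- constant on each piece.
    totalOn-nonneg : ∀ {E} κ L → Borel E → Finite E →
                     (∀ x → x ∈ E → 0# ≤ κ + valueAt L x) → 0# ≤ κ * mass E + totalOn E L
    totalOn-nonneg {E} κ [] bE finite-E 0≤ with em {P = ∃[ x ] x ∈ E}
    ... | yes (x , x∈E) = ≤-respʳ-≈ (sym (+-identityʳ _)) (*-nonneg (≤-respʳ-≈ (+-identityʳ κ) (0≤ x x∈E)) (mass-nonneg E))
    ... | no E=∅ = ≤-reflexive (sym (trans (+-identityʳ _) (trans (*-congˡ (trans
                     (mass-cong ((λ {x} x∈E → E=∅ (x , x∈E)) , λ ())) mass-∅)) (zeroʳ κ))))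
    totalOn-nonneg {E} κ (term w A bA ∷ L) bE finite-E 0≤ = ≤-respʳ-≈ (sym (begin
        κ * mass E + (w * mass (E ∩ A) + totalOn E L)
          ≈⟨ +-cong (*-congˡ (mass-split bA bE finite-E)) (+-congˡ (totalOn-split bA bE finite-E L)) ⟩
        κ * (mass (E ∩ A) + mass (E ∩ ∁ A)) + (w * mass (E ∩ A) + (totalOn (E ∩ A) L + totalOn (E ∩ ∁ A) L))
          ≈⟨ solve 6 (λ κ w a b c d → κ :* (a :+ b) :+ (w :* a :+ (c :+ d)) :=
               ((κ :+ w) :* a :+ c) :+ (κ :* b :+ d)) refl κ w _ _ _ _ ⟩
        ((κ + w) * mass (E ∩ A) + totalOn (E ∩ A) L) + (κ * mass (E ∩ ∁ A) + totalOn (E ∩ ∁ A) L)  ∎))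
      (+-nonneg
        (totalOn-nonneg (κ + w) L (borel-∩ bE bA) (∩-finite bA bE finite-E) λ { x (x∈E , x∈A) →
          ≤-respʳ-≈ (trans (+-congˡ (+-congʳ (trans (*-congˡ (select-yes x∈A)) (*-identityʳ w)))) (sym (+-assoc κ w _))) (0≤ x x∈E) })
        (totalOn-nonneg κ L (borel-∩ bE (compl bA)) (∩-finite (compl bA) bE finite-E) λ { x (x∈E , x∉A) →
          ≤-respʳ-≈ (+-congˡ (trans (+-congʳ (trans (*-congˡ (select-no x∉A)) (zeroʳ w))) (+-identityˡ _))) (0≤ x x∈E) }))
      where open ≈-Reasoning

    -- F is a step function on C, of integral v over C.
    Simple : Pred X 0ℓ → (X → ℝ) → ℝ → Set₁
    Simple C F v = ∃[ L ] ((∀ x → x ∈ C → valueAt L x ≈ F x) × totalOn C L ≈ v)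

    simple-resp : ∀ {C F G v w} → (∀ x → x ∈ C → F x ≈ G x) → v ≈ w → Simple C F v → Simple C G w
    simple-resp F≈G v≈w (L , value , total) = L , (λ x x∈C → trans (value x x∈C) (F≈G x x∈C)) , trans total v≈w

    simple-indicator : ∀ {C A} → Borel A → Simple C (λ x → 𝟙 (x ∈ A)) (mass (C ∩ A))
    simple-indicator bA = term 1# _ bA ∷ [] ,
      (λ x _ → trans (+-identityʳ _) (*-identityˡ _)) , trans (+-identityʳ _) (*-identityˡ _)

    simple-const : ∀ {C} → Borel C → ∀ κ → Simple C (λ _ → κ) (κ * mass C)
    simple-const {C} bC κ = term κ C bC ∷ [] ,
      (λ x x∈C → trans (+-identityʳ _) (trans (*-congˡ (select-yes x∈C)) (*-identityʳ κ))) ,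
      trans (+-identityʳ _) (*-congˡ (mass-cong (proj₁ , λ x∈C → x∈C , x∈C)))

    simple-+ : ∀ {C F G v w} → Simple C F v → Simple C G w → Simple C (λ x → F x + G x) (v + w)
    simple-+ {C} (L , value , total) (L′ , value′ , total′) = L ++ L′ ,
      (λ x x∈C → trans (valueAt-++ L L′ x) (+-cong (value x x∈C) (value′ x x∈C))) ,
      trans (totalOn-++ C L L′) (+-cong total total′)

    simple-* : ∀ {C F v} κ → Simple C F v → Simple C (λ x → κ * F x) (κ * v)
    simple-* {C} κ (L , value , total) = scale κ L ,
      (λ x x∈C → trans (valueAt-scale κ L x) (*-congˡ (value x x∈C))) ,
      trans (totalOn-scale C κ L) (*-congˡ total)

    simple-sum : ∀ {C} n {F : Fin n → X → ℝ} {v : Fin n → ℝ} → (∀ i → Simple C (F i) (v i)) →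
                 Simple C (λ x → sum (λ i → F i x)) (sum v)
    simple-sum zero    _ = [] , (λ _ _ → refl) , refl
    simple-sum (suc n) s = simple-+ (s zero) (simple-sum n (s ∘ suc))

    -- Positivity applied to a list representing G - F. Used in both directions, it also shows that
    -- the integral does not depend on the list representing a function.
    simple-mono : ∀ {C F G v w} → Borel C → Finite C → Simple C F v → Simple C G w →
                  (∀ x → x ∈ C → F x ≤ G x) → v ≤ w
    simple-mono {C} {F} {G} {v} {w} bC finite-C sF sG F≤G with simple-+ sG (simple-* (- 1#) sF)
    ... | L , value , total = 0≤⇒≤ (totalOn-nonneg 0# L bC finite-C λ x x∈C →
            ≤-respʳ-≈ (trans (solve 2 (λ f g → g :- f := :0 :+ (g :+ (:- :1) :* f)) refl (F x) (G x)) (+-congˡ (sym (value x x∈C))))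
              (≤⇒0≤- (F≤G x x∈C)))
          (trans (+-congˡ total) (solve 3 (λ c v w → :0 :* c :+ (w :+ (:- :1) :* v) := w :- v) refl _ v w))

    simple-unique : ∀ {C F G v w} → Borel C → Finite C → Simple C F v → Simple C G w →
                    (∀ x → x ∈ C → F x ≈ G x) → v ≈ w
    simple-unique bC finite-C sF sG F≈G = antisym
      (simple-mono bC finite-C sF sG λ x x∈C → ≤-reflexive (F≈G x x∈C))
      (simple-mono bC finite-C sG sF λ x x∈C → ≤-reflexive (sym (F≈G x x∈C)))

    -- Approximate f from below by its values rounded down to multiples of 1 / n.
    module _ (total-1 : μ U ≈⁺ [ 1# ]) {F : X → ℝ ⁺} {f : X → ℝ}
             (F≈f : ∀ x → F x ≈⁺ [ f x ]) (0≤f : ∀ x → 0# ≤ f x) (f≤1 : ∀ x → f x ≤ 1#)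
             (measurable : ∀ a → Borel (λ x → a ≤ f x)) {v : ℝ}
             (upper : ∀ {G w} → Simple U G w → (∀ x → G x ≤ f x) → w ≤ v)
             (lower : ∀ {G w} → Simple U G w → (∀ x → f x ≤ G x) → v ≤ w) where

      private
        finite-U : Finite U
        finite-U = ≈⁺⇒finite total-1

        finite : ∀ {A} → Borel A → Finite A
        finite bA = finite-≈⁺ (μ-cong ((λ x∈A → tt , x∈A) , proj₂)) (∩-finite bA borel-U finite-U)

        sum⁺-finite : ∀ {n} (x : Fin n → ℝ ⁺) (y : Fin n → ℝ) → (∀ i → x i ≈⁺ [ y i ]) → sum⁺ x ≈⁺ [ sum y ]
        sum⁺-finite {zero}  x y x≈y = [ refl ]
        sum⁺-finite {suc n} x y x≈y with x zero | x≈y zero | sum⁺ (x ∘ suc) | sum⁺-finite (x ∘ suc) (y ∘ suc) (x≈y ∘ suc)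
        ... | [ _ ] | [ p ] | [ _ ] | [ r ] = [ +-cong p r ]

        module _ (φ : SimpleFunction) where
          open SimpleFunction φ

          integrand : X → ℝ
          integrand x = sum (λ i → coeff i * 𝟙 (x ∈ piece i))

          integrated : ℝ
          integrated = sum (λ i → coeff i * mass (piece i))

          integrated-simple : Simple U integrand integrated
          integrated-simple = simple-sum size λ i → simple-* (coeff i)
            (simple-resp (λ _ _ → refl) (mass-cong (proj₂ , λ x∈ → tt , x∈)) (simple-indicator (borel i)))

          integrated-≈ : sum⁺ (λ i → coeff i ·⁺ μ (piece i)) ≈⁺ [ integrated ]
          integrated-≈ = sum⁺-finite _ _ λ i → ·⁺-finite (coeff i) (finite (borel i))

          integrand-inside : ∀ {x} i → x ∈ piece i → integrand x ≈ coeff i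
          integrand-inside {x} i x∈i = trans
            (sum-single i _ λ j j≢i → trans (*-congˡ (select-no λ x∈j → disjoint j i j≢i x (x∈j , x∈i))) (zeroʳ _))
            (trans (*-congˡ (select-yes x∈i)) (*-identityʳ _))

          integrand-outside : ∀ {x} → ¬ (∃[ i ] x ∈ piece i) → integrand x ≈ 0#
          integrand-outside {x} x∉ = trans (sum-cong-≋ {size} λ i →
            trans (*-congˡ (select-no λ x∈i → x∉ (i , x∈i))) (zeroʳ _)) (trans (sum-const size 0#) (zeroʳ _))

          integrand-≤ : φ ≼ F → ∀ x → integrand x ≤ f x
          integrand-≤ φ≼F x with em {P = ∃[ i ] x ∈ piece i}
          ... | no  x∉        = ≤-respˡ-≈ (sym (integrand-outside x∉)) (0≤f x)
          ... | yes (i , x∈i) with F x | F≈f x | φ≼F i x x∈i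
          ...   | [ y ] | [ y≈fx ] | [ c≤y ] = ≤-respˡ-≈ (sym (integrand-inside i x∈i)) (≤-respʳ-≈ y≈fx c≤y)

        floor : ∀ n {y} → 0# ≤ y → y < fromℕ n → ∃[ k ] (k ℕ.< n × fromℕ k ≤ y × y < fromℕ (suc k))
        floor zero    0≤y y<0 = contradiction 0≤y (<⇒≱ y<0)
        floor (suc n) {y} 0≤y y<1+n with em {P = fromℕ n ≤ y}
        ... | yes n≤y = n , ℕ.≤-refl , n≤y , y<1+n
        ... | no  n≰y with floor n 0≤y (≰⇒> n≰y)
        ...   | k , k<n , k≤y , y<1+k = k , ℕ.m<n⇒m<1+n k<n , k≤y , y<1+k

        module Rounded (n : ℕ) where
          N = fromℕ (suc n)

          0<N : 0# < N
          0<N = fromℕ-pos {suc n} (s≤s z≤n)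

          Level : ℕ → Pred X 0ℓ
          Level k x = fromℕ k * N ⁻¹ ≤ f x × ¬ (fromℕ (suc k) * N ⁻¹ ≤ f x)

          level-mono : ∀ {i j} → i ℕ.< j → ∀ {x} → x ∈ Level i → x ∈ Level j → ⊥
          level-mono i<j (_ , ¬1+i) (j≤ , _) = ¬1+i (≤-trans
            (*-monoʳ-≤ (<⇒≤ (⁻¹-pos 0<N)) (fromℕ-mono-≤ i<j)) j≤)

          rounded : SimpleFunction
          rounded = record
            -- The levels are 0 , ... , n + 1; the last one holds the points where f = 1 = (n + 1) /
            -- N.
            { size     = suc (suc n)
            ; coeff    = λ k → fromℕ (toℕ k) * N ⁻¹
            ; coeff≥0  = λ k → *-nonneg (fromℕ-nonneg (toℕ k)) (<⇒≤ (⁻¹-pos 0<N))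
            ; piece    = λ k → Level (toℕ k)
            ; borel    = λ k → borel-∩ (measurable _) (compl (measurable _))
            ; disjoint = λ { i j i≢j x (x∈i , x∈j) → separate i j i≢j x∈i x∈j }
            }
            where
            separate : ∀ (i j : Fin (suc (suc n))) → i ≢ j → ∀ {x} → x ∈ Level (toℕ i) → x ∈ Level (toℕ j) → ⊥
            separate i j i≢j x∈i x∈j with ℕ.<-cmp (toℕ i) (toℕ j)
            ... | tri< i<j _ _ = level-mono i<j x∈i x∈j
            ... | tri≈ _ i≡j _ = i≢j (Fin.toℕ-injective i≡j)
            ... | tri> _ _ j<i = level-mono j<i x∈j x∈i

          rounded-≼ : rounded ≼ F
          rounded-≼ k x (k≤ , _) with F x | F≈f x
          ... | [ y ] | [ y≈ ] = [ ≤-respʳ-≈ (sym y≈) k≤ ]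

          level-cover : ∀ x → ∃[ k ] (k ℕ.< suc (suc n) × x ∈ Level k)
          level-cover x =
            let (k , k<2+n , k≤fN , fN<1+k) = floor (suc (suc n)) {f x * N} (*-nonneg (0≤f x) (<⇒≤ 0<N))
                  (≤-<-trans (≤-respʳ-≈ (*-identityˡ N) (*-monoʳ-≤ (<⇒≤ 0<N) (f≤1 x)))
                    (0<⇒< 0<1 (solve 1 (λ N → :1 := (:1 :+ N) :- N) refl N)))
            in k , k<2+n , *⁻¹-≤ 0<N k≤fN , λ ≤f → <⇒≱ fN<1+k
                 (≤-respˡ-≈ (trans (*-assoc _ _ _) (trans (*-congˡ (trans (*-comm _ _) (⁻¹-inverse 0<N))) (*-identityʳ _)))
                   (*-monoʳ-≤ (<⇒≤ 0<N) ≤f))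

          f-≤-level : ∀ x k → k ℕ.< suc (suc n) → x ∈ Level k → f x ≤ integrand rounded x + N ⁻¹ * 1#
          f-≤-level x k k<2+n x∈k@(_ , ¬1+k≤f) = ≤-respʳ-≈ (sym bound≈) (<⇒≤ (≰⇒> ¬1+k≤f))
            where
            i = Fin.fromℕ< k<2+n
            x∈i : x ∈ Level (toℕ i)
            x∈i = ≡.subst (λ k → x ∈ Level k) (≡.sym (Fin.toℕ-fromℕ< k<2+n)) x∈k
            bound≈ : integrand rounded x + N ⁻¹ * 1# ≈ fromℕ (suc k) * N ⁻¹
            bound≈ = trans (+-congʳ (trans (integrand-inside rounded i x∈i) (reflexive (≡.cong (λ k → fromℕ k * N ⁻¹) (Fin.toℕ-fromℕ< k<2+n)))))
              (solve 2 (λ k i → k :* i :+ i :* :1 := (:1 :+ k) :* i) refl (fromℕ k) (N ⁻¹))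

          f-≤ : ∀ x → f x ≤ integrand rounded x + N ⁻¹ * 1#
          f-≤ x = let (k , k<2+n , x∈k) = level-cover x in f-≤-level x k k<2+n x∈k

          v-≤ : v ≤ integrated rounded + N ⁻¹
          v-≤ = ≤-respʳ-≈ (+-congˡ (trans (*-congˡ (trans (*-identityˡ _) (finitePart-cong total-1))) (*-identityʳ _)))
            (lower (simple-+ (integrated-simple rounded) (simple-* (N ⁻¹) (simple-const borel-U 1#))) f-≤)

      -- An upper bound u < v is refuted by rounding with 1 / N < v - u: the rounded function plus 1
      -- / N lies above f, so v is at most its integral, which is at most u + 1 / N.
      integral-≈ : integral m F ≈⁺ [ v ]
      integral-≈ = sup⁺-isLub (isUpper , isLeast)
        where
        isUpper : UpperBound _≤⁺_ _ [ v ]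
        isUpper _ (φ , φ≼F , ≡.refl) = from-≈⁺ (integrated-≈ φ) (upper (integrated-simple φ) (integrand-≤ φ φ≼F))
          where
          from-≈⁺ : ∀ {x y z} → x ≈⁺ [ y ] → y ≤ z → x ≤⁺ [ z ]
          from-≈⁺ [ x≈y ] y≤z = [ ≤-respˡ-≈ (sym x≈y) y≤z ]
        isLeast : ∀ u → UpperBound _≤⁺_ _ u → [ v ] ≤⁺ u
        isLeast ⊤⁺    _     = _ ≤⊤⁺
        isLeast [ u ] bound = [ ≮⇒≥ (λ u<v → contra u<v) ]
          where
          below : ∀ n → integrated (Rounded.rounded n) ≤ u
          below n = to-≤ (integrated-≈ (Rounded.rounded n)) (bound _ (Rounded.rounded n , Rounded.rounded-≼ n , ≡.refl))
            where
            to-≤ : ∀ {x y} → x ≈⁺ [ y ] → x ≤⁺ [ u ] → y ≤ u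
            to-≤ [ x≈y ] [ x≤u ] = ≤-respˡ-≈ x≈y x≤u
          contra : u < v → ⊥
          contra u<v = let (n , N⁻¹<v-u) = archimedean-⁻¹ (<⇒0<- u<v) in <⇒≱ (+-mono-≤-< (below n) N⁻¹<v-u)
                  (≤-respˡ-≈ (solve 2 (λ u v → v := u :+ (v :- u)) refl u v) (Rounded.v-≤ n))

  -- z ⊖ g is the solution x of Sum x g z, unique up to indistinguishability.
  module Translation (_⊖_ : X → X → X)
    (⊖-sum    : ∀ z g → Sum (z ⊖ g) g z)
    (⊖-unique : ∀ {x g z δ} → Sum x g z → 0# < δ → Near δ x (z ⊖ g) × Near δ (z ⊖ g) x)
    (⊖-near   : ∀ {z z′ δ} g → Near δ z z′ → Near δ (z ⊖ g) (z′ ⊖ g)) where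

    -- Open sets do not separate points which are near for every δ, and this passes through the
    -- Borel operations; nearness is required both ways because complements exchange x and y.
    borel-respects : ∀ {A x y} → Borel A → (∀ δ → 0# < δ → Near δ x y × Near δ y x) → x ∈ A → y ∈ A
    borel-respects (isOpen o) near x∈A with o _ x∈A
    ... | δ , 0<δ , near⇒∈ = near⇒∈ _ (proj₁ (near δ 0<δ))
    borel-respects (compl bA) near x∉A y∈A = x∉A (borel-respects bA (λ δ 0<δ → proj₂ (near δ 0<δ) , proj₁ (near δ 0<δ)) y∈A)
    borel-respects (union bA) near (n , x∈A) = n , borel-respects (bA n) near x∈A
    borel-respects (resp (B⊆A , A⊆B) bB) near x∈A = B⊆A (borel-respects bB near (A⊆B x∈A))

    borel-⊖ : ∀ {A} g → Borel A → Borel (λ z → (z ⊖ g) ∈ A)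
    borel-⊖ g (isOpen o) = isOpen λ z z∈ → let (δ , 0<δ , near⇒∈) = o (z ⊖ g) z∈ in
      δ , 0<δ , λ z′ near → near⇒∈ (z′ ⊖ g) (⊖-near g near)
    borel-⊖ g (compl bA) = compl (borel-⊖ g bA)
    borel-⊖ g (union bA) = union λ n → borel-⊖ g (bA n)
    borel-⊖ g (resp (B⊆A , A⊆B) bB) = resp (B⊆A , A⊆B) (borel-⊖ g bB)

    -- A solution x of `Sum x g z` is merely indistinguishable from z ⊖ g, so A must be Borel for
    -- membership to be transferred.
    ⊕-≐-⊖ : ∀ {A} → Borel A → ∀ g → (A ⊕ g) ≐ (λ z → (z ⊖ g) ∈ A)
    ⊕-≐-⊖ bA g = (λ { (x , x∈A , sum) → borel-respects bA (λ δ 0<δ → ⊖-unique sum 0<δ) x∈A }) ,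
                 λ {z} z∈ → z ⊖ g , z∈ , ⊖-sum z g

    module _ {C : Pred X 0ℓ} (haar : HaarMeasure C) where

      open HaarMeasure haar

      -- Each set of the list is replaced by its translate by g, which has the same mass: this is
      -- where the Haar property enters.
      simple-⊖ : ∀ {F v} g → Simple measure U F v → Simple measure U (λ z → F (z ⊖ g)) v
      simple-⊖ {F} g (L , value , total) = shift L ,
          (λ z _ → trans (valueAt-shift L z) (value (z ⊖ g) tt)) , trans (totalOn-shift L) total
        where
        shift : List Term → List Term
        shift []                = []
        shift (term w A bA ∷ L) = term w (λ z → (z ⊖ g) ∈ A) (borel-⊖ g bA) ∷ shift L

        valueAt-shift : ∀ L z → valueAt (shift L) z ≈ valueAt L (z ⊖ g)
        valueAt-shift []      z = refl
        valueAt-shift (_ ∷ L) z = +-congˡ (valueAt-shift L z)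

        whole : ∀ {A : Pred X 0ℓ} → (U ∩ A) ≐ A
        whole = proj₂ , λ x∈A → tt , x∈A

        totalOn-shift : ∀ L → totalOn measure U (shift L) ≈ totalOn measure U L
        totalOn-shift []                = refl
        totalOn-shift (term w A bA ∷ L) = +-cong (*-congˡ (trans (mass-cong measure whole)
          (trans (mass-cong measure (proj₂ (⊕-≐-⊖ bA g) , proj₁ (⊕-≐-⊖ bA g)))
            (trans (finitePart-cong (invariant A bA g)) (sym (mass-cong measure whole)))))) (totalOn-shift L)

-- Polynomial bounds for (1 - z) ^ n.

module PowerBounds (em : ∀ {ℓ} → ExcludedMiddle ℓ) (R : CompleteOrderedField) where

  open Reals em R

  binomial₂ binomial₃ : ℕ → ℝ
  binomial₂ zero    = 0#
  binomial₂ (suc n) = binomial₂ n + fromℕ n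
  binomial₃ zero    = 0#
  binomial₃ (suc n) = binomial₃ n + binomial₂ n

  binomial₂-nonneg : ∀ n → 0# ≤ binomial₂ n
  binomial₂-nonneg zero    = ≤-refl
  binomial₂-nonneg (suc n) = +-nonneg (binomial₂-nonneg n) (fromℕ-nonneg n)

  binomial₃-nonneg : ∀ n → 0# ≤ binomial₃ n
  binomial₃-nonneg zero    = ≤-refl
  binomial₃-nonneg (suc n) = +-nonneg (binomial₃-nonneg n) (binomial₂-nonneg n)

  2binomial₂ : ∀ n → (1# + 1#) * binomial₂ n ≈ fromℕ n * (fromℕ n - 1#)
  2binomial₂ zero    = solve 0 ((:1 :+ :1) :* :0 := :0 :* (:0 :- :1)) refl
  2binomial₂ (suc n) = trans (distribˡ _ _ _) (trans (+-congʳ (2binomial₂ n))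
    (solve 1 (λ n → n :* (n :- :1) :+ (:1 :+ :1) :* n := (:1 :+ n) :* (:1 :+ n :- :1)) refl (fromℕ n)))

  3binomial₃ : ∀ n → (1# + 1# + 1#) * binomial₃ n ≈ (fromℕ n - (1# + 1#)) * binomial₂ n
  3binomial₃ zero    = solve 0 ((:1 :+ :1 :+ :1) :* :0 := (:0 :- (:1 :+ :1)) :* :0) refl
  3binomial₃ (suc n) = begin
    (1# + 1# + 1#) * (binomial₃ n + binomial₂ n)
      ≈⟨ distribˡ _ _ _ ⟩
    (1# + 1# + 1#) * binomial₃ n + (1# + 1# + 1#) * binomial₂ n
      ≈⟨ +-congʳ (3binomial₃ n) ⟩
    (fromℕ n - (1# + 1#)) * binomial₂ n + (1# + 1# + 1#) * binomial₂ n
      ≈⟨ solve 2 (λ n b → (n :- (:1 :+ :1)) :* b :+ (:1 :+ :1 :+ :1) :* b :=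
           (n :- :1) :* b :+ (:1 :+ :1) :* b) refl (fromℕ n) (binomial₂ n) ⟩
    (fromℕ n - 1#) * binomial₂ n + (1# + 1#) * binomial₂ n
      ≈⟨ +-congˡ (2binomial₂ n) ⟩
    (fromℕ n - 1#) * binomial₂ n + fromℕ n * (fromℕ n - 1#)
      ≈⟨ solve 2 (λ n b → (n :- :1) :* b :+ n :* (n :- :1) :=
           (:1 :+ n :- (:1 :+ :1)) :* (b :+ n)) refl (fromℕ n) (binomial₂ n) ⟩
    (1# + fromℕ n - (1# + 1#)) * (binomial₂ n + fromℕ n)  ∎
    where open ≈-Reasoning

  module _ {z : ℝ} (0≤z : 0# ≤ z) (z≤1 : z ≤ 1#) where

    private
      0≤1-z : 0# ≤ 1# - z
      0≤1-z = ≤⇒0≤- z≤1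

    -- Truncations of the binomial expansion lie alternately below and above the power. In each
    -- induction one multiplies by 1 - z ≥ 0, and a single nonnegative term is discarded.
    bonferroni₁ : ∀ n → 1# - fromℕ n * z ≤ (1# - z) ^ n
    bonferroni₁ zero    = ≤-reflexive (solve 1 (λ z → :1 :- :0 :* z := :1) refl z)
    bonferroni₁ (suc n) = ≤-trans
      (0≤⇒≤ (*-nonneg (fromℕ-nonneg n) (square-nonneg z))
        (solve 2 (λ n z → n :* (z :* z) := (:1 :- z) :* (:1 :- n :* z) :- (:1 :- (:1 :+ n) :* z)) refl (fromℕ n) z))
      (*-monoˡ-≤ 0≤1-z (bonferroni₁ n))

    bonferroni₂ : ∀ n → (1# - z) ^ n ≤ 1# - fromℕ n * z + binomial₂ n * (z * z)
    bonferroni₂ zero    = ≤-reflexive (solve 1 (λ z → :1 := :1 :- :0 :* z :+ :0 :* (z :* z)) refl z)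
    bonferroni₂ (suc n) = ≤-trans (*-monoˡ-≤ 0≤1-z (bonferroni₂ n))
      (0≤⇒≤ (*-nonneg (binomial₂-nonneg n) (*-nonneg 0≤z (square-nonneg z)))
        (solve 3 (λ n z b → b :* (z :* (z :* z)) :=
          :1 :- (:1 :+ n) :* z :+ (b :+ n) :* (z :* z) :- (:1 :- z) :* (:1 :- n :* z :+ b :* (z :* z)))
          refl (fromℕ n) z (binomial₂ n)))

    bonferroni₃ : ∀ n → 1# - fromℕ n * z + binomial₂ n * (z * z) - binomial₃ n * (z * (z * z)) ≤ (1# - z) ^ n
    bonferroni₃ zero    = ≤-reflexive (solve 1 (λ z → :1 :- :0 :* z :+ :0 :* (z :* z) :- :0 :* (z :* (z :* z)) := :1) refl z)
    bonferroni₃ (suc n) = ≤-trans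
      (0≤⇒≤ (*-nonneg (binomial₃-nonneg n) (square-nonneg (z * z)))
        (solve 4 (λ n z b t → t :* (z :* z :* (z :* z)) :=
          (:1 :- z) :* (:1 :- n :* z :+ b :* (z :* z) :- t :* (z :* (z :* z))) :-
          (:1 :- (:1 :+ n) :* z :+ (b :+ n) :* (z :* z) :- (t :+ b) :* (z :* (z :* z))))
          refl (fromℕ n) z (binomial₂ n) (binomial₃ n)))
      (*-monoˡ-≤ 0≤1-z (bonferroni₃ n))

-- Decay of the survival probability of a critical branching process.

module Asymptotics (em : ∀ {ℓ} → ExcludedMiddle ℓ) (R : CompleteOrderedField) where

  open Reals em R
  open PowerBounds em R

  eventually-≤ : ∀ x {y} → 0# < y → ∃[ N ] (∀ n → N ℕ.≤ n → x ≤ fromℕ n * y)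
  eventually-≤ x {y} 0<y with archimedean (x * y ⁻¹)
  ... | N , x/y<N = N , λ n N≤n → ≤-respˡ-≈
        (trans (*-assoc x _ y) (trans (*-congˡ (trans (*-comm _ y) (⁻¹-inverse 0<y))) (*-identityʳ x)))
        (*-monoʳ-≤ (<⇒≤ 0<y) (≤-trans (<⇒≤ x/y<N) (fromℕ-mono-≤ N≤n)))

  -- From some index a on, the increments are within η of c, which costs η r in all. The initial
  -- discrepancy between v a and c a is constant, and the second η r absorbs it for large r.
  cesàro : ∀ (v : ℕ → ℝ) {c} → 0# ≤ c → (∀ r → 0# ≤ v r) →
    (∀ η → 0# < η → ∃[ N ] (∀ r → N ℕ.≤ r → v r + (c - η) ≤ v (suc r) × v (suc r) ≤ v r + (c + η))) →
    ∀ η → 0# < η → ∃[ N ] (∀ r → N ℕ.≤ r → (c - (η + η)) * fromℕ r ≤ v r × v r ≤ (c + (η + η)) * fromℕ r)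
  cesàro v {c} 0≤c 0≤v increments η 0<η with increments η 0<η
  ... | a , increments-a with eventually-≤ (v a) 0<η | eventually-≤ (c * fromℕ a) 0<η
  ...   | N₁ , v-small | N₂ , ca-small = N₁ ℕ.+ N₂ ℕ.+ a , bounds
    where
    lower : ∀ k → v a + (c - η) * fromℕ k ≤ v (k ℕ.+ a)
    lower zero    = ≤-reflexive (solve 2 (λ v c → v :+ c :* :0 := v) refl (v a) (c - η))
    lower (suc k) = ≤-trans (≤-trans
      (≤-reflexive (solve 3 (λ v c k → v :+ c :* (:1 :+ k) := v :+ c :* k :+ c) refl (v a) (c - η) (fromℕ k)))
      (+-monoˡ-≤ (c - η) (lower k))) (proj₁ (increments-a (k ℕ.+ a) (ℕ.m≤n+m a k)))

    upper : ∀ k → v (k ℕ.+ a) ≤ v a + (c + η) * fromℕ k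
    upper zero    = ≤-reflexive (solve 2 (λ v c → v := v :+ c :* :0) refl (v a) (c + η))
    upper (suc k) = ≤-trans (proj₂ (increments-a (k ℕ.+ a) (ℕ.m≤n+m a k))) (≤-trans
      (+-monoˡ-≤ (c + η) (upper k))
      (≤-reflexive (solve 3 (λ v c k → v :+ c :* k :+ c := v :+ c :* (:1 :+ k)) refl (v a) (c + η) (fromℕ k))))

    bounds : ∀ r → N₁ ℕ.+ N₂ ℕ.+ a ℕ.≤ r → (c - (η + η)) * fromℕ r ≤ v r × v r ≤ (c + (η + η)) * fromℕ r
    bounds r N≤r = ≡.subst (λ r → (c - (η + η)) * fromℕ r ≤ v r × v r ≤ (c + (η + η)) * fromℕ r)
        (ℕ.m∸n+n≡m (ℕ.m+n≤o⇒n≤o (N₁ ℕ.+ N₂) N≤r)) (below , above)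
      where
      k = r ℕ.∸ a
      r′ = k ℕ.+ a
      N≤r′ : N₁ ℕ.+ N₂ ℕ.≤ r′
      N≤r′ = ℕ.≤-trans (ℕ.m+n≤o⇒m≤o∸n (N₁ ℕ.+ N₂) N≤r) (ℕ.m≤m+n k a)
      kr : fromℕ r′ ≈ fromℕ k + fromℕ a
      kr = fromℕ-+ k a
      below : (c - (η + η)) * fromℕ r′ ≤ v r′
      below = ≤-trans (0≤⇒≤
        (+-nonneg (0≤v a) (+-nonneg (≤⇒0≤- (ca-small r′ (ℕ.≤-trans (ℕ.m≤n+m N₂ N₁) N≤r′))) (*-nonneg (<⇒≤ 0<η) (fromℕ-nonneg a))))
        (trans (+-congˡ (+-congʳ (+-congʳ (*-congʳ kr)))) (trans
          (solve 5 (λ v c η k a → v :+ ((k :+ a) :* η :- c :* a :+ η :* a) := v :+ (c :- η) :* k :- (c :- (η :+ η)) :* (k :+ a))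
            refl (v a) c η (fromℕ k) (fromℕ a))
          (+-congˡ (-‿cong (*-congˡ (sym kr)))))))
        (lower k)
      above : v r′ ≤ (c + (η + η)) * fromℕ r′
      above = ≤-trans (upper k) (0≤⇒≤
        (+-nonneg (≤⇒0≤- (v-small r′ (ℕ.≤-trans (ℕ.m≤m+n N₁ N₂) N≤r′)))
          (+-nonneg (*-nonneg 0≤c (fromℕ-nonneg a)) (*-nonneg (<⇒≤ 0<η) (fromℕ-nonneg a))))
        (trans (+-congʳ (+-congʳ (*-congʳ kr))) (trans
          (solve 5 (λ v c η k a → (k :+ a) :* η :- v :+ (c :* a :+ η :* a) := (c :+ (η :+ η)) :* (k :+ a) :- (v :+ (c :+ η) :* k))
            refl (v a) c η (fromℕ k) (fromℕ a))
          (+-congʳ (*-congˡ (sym kr))))))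

  -- Survival probabilities of the critical branching process with
  -- Binomial (m , 1 / m) offspring.
  module _ (m : ℕ) (2≤m : 2 ℕ.≤ m) where

    open Counting.Survival em R m

    private
      M = fromℕ m
      i = M ⁻¹
      ρ = survival

      0<M : 0# < M
      0<M = fromℕ-pos (ℕ.≤-trans (s≤s z≤n) 2≤m)

      0<i : 0# < i
      0<i = ⁻¹-pos 0<M

      i≤1 : i ≤ 1#
      i≤1 = ≤-respʳ-≈ 1⁻¹≈1 (⁻¹-anti-≤ 0<1 (1≤fromℕ (ℕ.≤-trans (s≤s z≤n) 2≤m)))

      Mi≈1 : M * i ≈ 1#
      Mi≈1 = ⁻¹-inverse 0<M

    -- Half the variance of the offspring law. Since the next survival probability is ρ - drift * ρ
    -- ^ 2 up to order ρ ^ 3, its inverse grows by about `drift` in each generation.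
    drift : ℝ
    drift = binomial₂ m * (i * i)

    private
      c = drift
      e = binomial₃ m * (i * (i * i))

      2c : (1# + 1#) * c ≈ (M - 1#) * i
      2c = begin
        (1# + 1#) * (binomial₂ m * (i * i))  ≈⟨ *-assoc _ _ _ ⟨
        (1# + 1#) * binomial₂ m * (i * i)    ≈⟨ *-congʳ (2binomial₂ m) ⟩
        M * (M - 1#) * (i * i)               ≈⟨ solve 2 (λ M i → M :* (M :- :1) :* (i :* i) := (M :* i) :* ((M :- :1) :* i)) refl M i ⟩
        M * i * ((M - 1#) * i)               ≈⟨ *-congʳ Mi≈1 ⟩
        1# * ((M - 1#) * i)                  ≈⟨ *-identityˡ _ ⟩
        (M - 1#) * i                         ∎
        where open ≈-Reasoning

      2c≤1 : (1# + 1#) * c ≤ 1#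
      2c≤1 = ≤-respˡ-≈ (sym 2c) (0≤⇒≤ (<⇒≤ 0<i)
        (trans (solve 2 (λ M i → i := M :* i :- (M :- :1) :* i) refl M i) (+-congʳ Mi≈1)))

      0≤c : 0# ≤ c
      0≤c = *-nonneg (binomial₂-nonneg m) (*-nonneg (<⇒≤ 0<i) (<⇒≤ 0<i))

      0≤e : 0# ≤ e
      0≤e = *-nonneg (binomial₃-nonneg m) (*-nonneg (<⇒≤ 0<i) (*-nonneg (<⇒≤ 0<i) (<⇒≤ 0<i)))

      -- From 3 e = (1 - 2 / m) c. It keeps c - e positive, so that the inverse survival probability
      -- grows at least linearly.
      2e≤c : (1# + 1#) * e ≤ c
      2e≤c = ≤-trans
        (0≤⇒≤ (*-nonneg (binomial₃-nonneg m) iii) (solve 2 (λ t i → t :* (i :* (i :* i)) :=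
          ((:1 :+ :1 :+ :1) :* t) :* (i :* (i :* i)) :- (:1 :+ :1) :* (t :* (i :* (i :* i)))) refl (binomial₃ m) i))
        (≤-trans (≤-reflexive (*-congʳ (3binomial₃ m)))
        (0≤⇒≤ (*-nonneg (+-nonneg 0≤1 0≤1) (*-nonneg (binomial₂-nonneg m) iii))
          (trans (solve 3 (λ b i M → (:1 :+ :1) :* (b :* (i :* (i :* i))) :=
              (M :* i) :* (b :* (i :* i)) :- (M :- (:1 :+ :1)) :* b :* (i :* (i :* i))) refl (binomial₂ m) i M)
            (+-congʳ (trans (*-congʳ Mi≈1) (*-identityˡ _))))))
        where
        iii : 0# ≤ i * (i * i)
        iii = *-nonneg (<⇒≤ 0<i) (*-nonneg (<⇒≤ 0<i) (<⇒≤ 0<i))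

    drift-pos : 0# < drift
    drift-pos = *-pos (0<binomial₂ 2≤m) (*-pos 0<i 0<i)
      where
      0<binomial₂ : ∀ {n} → 2 ℕ.≤ n → 0# < binomial₂ n
      0<binomial₂ {suc n} (s≤s 1≤n) = <-respʳ-≈ (+-comm _ _) (+-pos-nonneg (fromℕ-pos 1≤n) (binomial₂-nonneg n))

    -- drift = (m - 1) / (2 m)
    drift-≈ : (1# + 1#) * (M * drift) ≈ M - 1#
    drift-≈ = begin
      (1# + 1#) * (M * c)    ≈⟨ solve 2 (λ M c → (:1 :+ :1) :* (M :* c) := M :* ((:1 :+ :1) :* c)) refl M c ⟩
      M * ((1# + 1#) * c)    ≈⟨ *-congˡ 2c ⟩
      M * ((M - 1#) * i)     ≈⟨ solve 2 (λ M i → M :* ((M :- :1) :* i) := (M :* i) :* (M :- :1)) refl M i ⟩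
      M * i * (M - 1#)       ≈⟨ *-congʳ Mi≈1 ⟩
      1# * (M - 1#)          ≈⟨ *-identityˡ _ ⟩
      M - 1#                 ∎
      where open ≈-Reasoning

    private
      module Step {ρ : ℝ} (0<ρ : 0# < ρ) (ρ≤1 : ρ ≤ 1#) where
        z = ρ * i
        0≤z : 0# ≤ z
        0≤z = *-nonneg (<⇒≤ 0<ρ) (<⇒≤ 0<i)
        z≤1 : z ≤ 1#
        z≤1 = ≤-respʳ-≈ (*-identityˡ 1#) (*-mono-≤ (<⇒≤ 0<i) 0≤1 ρ≤1 i≤1)
        -- Criticality: the mean number of children is 1, so the linear term of 1 - (1 - z) ^ m is ρ
        -- itself.
        Mz : M * z ≈ ρ
        Mz = trans (solve 3 (λ M ρ i → M :* (ρ :* i) := (M :* i) :* ρ) refl M ρ i) (trans (*-congʳ Mi≈1) (*-identityˡ ρ))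

        ρ′ = 1# - (1# - z) ^ m

        ρ′-lower : ρ * (1# - c * ρ) ≤ ρ′
        ρ′-lower = 0≤⇒≤ (≤⇒0≤- (bonferroni₂ 0≤z z≤1 m)) (trans
          (+-congʳ (+-congʳ (+-congˡ (-‿cong Mz))))
          (solve 4 (λ ρ i b p → :1 :- ρ :+ b :* (ρ :* i :* (ρ :* i)) :- p :=
            :1 :- p :- ρ :* (:1 :- b :* (i :* i) :* ρ)) refl ρ i (binomial₂ m) ((1# - z) ^ m)))

        ρ′-upper : ρ′ ≤ ρ * (1# - c * ρ + e * (ρ * ρ))
        ρ′-upper = 0≤⇒≤ (≤⇒0≤- (bonferroni₃ 0≤z z≤1 m)) (trans
          (+-congˡ (-‿cong (+-congʳ (+-congʳ (+-congˡ (-‿cong Mz))))))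
          (solve 5 (λ ρ i b t p → p :- (:1 :- ρ :+ b :* (ρ :* i :* (ρ :* i)) :- t :* (ρ :* i :* (ρ :* i :* (ρ :* i)))) :=
            ρ :* (:1 :- b :* (i :* i) :* ρ :+ t :* (i :* (i :* i)) :* (ρ :* ρ)) :- (:1 :- p)) refl ρ i (binomial₂ m) (binomial₃ m) ((1# - z) ^ m)))

        ρ′≤1 : ρ′ ≤ 1#
        ρ′≤1 = 0≤⇒≤ (^-nonneg m (≤⇒0≤- z≤1)) (solve 1 (λ p → p := :1 :- (:1 :- p)) refl _)

        cρ≤c : c * ρ ≤ c
        cρ≤c = ≤-respʳ-≈ (*-identityʳ c) (*-monoˡ-≤ 0≤c ρ≤1)

        0<1-cρ : 0# < 1# - c * ρ
        0<1-cρ = <⇒0<- (≤-<-trans cρ≤c (<-≤-trans (0<⇒< drift-pos (solve 1 (λ c → c := (:1 :+ :1) :* c :- c) refl c)) 2c≤1))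

        0<ρ′ : 0# < ρ′
        0<ρ′ = <-≤-trans (*-pos 0<ρ 0<1-cρ) ρ′-lower

        v = ρ ⁻¹
        ρv : ρ * v ≈ 1#
        ρv = ⁻¹-inverse 0<ρ

        1≤v : 1# ≤ v
        1≤v = ≤-respˡ-≈ 1⁻¹≈1 (⁻¹-anti-≤ 0<ρ ρ≤1)

        eρ≤c : e * ρ ≤ c
        eρ≤c = ≤-trans (≤-trans (*-monoˡ-≤ 0≤e ρ≤1) (≤-reflexive (*-identityʳ e)))
          (≤-trans (0≤⇒≤ 0≤e (solve 1 (λ e → e := (:1 :+ :1) :* e :- e) refl e)) 2e≤c)

        -- By `ρ′-lower` it suffices that (1 - c ρ) (1 + c ρ + c ρ ^ 2) ≥ 1. The excess is c ρ ^ 2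
        -- (1 - c - c ρ), nonnegative because 2 c ≤ 1.
        v′-upper : ρ′ ⁻¹ ≤ v + (c + c * ρ)
        v′-upper = ≤-respˡ-≈ (*-identityˡ _) (*⁻¹-≤ 0<ρ′ (≤-respʳ-≈ (*-comm _ _) (≤-trans main (*-monoʳ-≤ 0≤y ρ′-lower))))
          where
          0≤y : 0# ≤ v + (c + c * ρ)
          0≤y = +-nonneg (≤-trans 0≤1 1≤v) (+-nonneg 0≤c (*-nonneg 0≤c (<⇒≤ 0<ρ)))
          c+cρ≤1 : c + c * ρ ≤ 1#
          c+cρ≤1 = ≤-trans (+-monoʳ-≤ c cρ≤c) (≤-respˡ-≈ (solve 1 (λ c → (:1 :+ :1) :* c := c :+ c) refl c) 2c≤1)
          main : 1# ≤ ρ * (1# - c * ρ) * (v + (c + c * ρ))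
          main = 0≤⇒≤ (*-nonneg (*-nonneg 0≤c (square-nonneg ρ)) (≤⇒0≤- c+cρ≤1))
            (trans (solve 2 (λ c ρ → c :* (ρ :* ρ) :* (:1 :- (c :+ c :* ρ)) :=
                (:1 :- c :* ρ) :* (:1 :+ ρ :* (c :+ c :* ρ)) :- :1) refl c ρ)
              (+-congʳ (trans (*-congˡ (+-congʳ (sym ρv)))
                (solve 3 (λ c ρ v → (:1 :- c :* ρ) :* (ρ :* v :+ ρ :* (c :+ c :* ρ)) :=
                  ρ :* (:1 :- c :* ρ) :* (v :+ (c :+ c :* ρ))) refl c ρ v))))

        -- With w = c ρ - e ρ ^ 2 the upper bound for ρ′ is ρ (1 - w), and (1 - w) (1 + w) ≤ 1.
        v′-lower : v + (c - e * ρ) ≤ ρ′ ⁻¹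
        v′-lower = ≤-respʳ-≈ (*-identityˡ _) (≤-*⁻¹ 0<ρ′ (≤-respˡ-≈ (*-comm _ _) (≤-trans (*-monoʳ-≤ 0≤y ρ′-upper) main)))
          where
          0≤y : 0# ≤ v + (c - e * ρ)
          0≤y = +-nonneg (≤-trans 0≤1 1≤v) (≤⇒0≤- eρ≤c)
          main : ρ * (1# - c * ρ + e * (ρ * ρ)) * (v + (c - e * ρ)) ≤ 1#
          main = 0≤⇒≤ (square-nonneg (c * ρ - e * (ρ * ρ)))
            (trans (solve 3 (λ c e ρ → (c :* ρ :- e :* (ρ :* ρ)) :* (c :* ρ :- e :* (ρ :* ρ)) :=
                :1 :- (:1 :- c :* ρ :+ e :* (ρ :* ρ)) :* (:1 :+ ρ :* (c :- e :* ρ))) refl c e ρ)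
              (+-congˡ (-‿cong (trans (*-congˡ (+-congʳ (sym ρv)))
                (solve 4 (λ c e ρ v → (:1 :- c :* ρ :+ e :* (ρ :* ρ)) :* (ρ :* v :+ ρ :* (c :- e :* ρ)) :=
                  ρ :* (:1 :- c :* ρ :+ e :* (ρ :* ρ)) :* (v :+ (c :- e :* ρ))) refl c e ρ v)))))

    survival-bounds : ∀ r → 0# < ρ r × ρ r ≤ 1#
    survival-bounds zero    = 0<1 , ≤-refl
    survival-bounds (suc r) = Step.0<ρ′ (proj₁ (survival-bounds r)) (proj₂ (survival-bounds r)) ,
                              Step.ρ′≤1 (proj₁ (survival-bounds r)) (proj₂ (survival-bounds r))

    private
      module At r = Step (proj₁ (survival-bounds r)) (proj₂ (survival-bounds r))

      v : ℕ → ℝ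
      v r = ρ r ⁻¹

      0≤v : ∀ r → 0# ≤ v r
      0≤v r = <⇒≤ (⁻¹-pos (proj₁ (survival-bounds r)))

      g = c - e

      0<g : 0# < g
      0<g = ≰⇒> λ g≤0 → <⇒≱ drift-pos (≤-trans
        (0≤⇒≤ (≤⇒0≤- 2e≤c) (solve 2 (λ c e → c :- (:1 :+ :1) :* e := (c :- e) :+ (c :- e) :- c) refl c e))
        (≤-respʳ-≈ (+-identityˡ 0#) (+-mono-≤ g≤0 g≤0)))

      -- A crude bound using only ρ ≤ 1: every increment is at least c - e. It forces ρ to tend to
      -- 0, which the exact rate relies on.
      growth : ∀ r → fromℕ r * g ≤ v r
      growth zero    = ≤-trans (≤-reflexive (zeroˡ g)) (0≤v 0)
      growth (suc r) = ≤-trans (≤-trans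
        (≤-reflexive (solve 2 (λ r g → (:1 :+ r) :* g := r :* g :+ g) refl (fromℕ r) g))
        (+-mono-≤ (growth r) (+-monoʳ-≤ c (neg-mono-≤ (≤-respʳ-≈ (*-identityʳ e) (*-monoˡ-≤ 0≤e (proj₂ (survival-bounds r))))))))
        (At.v′-lower r)

    inverse-survival-large : ∀ x → ∃[ N ] (∀ r → N ℕ.≤ r → x ≤ survival r ⁻¹)
    inverse-survival-large x = let (N , x≤) = eventually-≤ x 0<g in
      N , λ r N≤r → ≤-trans (x≤ r N≤r) (growth r)

    -- The increments of 1 / ρ differ from c by at most c ρ, as e ≤ c, and c ρ ≤ η once 1 / ρ ≥ c /
    -- η; averaging the increments gives the rate.
    survival-rate : ∀ η → 0# < η → ∃[ N ] (∀ r → N ℕ.≤ r →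
      (drift - (η + η)) * fromℕ r ≤ survival r ⁻¹ × survival r ⁻¹ ≤ (drift + (η + η)) * fromℕ r)
    survival-rate = cesàro v 0≤c 0≤v increments
      where
      increments : ∀ η → 0# < η → ∃[ N ] (∀ r → N ℕ.≤ r → v r + (c - η) ≤ v (suc r) × v (suc r) ≤ v r + (c + η))
      increments η 0<η =
            let (N , large) = inverse-survival-large (c * η ⁻¹) in N , λ r N≤r →
            let cρ≤η = small r (large r N≤r)
                eρ≤cρ = *-monoʳ-≤ (<⇒≤ (proj₁ (survival-bounds r)))
                          (≤-trans (0≤⇒≤ 0≤e (solve 1 (λ e → e := (:1 :+ :1) :* e :- e) refl e)) 2e≤c)
            in ≤-trans (+-monoʳ-≤ (v r) (+-monoʳ-≤ c (neg-mono-≤ (≤-trans eρ≤cρ cρ≤η)))) (At.v′-lower r) ,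
               ≤-trans (At.v′-upper r) (+-monoʳ-≤ (v r) (+-monoʳ-≤ c cρ≤η))
        where
        small : ∀ r → c * η ⁻¹ ≤ v r → c * ρ r ≤ η
        small r c/η≤v = *-cancelˡ-≤ (⁻¹-pos 0<η) (≤-resp₂
          (solve 3 (λ c j ρ → c :* j :* ρ := j :* (c :* ρ)) refl c (η ⁻¹) (ρ r))
          (trans (trans (*-comm _ _) (At.ρv r)) (sym (trans (*-comm _ _) (⁻¹-inverse 0<η))))
          (*-monoʳ-≤ (<⇒≤ (proj₁ (survival-bounds r))) c/η≤v))

-- π-adic digits of integers.

module IntegerDigits (em : ∀ {ℓ} → ExcludedMiddle ℓ) (𝕂 : LocalField) where

  open Valuation em 𝕂

  V-≈0 : ∀ {k x} → x ≈ 0# → V k x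
  V-≈0 x≈0 = V-cong (sym x≈0) V-0#

  V-refl : ∀ {k x y} → x ≈ y → V k (x - y)
  V-refl {x = x} {y} x≈y = V-≈0 (trans (+-congʳ x≈y) (-‿inverseʳ y))

  V-sym : ∀ {k x y} → V k (x - y) → V k (y - x)
  V-sym {x = x} {y} v = V-cong (solve 2 (λ x y → :- (x :- y) := y :- x) refl x y) (V-neg v)

  V-trans : ∀ {k x y z} → V k (x - y) → V k (y - z) → V k (x - z)
  V-trans {x = x} {y} {z} v w = V-cong (solve 3 (λ x y z → x :- y :+ (y :- z) := x :- z) refl x y z) (V-+ v w)

  representative : IntegerRing → Fin q
  representative x = proj₁ (proj₂ residue-bijective x)

  representative-≈ : ∀ x → V 1 (proj₁ x - proj₁ (residue (representative x)))
  representative-≈ x = V-sym (proj₂ (proj₂ residue-bijective x) ≡.refl)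

  quotient-π : ∀ x → ∃[ y ] (V 0 y × proj₁ x - proj₁ (residue (representative x)) ≈ π * y)
  quotient-π x = divide-π (representative-≈ x)

  integers : DigitSpace q
  integers = record
    { Point          = IntegerRing
    ; _≈[_]_         = λ x k y → V k (proj₁ x - proj₁ y)
    ; ≈-refl         = V-refl refl
    ; ≈-sym          = V-sym
    ; ≈-trans        = V-trans
    ; ≈-zero         = λ x y → V-minus (proj₂ x) (proj₂ y)
    ; cons           = λ δ x → proj₁ (residue δ) + π * proj₁ x , V-+ (proj₂ (residue δ)) (V-mono z≤n (V-π* (proj₂ x)))
    ; cons-cong      = λ {k} {δ} {x} {y} x≈y → V-cong
        (solve 4 (λ r p x y → p :* (x :- y) := r :+ p :* x :- (r :+ p :* y)) refl (proj₁ (residue δ)) π (proj₁ x) (proj₁ y)) (V-π* x≈y)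
    ; cons-injective = λ {k} {δ} {ε} {x} {y} → cons-injective {k} {δ} {ε} {x} {y}
    ; head           = representative
    ; tail           = λ x → proj₁ (quotient-π x) , proj₁ (proj₂ (quotient-π x))
    ; cons-head-tail = λ x → V-refl (trans (solve 2 (λ x r → x := r :+ (x :- r)) refl _ _) (+-congˡ (proj₂ (proj₂ (quotient-π x)))))
    ; origin         = 0# , V-0#
    }
    where
    cons-injective : ∀ {k δ ε} {x y : IntegerRing} →
      V (suc k) ((proj₁ (residue δ) + π * proj₁ x) - (proj₁ (residue ε) + π * proj₁ y)) →
      δ ≡ ε × V k (proj₁ x - proj₁ y)
    cons-injective {k} {δ} {ε} {x , vx} {y , vy} v
      with proj₁ residue-bijective {δ} {ε} (V-cong
        (solve 5 (λ r r′ p x y → (r :+ p :* x :- (r′ :+ p :* y)) :- p :* (x :- y) := r :- r′) refl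
          (proj₁ (residue δ)) (proj₁ (residue ε)) π x y)
        (V-minus (V-mono (s≤s z≤n) v) (V-π* (V-minus vx vy))))
    ... | ≡.refl = ≡.refl , V-π*⁻¹ (V-cong
        (solve 4 (λ r p x y → r :+ p :* x :- (r :+ p :* y) := p :* (x :- y)) refl (proj₁ (residue δ)) π x y) v)

-- Affine charts of the projective space and the condition for a line to meet y.

module Charts (em : ∀ {ℓ} → ExcludedMiddle ℓ) (𝕂 : LocalField) (s : ℕ) where

  open Valuation em 𝕂
  open IntegerDigits em 𝕂

  -- Norm 1 expressed by divisibility; `pivot` is the index at which the canonical representative
  -- has the entry 1.
  record Primitive (a : Vector Carrier (suc s)) : Set where
    field
      integral : ∀ i → V 0 (a i)
      pivot    : Fin (suc s)
      pivot-¬V : ¬ V 1 (a pivot)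
      first    : ∀ i → i Fin.< pivot → V 1 (a i)

    pivot-inverse : ∃[ u ] (V 0 u × a pivot * u ≈ 1#)
    pivot-inverse = proj₂ (¬V1⇒unit (integral pivot) pivot-¬V)

    -- The affine coordinates of the line: its canonical representative without the entry 1 at the
    -- pivot.
    chart : Vector IntegerRing s
    chart i = proj₁ pivot-inverse * a (punchIn pivot i) , V-*ˡ (proj₁ (proj₂ pivot-inverse)) (integral (punchIn pivot i))

  open Primitive

  first-¬V1 : ∀ {n} (a : Vector Carrier n) → ∃[ i ] ¬ V 1 (a i) → ∃[ j ] (¬ V 1 (a j) × (∀ i → i Fin.< j → V 1 (a i)))
  first-¬V1 {suc n} a (i , ¬v) with em {P = V 1 (a zero)}
  ... | no ¬v₀ = zero , ¬v₀ , λ _ ()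
  first-¬V1 {suc n} a (zero  , ¬v) | yes v₀ = contradiction v₀ ¬v
  first-¬V1 {suc n} a (suc i , ¬v) | yes v₀ with first-¬V1 (a ∘ suc) (i , ¬v)
  ... | j , ¬vⱼ , first = suc j , ¬vⱼ , λ { zero _ → v₀ ; (suc i) (s≤s i<j) → first i i<j }

  mkPrimitive : ∀ {a} → (∀ i → V 0 (a i)) → ∃[ i ] ¬ V 1 (a i) → Primitive a
  mkPrimitive integral ∃¬v = let (j , ¬v , first) = first-¬V1 _ ∃¬v in
    record { integral = integral ; pivot = j ; pivot-¬V = ¬v ; first = first }

  -- a and b represent points of the projective space which agree modulo π ^ k.
  Close : ℕ → Vector Carrier (suc s) → Vector Carrier (suc s) → Set
  Close k a b = ∃[ u ] (IsUnit u × (∀ i → V k (b i - u * a i)))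

  private
    V1-transfer : ∀ {u a b} → V 1 (b - u * a) → V 1 a → V 0 u → V 1 b
    V1-transfer {u} {a} {b} v va vu = V-cong (solve 3 (λ u a b → b :- u :* a :+ u :* a := b) refl u a b) (V-+ v (V-*ˡ vu va))

    V1-transfer⁻¹ : ∀ {u a b} → V 1 (b - u * a) → V 1 b → IsUnit u → V 1 a
    V1-transfer⁻¹ {u} {a} {b} v vb unit = V-unit* unit
      (V-cong (solve 3 (λ u a b → b :- (b :- u :* a) := u :* a) refl u a b) (V-minus vb v))

  -- The pivot is the first nonzero coordinate modulo π, and units do not change it. Agreement
  -- modulo at least π is required, hence `suc k`.
  pivot-cong : ∀ {k a b} (pa : Primitive a) (pb : Primitive b) → Close (suc k) a b → pivot pa ≡ pivot pb
  pivot-cong pa pb (u , unit , close) with Fin.<-cmp (pivot pa) (pivot pb)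
  ... | tri≈ _ eq _ = eq
  ... | tri< lt _ _ = contradiction (V1-transfer⁻¹ (V-mono (s≤s z≤n) (close (pivot pa))) (first pb _ lt) unit) (pivot-¬V pa)
  ... | tri> _ _ gt = contradiction (V1-transfer (V-mono (s≤s z≤n) (close (pivot pb))) (first pa _ gt) (proj₁ unit)) (pivot-¬V pb)

  -- Since aⱼ x = bⱼ y = 1, one has x aᵢ - y bᵢ = x y (bⱼ - u aⱼ) aᵢ - y (bᵢ - u aᵢ). The pivots are
  -- abstracted to variables so that their equality can be matched.
  chart-cong : ∀ {k a b} (pa : Primitive a) (pb : Primitive b) → Close (suc k) a b →
               ∀ i → V (suc k) (proj₁ (chart pa i) - proj₁ (chart pb i))
  chart-cong {k} {a} {b} pa pb close i = lemma (pivot pa) (pivot pb) (pivot-cong pa pb close) (pivot-inverse pa) (pivot-inverse pb) close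
    where
    lemma : ∀ j j′ → j ≡ j′ → (x : ∃[ u ] (V 0 u × a j * u ≈ 1#)) (y : ∃[ u ] (V 0 u × b j′ * u ≈ 1#)) → Close (suc k) a b →
            V (suc k) (proj₁ x * a (punchIn j i) - proj₁ y * b (punchIn j′ i))
    lemma j .j ≡.refl (x , vx , ax≈1) (y , vy , by≈1) (u , unit , close) = V-cong
      (trans (solve 7 (λ x y u aⱼ aᵢ bⱼ bᵢ →
          x :* y :* (bⱼ :- u :* aⱼ) :* aᵢ :- y :* (bᵢ :- u :* aᵢ) :=
          (bⱼ :* y) :* (x :* aᵢ) :- (aⱼ :* x) :* (y :* u :* aᵢ) :- y :* bᵢ :+ y :* u :* aᵢ)
          refl x y u (a j) (a (punchIn j i)) (b j) (b (punchIn j i)))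
        (trans (+-congʳ (+-congʳ (+-cong (*-congʳ by≈1) (-‿cong (*-congʳ ax≈1)))))
          (solve 5 (λ x y u aᵢ bᵢ → :1 :* (x :* aᵢ) :- :1 :* (y :* u :* aᵢ) :- y :* bᵢ :+ y :* u :* aᵢ := x :* aᵢ :- y :* bᵢ)
            refl x y u (a (punchIn j i)) (b (punchIn j i)))))
      (V-minus (V-*ʳ (V-*ˡ (V-*ˡ vx vy) (close j)) (integral pa (punchIn j i))) (V-*ˡ vy (close (punchIn j i))))

  -- The elements of `Ω` in terms of congruences. Taken for all k, the Lipschitz condition makes the
  -- value independent of the representative and of the proof of primitivity.
  record LipschitzMap : Set where
    field
      to         : ∀ a → Primitive a → Vector Carrier (suc s)
      integral   : ∀ a pa i → V 0 (to a pa i)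
      lipschitz  : ∀ {k a b} pa pb → Close k a b → ∀ i → V k (to a pa i - to b pb i)

  open LipschitzMap using (to; lipschitz)

  difference : LipschitzMap → LipschitzMap → LipschitzMap
  difference f g = record
    { to        = λ a pa i → to f a pa i - to g a pa i
    ; integral  = λ a pa i → V-minus (LipschitzMap.integral f a pa i) (LipschitzMap.integral g a pa i)
    ; lipschitz = λ pa pb close i → V-cong
        (solve 4 (λ a b c d → a :- b :- (c :- d) := a :- c :- (b :- d)) refl _ _ _ _)
        (V-minus (lipschitz f pa pb close i) (lipschitz g pa pb close i))
    }

  coordinates : ∀ {p} {P : Fin (suc s) → Set p} j → P j → (∀ i → P (punchIn j i)) → ∀ i → P i
  coordinates {P = P} j Pj Prest i with j Fin.≟ i
  ... | yes ≡.refl = Pj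
  ... | no  j≢i    = ≡.subst P (Fin.punchIn-punchOut j≢i) (Prest (punchOut j≢i))

  insertAt-V : ∀ {k} {x y : Vector Carrier s} j {e f} → V k (e - f) → (∀ i → V k (x i - y i)) →
               ∀ i → V k (insertAt x j e i - insertAt y j f i)
  insertAt-V {k} {x} {y} j {e} {f} ve vx = coordinates j
    (≡.subst₂ (λ e f → V k (e - f)) (≡.sym (insertAt-lookup x j e)) (≡.sym (insertAt-lookup y j f)) ve)
    λ i → ≡.subst₂ (λ e f → V k (e - f)) (≡.sym (insertAt-punchIn x j e i)) (≡.sym (insertAt-punchIn y j f i)) (vx i)

  cube : DigitSpace (q ℕ.^ s)
  cube = power integers s

  open DigitSpace cube using (Point; Contraction; ≈-refl; head)
  open RandomContractions cube public

  digitwise : ∀ {x : IntegerRing} {y} → DigitSpace.head integers x ≡ DigitSpace.head integers y → V 1 (proj₁ x - proj₁ y)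
  digitwise {x} {y} eq = ≈-trans {1} {x} {x′} {y} (cons-head-tail {1} x)
      (≈-trans {1} {x′} {y′} {y} (lemma eq) (≈-sym {1} {y} {y′} (cons-head-tail {1} y)))
    where
    open DigitSpace integers using (≈-trans; ≈-sym; cons-head-tail; cons; cons-cong; tail; ≈-zero; _≈[_]_)
    x′ = cons (representative x) (tail x)
    y′ = cons (representative y) (tail y)
    lemma : ∀ {δ ε} → δ ≡ ε → cons δ (tail x) ≈[ 1 ] cons ε (tail y)
    lemma {δ} ≡.refl = cons-cong {0} {δ} {tail x} {tail y} (≈-zero (tail x) (tail y))

  -- One tree for each of the s + 1 possible pivots.
  codeCount : ℕ → ℕ
  codeCount n = treeCount (q ℕ.^ s) n ℕ.^ suc s

  -- On the lines with pivot j, the j-th tree acts on the affine coordinates. Lines with different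
  -- pivots already differ modulo π, so the Lipschitz condition does not couple the trees: modulo π
  -- ^ 0 integrality suffices.
  random : ∀ n → Fin (codeCount n) → LipschitzMap
  random n c = record
    { to        = λ a pa → value (pivot pa) (chart pa)
    ; integral  = λ a pa → value-0 (pivot pa) (chart pa)
    ; lipschitz = λ {k} → lip k
    }
    where
    eval : Fin (suc s) → Point → Point
    eval j = evaluate n (finToFun c j)
    value : Fin (suc s) → Point → Vector Carrier (suc s)
    value j α = insertAt (proj₁ ∘ eval j α) j 0#
    value-V : ∀ k j {α β : Point} → (∀ i → V k (proj₁ (α i) - proj₁ (β i))) → ∀ i → V k (value j α i - value j β i)
    value-V k j {α} {β} α≈β = insertAt-V j (V-refl refl) (evaluate-contraction n (finToFun c j) {k} {α} {β} α≈β)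
    value-V′ : ∀ k {j j′} {α β : Point} → j ≡ j′ → (∀ i → V k (proj₁ (α i) - proj₁ (β i))) → ∀ i → V k (value j α i - value j′ β i)
    value-V′ k {j} {α = α} {β} ≡.refl = value-V k j {α} {β}
    value-0 : ∀ j α i → V 0 (value j α i)
    value-0 j α = coordinates j
      (≡.subst (V 0) (≡.sym (insertAt-lookup (proj₁ ∘ eval j α) j 0#)) V-0#)
      λ i → ≡.subst (V 0) (≡.sym (insertAt-punchIn (proj₁ ∘ eval j α) j 0# i)) (proj₂ (eval j α i))
    lip : ∀ k {a b} pa pb → Close k a b → ∀ i → V k (value (pivot pa) (chart {a} pa) i - value (pivot pb) (chart {b} pb) i)
    lip zero    pa pb close i = V-minus (value-0 (pivot pa) (chart pa) i) (value-0 (pivot pb) (chart pb) i)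
    lip (suc k) pa pb close   = value-V′ (suc k) {α = chart pa} {chart pb} (pivot-cong pa pb close) (chart-cong pa pb close)

  embed : Fin (suc s) → Point → Vector Carrier (suc s)
  embed j α = insertAt (proj₁ ∘ α) j 1#

  embed-pivot : ∀ j α → embed j α j ≡ 1#
  embed-pivot j α = insertAt-lookup (proj₁ ∘ α) j 1#

  embed-rest : ∀ j α i → embed j α (punchIn j i) ≡ proj₁ (α i)
  embed-rest j α = insertAt-punchIn (proj₁ ∘ α) j 1#

  embed-primitive : ∀ j α → Primitive (embed j α)
  embed-primitive j α = mkPrimitive
    (coordinates j (≡.subst (V 0) (≡.sym (embed-pivot j α)) V0-1#) λ i → ≡.subst (V 0) (≡.sym (embed-rest j α i)) (proj₂ (α i)))
    (j , λ v → ¬V1-1# (≡.subst (V 1) (embed-pivot j α) v))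

  congruent⇒close : ∀ {k} {a b : Vector Carrier (suc s)} → (∀ i → V k (a i - b i)) → Close k a b
  congruent⇒close {a = a} {b} v = 1# , unit-1# , λ i →
    V-cong (solve 2 (λ a b → :- (a :- b) := b :- :1 :* a) refl (a i) (b i)) (V-neg (v i))

  Canonical : Vector Carrier (suc s) → Fin (suc s) → Vector Carrier (suc s) → Set
  Canonical a j c = (∃[ u ] (IsUnit u × (∀ i → c i ≈ u * a i))) × c j ≈ 1# × (∀ i → i Fin.< j → V 1 (c i))

  -- y lies on one of the lines of the Kakeya set of f, modulo π ^ n.
  Hit : ℕ → LipschitzMap → Vector Carrier (suc s) → Set
  Hit n f y = ∃[ a ] ∃[ pa ] ∃[ c ] ∃[ t ] ((∃[ j ] Canonical a j c) × V 0 t × (∀ i → V n (y i - (t * c i + to f a pa i))))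

  -- The requirement |aᵢ| < 1 before the pivot concerns only the first π-adic digit of each affine
  -- coordinate, so it is a restriction on the head of a match.
  Leading : Fin (suc s) → Fin (q ℕ.^ s) → Set
  Leading j δ = ∀ i → toℕ i ℕ.< toℕ j → finToFun {n = s} δ i ≡ representative (0# , V-0#)

  leading⇔ : ∀ j α → (Leading j (head α) → ∀ i → toℕ i ℕ.< toℕ j → V 1 (proj₁ (α i))) ×
                     ((∀ i → toℕ i ℕ.< toℕ j → V 1 (proj₁ (α i))) → Leading j (head α))
  leading⇔ j α = (λ lead i i<j → V-cong (solve 1 (λ x → x :- :0 := x) refl _)
      (digitwise {α i} {0# , V-0#} (≡.trans (≡.sym (Fin.finToFun-funToFin (representative ∘ α) i)) (lead i i<j)))) ,
    λ v i i<j → ≡.trans (Fin.finToFun-funToFin (representative ∘ α) i)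
      (proj₁ (DigitSpace.head-tail-cong integers {0} {α i} {0# , V-0#} (V-cong (solve 1 (λ x → x := x :- :0) refl _) (v i i<j))))

  punchIn-< : ∀ {n} (j : Fin (suc n)) (i : Fin n) → (toℕ i ℕ.< toℕ j → punchIn j i Fin.< j) × (punchIn j i Fin.< j → toℕ i ℕ.< toℕ j)
  punchIn-< zero    i       = (λ ()) , λ ()
  punchIn-< (suc j) zero    = (λ _ → s≤s z≤n) , λ _ → s≤s z≤n
  punchIn-< (suc j) (suc i) = (λ { (s≤s i<j) → s≤s (proj₁ (punchIn-< j i) i<j) }) , λ { (s≤s i<j) → s≤s (proj₂ (punchIn-< j i) i<j) }

  <⇒punchIn : ∀ {n} (j i : Fin (suc n)) → i Fin.< j → ∃[ i′ ] (punchIn j i′ ≡ i × toℕ i′ ℕ.< toℕ j)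
  <⇒punchIn j i i<j = let j≢i = λ j≡i → ℕ.<-irrefl (≡.cong toℕ (≡.sym j≡i)) i<j in
    punchOut j≢i , Fin.punchIn-punchOut j≢i ,
    proj₂ (punchIn-< j (punchOut j≢i)) (≡.subst (Fin._< j) (≡.sym (Fin.punchIn-punchOut j≢i)) i<j)

  module _ (h : LipschitzMap) (y : Vector Carrier (suc s)) (vy : ∀ i → V 0 (y i)) where

    private
      H : Fin (suc s) → Point → Vector Carrier (suc s)
      H j α = to h (embed j α) (embed-primitive j α)

      vH : ∀ j α i → V 0 (H j α i)
      vH j α = LipschitzMap.integral h (embed j α) (embed-primitive j α)

      H-cong : ∀ {k} j {α β : Point} → (∀ i → V k (proj₁ (α i) - proj₁ (β i))) → ∀ i → V k (H j α i - H j β i)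
      H-cong j {α} {β} α≈β = lipschitz h (embed-primitive j α) (embed-primitive j β)
        (congruent⇒close (insertAt-V {x = proj₁ ∘ α} {proj₁ ∘ β} j (V-refl refl) α≈β))

    -- The line with direction embed j α meets y exactly when the remaining
    -- coordinates of f (embed j α) are those of target j α, f being 0 on
    -- the pivot coordinate; the pivot coordinate determines the parameter t.
    target : Fin (suc s) → Point → Point
    target j α i = (y j - H j α j) * proj₁ (α i) + (H j α (punchIn j i) - y (punchIn j i)) ,
      V-+ (V-*ˡ (V-minus (vy j) (vH j α j)) (proj₂ (α i))) (V-minus (vH j α (punchIn j i)) (vy (punchIn j i)))

    -- A product of integral factors is 1-Lipschitz: (y - Hα) a - (y - Hβ) b = (y - Hα) (a - b) -
    -- (Hα - Hβ) b.
    target-contraction : ∀ j → Contraction (target j)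
    target-contraction j {k} {α} {β} α≈β i = V-cong
      (solve 7 (λ y Hα Hβ a b Hα′ Hβ′ →
         (y :- Hα) :* (a :- b) :- (Hα :- Hβ) :* b :+ (Hα′ :- Hβ′) :=
         (y :- Hα) :* a :- (y :- Hβ) :* b :+ (Hα′ :- Hβ′)) refl (y j) (H j α j) (H j β j) (proj₁ (α i)) (proj₁ (β i)) (H j α (punchIn j i)) (H j β (punchIn j i)) ⟨ trans ⟩
       solve 7 (λ y Hα Hβ a b Hα′ Hβ′ →
         (y :- Hα) :* a :- (y :- Hβ) :* b :+ (Hα′ :- Hβ′) :=
         (y :- Hα) :* a :+ Hα′ :- ((y :- Hβ) :* b :+ Hβ′)) refl (y j) (H j α j) (H j β j) (proj₁ (α i)) (proj₁ (β i)) (H j α (punchIn j i)) (H j β (punchIn j i)) ⟨ trans ⟩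
       solve 4 (λ A A′ B y → A :- B := (A :- y) :- (B :- y)) refl _ 0# _ (y (punchIn j i)) ⟨ trans ⟩
       +-cong (sym (solve 3 (λ A B y → A :+ (B :- y) := A :+ B :- y) refl _ _ _))
         (-‿cong (sym (solve 3 (λ A B y → A :+ (B :- y) := A :+ B :- y) refl _ _ _))))
      (V-+ (V-minus (V-*ˡ (V-minus (vy j) (vH j α j)) (α≈β i)) (V-*ʳ (H-cong j {α} {β} α≈β j) (proj₂ (β i)))) (H-cong j {α} {β} α≈β (punchIn j i)))

    module _ (n : ℕ) (c : Fin (codeCount n)) where

      private
        f = difference h (random n c)

        value : Fin (suc s) → Point → Vector Carrier (suc s)
        value j α = insertAt (proj₁ ∘ evaluate n (finToFun c j) α) j 0#

        random-V : ∀ {k a j α} (pa : Primitive a) → pivot pa ≡ j →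
          (∀ i → V k (proj₁ (chart pa i) - proj₁ (α i))) → ∀ i → V k (to (random n c) a pa i - value j α i)
        random-V {k} {α = α} pa ≡.refl chart≈ = insertAt-V (pivot pa) (V-refl refl)
          (evaluate-contraction n (finToFun c (pivot pa)) {k} {chart pa} {α} chart≈)

        -- `embed j α` is the canonical representative of the line of a, so a has pivot j and affine
        -- coordinates α; equality is recorded as congruence modulo every π ^ k.
        chart-scaled : ∀ {a j u α} (pa : Primitive a) → IsUnit u → (∀ i → embed j α i ≈ u * a i) →
          (∀ i → i Fin.< j → V 1 (embed j α i)) → pivot pa ≡ j × (∀ k i → V k (proj₁ (chart pa i) - proj₁ (α i)))
        chart-scaled {a} {j} {u} {α} pa unit scaled small = pivot≡ , λ k i → chart≈ (pivot pa) pivot≡ (pivot-inverse pa) i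
          where
          pivot≡ : pivot pa ≡ j
          pivot≡ with Fin.<-cmp (pivot pa) j
          ... | tri≈ _ eq _ = eq
          ... | tri< lt _ _ = contradiction (V-unit* unit (V-cong (scaled _) (small _ lt))) (pivot-¬V pa)
          ... | tri> _ _ gt = contradiction (≡.subst (V 1) (embed-pivot j α) (V-cong (sym (scaled j)) (V-*ˡ (proj₁ unit) (first pa _ gt)))) ¬V1-1#
          chart≈ : ∀ p → p ≡ j → (x : ∃[ x ] (V 0 x × a p * x ≈ 1#)) → ∀ {k} i → V k (proj₁ x * a (punchIn p i) - proj₁ (α i))
          chart≈ p ≡.refl (x , _ , ax≈1) i = V-refl (begin
              x * a (punchIn p i)                  ≈⟨ *-identityˡ _ ⟨
              1# * (x * a (punchIn p i))           ≈⟨ *-congʳ (trans (reflexive (≡.sym (embed-pivot p α))) (scaled p)) ⟩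
              u * a p * (x * a (punchIn p i))      ≈⟨ solve 4 (λ u ap x aᵢ → u :* ap :* (x :* aᵢ) := (ap :* x) :* (u :* aᵢ)) refl u (a p) x (a (punchIn p i)) ⟩
              a p * x * (u * a (punchIn p i))      ≈⟨ *-congʳ ax≈1 ⟩
              1# * (u * a (punchIn p i))           ≈⟨ *-identityˡ _ ⟩
              u * a (punchIn p i)                  ≈⟨ scaled (punchIn p i) ⟨
              embed p α (punchIn p i)              ≡⟨ embed-rest p α i ⟩
              proj₁ (α i)                          ∎)
            where
            open import Relation.Binary.Reasoning.Setoid (CommutativeRing.setoid commutativeRing)
            open CommutativeRing commutativeRing using (reflexive)

        offset-V : ∀ {a j u α} (pa : Primitive a) → IsUnit u → (∀ i → embed j α i ≈ u * a i) →
          (∀ i → i Fin.< j → V 1 (embed j α i)) → ∀ k i → V k (to f a pa i - (H j α i - value j α i))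
        offset-V {a} {j} {u} {α} pa unit scaled small k i = V-cong
          (solve 4 (λ a b c d → a :- c :- (b :- d) := a :- b :- (c :- d)) refl _ _ _ _)
          (V-minus (lipschitz h pa (embed-primitive j α) (u , unit , λ i → V-refl (scaled i)) i)
               (let (pivot≡ , chart≈) = chart-scaled {α = α} pa unit scaled small in random-V pa pivot≡ (chart≈ k) i))

        -- At the pivot the direction is 1 and the random map is 0, which gives t ≡ yⱼ - Hⱼ modulo π
        -- ^ n; eliminating t from the other coordinates leaves target ≡ evaluate. Backward, t is
        -- chosen to satisfy the pivot equation exactly.
        match-coordinates : ∀ j α t → V 0 t →
          let line = λ i → t * embed j α i + (H j α i - value j α i) in
          ((∀ i → V n (y i - line i)) → ∀ i → V n (proj₁ (target j α i) - proj₁ (evaluate n (finToFun c j) α i))) ×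
          (t ≈ y j - H j α j → (∀ i → V n (proj₁ (target j α i) - proj₁ (evaluate n (finToFun c j) α i))) → ∀ i → V n (y i - line i))
        match-coordinates j α t vt = forward , backward
          where
          E : Fin s → Carrier
          E i = proj₁ (evaluate n (finToFun c j) α i)
          G : Fin (suc s) → Carrier
          G i = y i - (t * embed j α i + (H j α i - value j α i))
          at-pivot : G j ≈ y j - (t + H j α j)
          at-pivot = trans
            (+-congˡ (-‿cong (+-cong (*-congˡ (reflexive (embed-pivot j α))) (+-congˡ (-‿cong (reflexive (insertAt-lookup (proj₁ ∘ evaluate n (finToFun c j) α) j 0#)))))))
            (solve 3 (λ y t H → y :- (t :* :1 :+ (H :- :0)) := y :- (t :+ H)) refl (y j) t (H j α j))
            where open CommutativeRing commutativeRing using (reflexive)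
          at-rest : ∀ i → G (punchIn j i) ≈ y (punchIn j i) - (t * proj₁ (α i) + (H j α (punchIn j i) - E i))
          at-rest i = +-congˡ (-‿cong (+-cong (*-congˡ (reflexive (embed-rest j α i))) (+-congˡ (-‿cong (reflexive (insertAt-punchIn (proj₁ ∘ evaluate n (finToFun c j) α) j 0# i))))))
            where open CommutativeRing commutativeRing using (reflexive)
          forward : (∀ i → V n (G i)) → ∀ i → V n (proj₁ (target j α i) - E i)
          forward v i = V-cong
            (solve 7 (λ yj Hj t a H yi E → (yj :- (t :+ Hj)) :* a :- (yi :- (t :* a :+ (H :- E))) := (yj :- Hj) :* a :+ (H :- yi) :- E)
              refl (y j) (H j α j) t (proj₁ (α i)) (H j α (punchIn j i)) (y (punchIn j i)) (E i))
            (V-minus (V-*ʳ (V-cong at-pivot (v j)) (proj₂ (α i))) (V-cong (at-rest i) (v (punchIn j i))))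
          backward : t ≈ y j - H j α j → (∀ i → V n (proj₁ (target j α i) - E i)) → ∀ i → V n (G i)
          backward t≈ v = coordinates j
            (V-≈0 (trans at-pivot (trans (+-congˡ (-‿cong (+-congʳ t≈))) (solve 2 (λ y H → y :- (y :- H :+ H) := :0) refl (y j) (H j α j)))))
            λ i → V-cong (sym (trans (at-rest i) (trans (+-congˡ (-‿cong (+-congʳ (*-congʳ t≈))))
              (solve 4 (λ A H y E → y :- (A :+ (H :- E)) := :- (A :+ (H :- y) :- E)) refl ((y j - H j α j) * proj₁ (α i)) _ _ _)))) (V-neg (v i))

      hit⇒match : Hit n f y → ∃[ j ] Match n (target j) (finToFun c j) (Leading j)
      hit⇒match (a , pa , b , t , (j , (u , unit , scaled) , bⱼ≈1 , small) , vt , close) = j , α ,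
          proj₂ (leading⇔ j α) (λ i i<j → small (punchIn j i) (proj₁ (punchIn-< j i) i<j)) ,
          proj₁ (match-coordinates j α t vt) λ i → V-cong
            (trans (solve 5 (λ y t b F L → y :- (t :* b :+ F) :+ (F :- L) := y :- (t :* b :+ L)) refl (y i) t (b i) (to f a pa i) _)
              (+-congˡ (-‿cong (+-congʳ (*-congˡ (sym (embed≈ i)))))))
            (V-+ (close i) (offset-V {α = α} pa unit (λ i → trans (embed≈ i) (scaled i)) (λ i i<j → V-cong (sym (embed≈ i)) (small i i<j)) n i))
        where
        α : Point
        α i = b (punchIn j i) , V-cong (sym (scaled (punchIn j i))) (V-*ˡ (proj₁ unit) (Primitive.integral pa (punchIn j i)))
        embed≈ : ∀ i → embed j α i ≈ b i
        embed≈ = coordinates j (trans (reflexive (embed-pivot j α)) (sym bⱼ≈1)) λ i → reflexive (embed-rest j α i)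
          where open CommutativeRing commutativeRing using (reflexive)

      match⇒hit : ∃[ j ] Match n (target j) (finToFun c j) (Leading j) → Hit n f y
      match⇒hit (j , α , lead , match) = a , pa , a , t , (j , (1# , unit-1# , scaled) , reflexive (embed-pivot j α) , small) , vt ,
          λ i → V-cong (solve 5 (λ y t b F L → y :- (t :* b :+ L) :- (F :- L) := y :- (t :* b :+ F)) refl (y i) t (a i) (to f a pa i) _)
            (V-minus (proj₂ (match-coordinates j α t vt) refl match i)
                 (offset-V {α = α} pa unit-1# scaled small n i))
        where
        open CommutativeRing commutativeRing using (reflexive)
        a = embed j α
        pa = embed-primitive j α
        t = y j - H j α j
        vt = V-minus (vy j) (vH j α j)
        scaled : ∀ i → a i ≈ 1# * a i
        scaled i = sym (*-identityˡ (a i))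
        small : ∀ i → i Fin.< j → V 1 (a i)
        small i i<j = let (i′ , punchIn≡ , i′<j) = <⇒punchIn j i i<j in
          ≡.subst (λ i → V 1 (a i)) punchIn≡ (≡.subst (V 1) (≡.sym (embed-rest j α i′)) (proj₁ (leading⇔ j α) lead i′ i′<j))

-- The number of translates whose Kakeya set meets a given point.

module HitCount (em : ∀ {ℓ} → ExcludedMiddle ℓ) (R : CompleteOrderedField) (𝕂 : LocalField) (s : ℕ) where

  open Reals em R
  open Counting em R
  open Charts em 𝕂 s
  open LocalField 𝕂 using (q)
  open IntegerDigits em 𝕂 using (representative)
  module F = Valuation em 𝕂

  0<q^s : 0 ℕ.< q ℕ.^ s
  0<q^s = ℕ.m^n>0 q {{ℕ.>-nonZero (ℕ.≤-trans (s≤s z≤n) F.1<q)}} s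

  open Survival (q ℕ.^ s)

  hitProbability : ℕ → ℝ
  hitProbability r = 1# - branchDeath r ^ lineCount q (suc s)

  count-hits : ∀ r h y → (∀ i → F.V 0 (y i)) →
    sum (λ c → 𝟙 (Hit (suc r) (difference h (random (suc r) c)) y)) ≈ fromℕ (codeCount (suc r)) * hitProbability r
  count-hits r h y vy = begin
    sum {N ℕ.^ suc s} (λ c → 𝟙 (Hit n (difference h (random n c)) y))
      ≈⟨ sum-cong-≋ {N ℕ.^ suc s} (λ c → trans (solve 1 (λ x → x := :1 :- (:1 :- x)) refl _) (+-congˡ (-‿cong (trans (sym (𝟙-¬ _))
           (𝟙-cong (λ ¬hit → ¬hit ∘ match⇒hit h y vy n c) (λ ¬match → ¬match ∘ hit⇒match h y vy n c)))))) ⟩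
    sum {N ℕ.^ suc s} (λ c → 1# - 𝟙 (¬ ∃ λ j → Match n (T j) (finToFun c j) (Leading j)))
      ≈⟨ sum-difference {N ℕ.^ suc s} _ _ ⟩
    sum {N ℕ.^ suc s} (λ c → 1#) - sum {N ℕ.^ suc s} (λ c → 𝟙 (¬ ∃ λ j → Match n (T j) (finToFun c j) (Leading j)))
      -- The trees of the s + 1 charts are independent components of c, so the number of codes
      -- missing y in every chart is a product over j.
      ≈⟨ +-cong (trans (sum-const (N ℕ.^ suc s) 1#) (*-identityʳ _))
           (-‿cong (trans (sum-cong-≋ {N ℕ.^ suc s} λ c → 𝟙-∄ λ j → Match n (T j) (finToFun c j) (Leading j))
             (product-sum N (suc s) (λ j x → 𝟙 (¬ Match n (T j) x (Leading j)))))) ⟩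
    fromℕ (N ℕ.^ suc s) - product {suc s} (λ j → sum {N} (λ x → 𝟙 (¬ Match n (T j) x (Leading j))))
      ≈⟨ +-congˡ (-‿cong unmatched) ⟩
    fromℕ (N ℕ.^ suc s) - fromℕ (N ℕ.^ suc s) * w ^ lineCount q (suc s)
      ≈⟨ solve 2 (λ n p → n :- n :* p := n :* (:1 :- p)) refl _ _ ⟩
    fromℕ (N ℕ.^ suc s) * hitProbability r  ∎
    where
    open ≈-Reasoning
    n = suc r
    N = treeCount (q ℕ.^ s) n
    w = branchDeath r
    T = target h y vy
    unmatched : product {suc s} (λ j → sum {N} (λ x → 𝟙 (¬ Match n (T j) x (Leading j)))) ≈ fromℕ (N ℕ.^ suc s) * w ^ lineCount q (suc s)
    unmatched = begin
      product {suc s} (λ j → sum {N} (λ x → 𝟙 (¬ Match n (T j) x (Leading j))))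
        ≈⟨ product-cong {suc s} (λ j → trans (count-unmatchedOn 0<q^s cube r {T j} (λ {k} {α} {β} → target-contraction h y vy j {k} {α} {β}) (Leading j))
             (*-congˡ (product-leadingDigits _ s w (Fin.toℕ≤pred[n] j)))) ⟩
      product {suc s} (λ j → fromℕ N * w ^ (q ℕ.^ (s ℕ.∸ toℕ j)))
        ≈⟨ product-distrib-* {suc s} (λ j → fromℕ N) (λ j → w ^ (q ℕ.^ (s ℕ.∸ toℕ j))) ⟩
      product {suc s} (λ j → fromℕ N) * product {suc s} (λ j → w ^ (q ℕ.^ (s ℕ.∸ toℕ j)))
        ≈⟨ *-cong (trans (product-replicate (suc s)) (sym (fromℕ-^ N (suc s)))) (product-powers q s w) ⟩
      fromℕ (N ℕ.^ suc s) * w ^ lineCount q (suc s)  ∎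

-- Congruence identities used with vectors and translations.

module Congruences (em : ∀ {ℓ} → ExcludedMiddle ℓ) (𝕂 : LocalField) where

  open Valuation em 𝕂
  open IntegerDigits em 𝕂

  V⇒≈ : ∀ {x y} → (∀ k → V k (x - y)) → x ≈ y
  V⇒≈ {x} {y} v = trans (solve 2 (λ x y → x := x :- y :+ y) refl x y)
    (trans (+-congʳ (V⇒≈0 v)) (solve 1 (λ y → :0 :+ y := y) refl y))

  V-cong₂ : ∀ {k x x′ y y′} → x ≈ x′ → y ≈ y′ → V k (x - y) → V k (x′ - y′)
  V-cong₂ x≈x′ y≈y′ = V-cong (+-cong x≈x′ (-‿cong y≈y′))

  -- Turns a congruence between chosen representatives u a and v b into `Close` for a and b
  -- themselves, with the unit u / v.
  V-unscale : ∀ {k u v v′ a b â b̂} → â ≈ u * a → b̂ ≈ v * b → v * v′ ≈ 1# → V 0 v′ →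
              V k (â - b̂) → V k (b - (v′ * u) * a)
  V-unscale {u = u} {v} {v′} {a} {b} {â} {b̂} â≈ b̂≈ vv′ v′₀ close = V-cong
    (trans (*-congˡ (-‿cong (+-cong â≈ (-‿cong b̂≈))))
      (trans (solve 5 (λ u v w a b → w :* (:- (u :* a :- v :* b)) := (v :* w) :* b :- (w :* u) :* a) refl u v v′ a b)
        (+-congʳ (trans (*-congʳ vv′) (*-identityˡ b)))))
    (V-*ˡ v′₀ (V-neg close))

  V-shift : ∀ {k y y′ x} → V k (y - y′) → V k (y - x) → V k (y′ - x)
  V-shift close = V-trans (V-sym close)

  V-shiftʳ : ∀ {k y x x′ L} → V k (x - x′) → V k (y - (L + x)) → V k (y - (L + x′))
  V-shiftʳ {y = y} {x} {x′} {L} close = λ v → V-cong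
    (solve 4 (λ y x x′ L → y :- (L :+ x) :+ (x :- x′) := y :- (L :+ x′)) refl y x x′ L) (V-+ v close)

  V0-from-close : ∀ {k y x} → V k (y - x) → V 0 x → V 0 y
  V0-from-close {y = y} {x} close vx = V-cong (solve 2 (λ y x → y :- x :+ x := y) refl y x) (V-+ (V-mono z≤n close) vx)

  minus-plus : ∀ z g → z ≈ (z - g) + g
  minus-plus = solve 2 (λ z g → z := z :- g :+ g) refl

  sum-minus : ∀ {x g z w} → z ≈ x + g → w ≈ z - g → x - w ≈ 0#
  sum-minus {x} {g} {z} {w} z≈ w≈ = trans (+-congˡ (-‿cong (trans w≈ (+-congʳ z≈)))) (solve 2 (λ x g → x :- (x :+ g :- g) := :0) refl x g)

  sum-minus′ : ∀ {x g z w} → z ≈ x + g → w ≈ z - g → w - x ≈ 0#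
  sum-minus′ {x} {g} {z} {w} z≈ w≈ = trans (solve 2 (λ w x → w :- x := :- (x :- w)) refl w x)
    (trans (-‿cong (sum-minus z≈ w≈)) (solve 0 (:- :0 := :0) refl))

  minus-minus : ∀ {z z′ g w w′} → w ≈ z - g → w′ ≈ z′ - g → z - z′ ≈ w - w′
  minus-minus {z} {z′} {g} w≈ w′≈ = trans (solve 3 (λ z z′ g → z :- z′ := z :- g :- (z′ :- g)) refl z z′ g)
    (+-cong (sym w≈) (-‿cong (sym w′≈)))

-- Translation between norms and divisibility.

module Norms (em : ∀ {ℓ} → ExcludedMiddle ℓ) (R : CompleteOrderedField) (𝕂 : LocalField) (d : ℕ) where

  open Reals em R
  open Kakeya em R 𝕂 d using (norm; ‖_‖; Kᵈ; _-ᵈ_)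
  module F = Valuation em 𝕂
  open F using (q; V; val)
  private module ℤ⁺≤ = Relation.Binary.Construct.Add.Supremum.NonStrict ℤ._≤_

  1<Q : 1# < fromℕ q
  1<Q = <-≤-trans (0<⇒< 0<1 (solve 0 (:1 := :1 :+ (:1 :+ :0) :- :1) refl)) (fromℕ-mono-≤ F.1<q)

  0<Q : 0# < fromℕ q
  0<Q = <-trans 0<1 1<Q

  radius : ℕ → ℝ
  radius k = (fromℕ q ^ k) ⁻¹

  radius-pos : ∀ k → 0# < radius k
  radius-pos k = ⁻¹-pos (^-pos k 0<Q)

  radius-anti : ∀ {m n} → m ℕ.≤ n → radius n ≤ radius m
  radius-anti {m} {n} m≤n = ⁻¹-anti-≤ (^-pos m 0<Q) (^-monoʳ-≤ (<⇒≤ 1<Q) m≤n)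

  radius-cancel : ∀ {m n} → radius m ≤ radius n → n ℕ.≤ m
  radius-cancel {m} {n} m≤n = ^-cancelʳ-≤ 1<Q (≤-resp₂
    (trans (solve 3 (λ a b i → i :* (a :* b) := (a :* i) :* b) refl (fromℕ q ^ m) (fromℕ q ^ n) (radius m))
      (trans (*-congʳ (⁻¹-inverse (^-pos m 0<Q))) (*-identityˡ _)))
    (trans (solve 3 (λ a b i → i :* (a :* b) := (b :* i) :* a) refl (fromℕ q ^ m) (fromℕ q ^ n) (radius n))
      (trans (*-congʳ (⁻¹-inverse (^-pos n 0<Q))) (*-identityˡ _)))
    (*-monoʳ-≤ (*-nonneg (<⇒≤ (^-pos m 0<Q)) (<⇒≤ (^-pos n 0<Q))) m≤n))

  radius-< : ∀ {m n} → m ℕ.< n → radius n < radius m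
  radius-< m<n = ≰⇒> λ m≤n → ℕ.<⇒≱ m<n (radius-cancel m≤n)

  radius-0 : radius 0 ≈ 1#
  radius-0 = 1⁻¹≈1

  -- Factors `norm` through the valuation, so that a known value of `val x` can be substituted in
  -- it.
  size : ℤ ⁺ → ℝ
  size [ n ] = fromℕ q ^ᶻ (ℤ.- n)
  size ⊤⁺    = 0#

  norm-size : ∀ x → norm x ≡ size (val x)
  norm-size x with val x
  ... | [ _ ] = ≡.refl
  ... | ⊤⁺    = ≡.refl

  size-+ : ∀ n → size [ + n ] ≈ radius n
  size-+ zero    = sym radius-0
  size-+ (suc n) = refl

  1≤size : ∀ n k → ¬ (size [ -[1+ n ] ] ≤ radius k)
  1≤size n k ≤radius = <⇒≱ 1<Q (≤-respˡ-≈ (*-identityʳ _)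
    (≤-trans (*-monoˡ-≤ (<⇒≤ 0<Q) (1≤^ n (<⇒≤ 1<Q))) (≤-trans ≤radius (≤-respʳ-≈ radius-0 (radius-anti {0} {k} z≤n)))))

  size-≤ : ∀ {k} v → [ + k ] ℤ⁺≤.≤⁺ v → size v ≤ radius k
  size-≤ [ + n ] ℤ⁺≤.[ ℤ.+≤+ k≤n ] = ≤-respˡ-≈ (sym (size-+ n)) (radius-anti k≤n)
  size-≤ {k} ⊤⁺ _ = <⇒≤ (radius-pos k)

  size-≤⇒ : ∀ {k} v → size v ≤ radius k → [ + k ] ℤ⁺≤.≤⁺ v
  size-≤⇒ [ + n ]          v≤ = ℤ⁺≤.[ ℤ.+≤+ (radius-cancel (≤-respˡ-≈ (size-+ n) v≤)) ]
  size-≤⇒ {k} [ -[1+ n ] ] v≤ = contradiction v≤ (1≤size n k)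
  size-≤⇒ ⊤⁺               v≤ = _ ℤ⁺≤.≤⊤⁺

  -- The valuation is discrete: the norm takes no value strictly between q ^ -(k + 1) and q ^ -k.
  size-<⇒ : ∀ {k} v → size v < radius k → [ + suc k ] ℤ⁺≤.≤⁺ v
  size-<⇒ {k} [ + n ]      v< = ℤ⁺≤.[ ℤ.+≤+ (ℕ.≰⇒> λ n≤k → <⇒≱ v< (≤-respʳ-≈ (sym (size-+ n)) (radius-anti n≤k))) ]
  size-<⇒ {k} [ -[1+ n ] ] v< = contradiction (<⇒≤ v<) (1≤size n k)
  size-<⇒ ⊤⁺               v< = _ ℤ⁺≤.≤⊤⁺

  V⇒norm≤ : ∀ {k} x → V k x → norm x ≤ radius k
  V⇒norm≤ x v = ≡.subst (_≤ _) (≡.sym (norm-size x)) (size-≤ (val x) v)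

  norm≤⇒V : ∀ {k} x → norm x ≤ radius k → V k x
  norm≤⇒V x n≤ = size-≤⇒ (val x) (≡.subst (_≤ _) (norm-size x) n≤)

  norm<⇒V : ∀ {k} x → norm x < radius k → V (suc k) x
  norm<⇒V x n< = size-<⇒ (val x) (≡.subst (_< _) (norm-size x) n<)

  norm-cong : ∀ {x y} → x F.≈ y → norm x ≡ norm y
  norm-cong {x} {y} x≈y = ≡.trans (norm-size x) (≡.trans (≡.cong size (F.val-cong x≈y)) (≡.sym (norm-size y)))

  norm-0 : ∀ {x} → x F.≈ F.0# → norm x ≡ 0#
  norm-0 {x} x≈0 = ≡.trans (norm-size x) (≡.cong size (≡.trans (F.val-cong x≈0) F.val-0))

  private
    maximum : ∀ {n} → Vector ℝ n → ℝ
    maximum = foldr max 0#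

    maximum-upper : ∀ {n} (v : Vector ℝ n) i → v i ≤ maximum v
    maximum-upper v zero    = x≤x⊔y (v zero) _
    maximum-upper v (suc i) = ≤-trans (maximum-upper (v ∘ suc) i) (x≤y⊔x (v zero) _)

    maximum-least : ∀ {n u} (v : Vector ℝ n) → 0# ≤ u → (∀ i → v i ≤ u) → maximum v ≤ u
    maximum-least {zero}  v 0≤u v≤u = 0≤u
    maximum-least {suc n} v 0≤u v≤u = ⊔-lub (v≤u zero) (maximum-least (v ∘ suc) 0≤u (v≤u ∘ suc))

    maximum-nonneg : ∀ {n} (v : Vector ℝ n) → 0# ≤ maximum v
    maximum-nonneg {zero}  v = ≤-refl
    maximum-nonneg {suc n} v = ≤-trans (maximum-nonneg (v ∘ suc)) (x≤y⊔x (v zero) _)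

  norm≤‖‖ : ∀ x i → norm (x i) ≤ ‖ x ‖
  norm≤‖‖ x = maximum-upper (norm ∘ x)

  ‖‖-least : ∀ {u} x → 0# ≤ u → (∀ i → norm (x i) ≤ u) → ‖ x ‖ ≤ u
  ‖‖-least x = maximum-least (norm ∘ x)

  ‖‖-nonneg : ∀ x → 0# ≤ ‖ x ‖
  ‖‖-nonneg x = maximum-nonneg (norm ∘ x)

  V⇒‖‖≤ : ∀ {k} x → (∀ i → V k (x i)) → ‖ x ‖ ≤ radius k
  V⇒‖‖≤ {k} x v = ‖‖-least x (<⇒≤ (radius-pos k)) λ i → V⇒norm≤ (x i) (v i)

  ‖‖≤⇒V : ∀ {k} x → ‖ x ‖ ≤ radius k → ∀ i → V k (x i)
  ‖‖≤⇒V x x≤ i = norm≤⇒V (x i) (≤-trans (norm≤‖‖ x i) x≤)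

  ‖‖<⇒V : ∀ {k} x → ‖ x ‖ < radius k → ∀ i → V (suc k) (x i)
  ‖‖<⇒V x x< i = norm<⇒V (x i) (≤-<-trans (norm≤‖‖ x i) x<)

  ‖‖-≤-cong : ∀ {u x y} → (∀ i → x i F.≈ y i) → ‖ x ‖ ≤ u → ‖ y ‖ ≤ u
  ‖‖-≤-cong {u} {x} {y} x≈y x≤ = ‖‖-least y (≤-trans (‖‖-nonneg x) x≤) λ i →
    ≡.subst (_≤ u) (norm-cong (x≈y i)) (≤-trans (norm≤‖‖ x i) x≤)

  ‖‖-≈0 : ∀ {u} x → 0# < u → (∀ i → x i F.≈ F.0#) → ‖ x ‖ ≤ u
  ‖‖-≈0 x 0<u x≈0 = ‖‖-least x (<⇒≤ 0<u) λ i → ≡.subst (_≤ _) (≡.sym (norm-0 (x≈0 i))) (<⇒≤ 0<u)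

  -- The values of the norm are discrete, so norms are compared through the
  -- powers of π dividing the vectors.
  ‖‖-dominated : ∀ {x y} → (∀ i → V 0 (x i)) → (∀ k → (∀ i → V k (y i)) → ∀ i → V k (x i)) → ‖ x ‖ ≤ ‖ y ‖
  ‖‖-dominated {x} {y} x₀ dominated = ‖‖-least x (‖‖-nonneg y) λ i → ≮⇒≥ λ y<xᵢ → impossible i y<xᵢ (val (x i)) ≡.refl
    where
    V-at : ∀ i {v k} → val (x i) ≡ v → V k (x i) → [ + k ] ℤ⁺≤.≤⁺ v
    V-at i {k = k} = ≡.subst ([ + k ] ℤ⁺≤.≤⁺_)
    impossible : ∀ i → ‖ y ‖ < norm (x i) → ∀ v → val (x i) ≡ v → ⊥
    impossible i y<xᵢ ⊤⁺ eq = <⇒≱ y<xᵢ (≡.subst (_≤ ‖ y ‖) (≡.sym (≡.trans (norm-size (x i)) (≡.cong size eq))) (‖‖-nonneg y))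
    impossible i y<xᵢ [ -[1+ n ] ] eq with V-at i eq (x₀ i)
    ... | ℤ⁺≤.[ () ]
    impossible i y<xᵢ [ + n ] eq with V-at i eq (dominated (suc n) (‖‖<⇒V y y<radius) i)
      where
      y<radius : ‖ y ‖ < radius n
      y<radius = <-respʳ-≈ (size-+ n) (≡.subst (‖ y ‖ <_) (≡.trans (norm-size (x i)) (≡.cong size eq)) y<xᵢ)
    ... | ℤ⁺≤.[ ℤ.+≤+ 1+n≤n ] = ℕ.1+n≰n 1+n≤n

-- The expected volume at a fixed scale.

module RandomKakeya (em : ∀ {ℓ} → ExcludedMiddle ℓ) (R : CompleteOrderedField) (𝕂 : LocalField) (s : ℕ) where

  open Reals em R
  open Counting em R
  open ExtendedReals em R
  open Norms em R 𝕂 (suc s)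
  open Kakeya em R 𝕂 (suc s) using (norm; ‖_‖; _≈ᴷ_; _+ᴷ_; _*ᴷ_; _-ᴷ_; Kᵈ; _≈ᵈ_; _-ᵈ_; Rᵈ; ℙ; _~_; dist; Ω; HaarKᵈ; HaarΩ; kakeya; neighbourhood; X; 𝔼; module MeasuresKᵈ; module MeasuresΩ)
  open Kakeya.Ω using (to; cong; integral; lipschitz)
  open F using (q; V; IsUnit; unit-1#; unit-*; unit-inverse)
  open Congruences em 𝕂
  open IntegerDigits em 𝕂 using (V-refl; V-sym; V-trans)
  open Charts em 𝕂 s
  open HitCount em R 𝕂 s using (hitProbability; count-hits; 0<q^s)
  module L = LipschitzMap

  primitive⇒unit : ∀ {a} → Primitive a → ‖ a ‖ ≈ 1#
  primitive⇒unit {a} pa = antisym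
    (≤-respʳ-≈ radius-0 (V⇒‖‖≤ a (Primitive.integral pa)))
    (≮⇒≥ λ a<1 → Primitive.pivot-¬V pa (‖‖<⇒V a (<-respʳ-≈ (sym radius-0) a<1) (Primitive.pivot pa)))

  unit⇒primitive : ∀ {a} → ‖ a ‖ ≈ 1# → Primitive a
  unit⇒primitive {a} ‖a‖≈1 = mkPrimitive (‖‖≤⇒V a (≤-reflexive (trans ‖a‖≈1 (sym radius-0)))) ∃¬V
    where
    ∃¬V : ∃[ i ] ¬ V 1 (a i)
    ∃¬V with em {P = ∃[ i ] ¬ V 1 (a i)}
    ... | yes ∃¬V = ∃¬V
    ... | no ¬∃ = contradiction (≤-respˡ-≈ ‖a‖≈1 (V⇒‖‖≤ {1} a all-V1)) (<⇒≱ (<-respʳ-≈ radius-0 (radius-< {0} {1} (s≤s z≤n))))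
      where
      all-V1 : ∀ i → V 1 (a i)
      all-V1 i with em {P = V 1 (a i)}
      ... | yes v = v
      ... | no ¬v = contradiction (i , ¬v) ¬∃

  scaled-primitive : ∀ {u a b} → IsUnit u → (∀ i → b i ≈ᴷ (u *ᴷ a i)) → Primitive a → Primitive b
  scaled-primitive unit b≈ pa = mkPrimitive
    (λ i → F.V-cong (F.sym (b≈ i)) (F.V-*ˡ (proj₁ unit) (Primitive.integral pa i)))
    (Primitive.pivot pa , λ v → Primitive.pivot-¬V pa (F.V-unit* unit (F.V-cong (b≈ _) v)))

  ~-refl : ∀ {a b : ℙ} → (∀ i → proj₁ a i ≈ᴷ proj₁ b i) → a ~ b
  ~-refl a≈b = F.1# , unit-1# , λ i → F.trans (F.sym (a≈b i)) (F.sym (F.*-identityˡ _))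

  -- a and b represent themselves, so the set of distances is nonempty, and it is bounded below by
  -- 0; `dist` is therefore a genuine infimum and not a default value.
  dist-glb : ∀ a b → IsGlb _≤_ (λ r → ∃[ â ] ∃[ b̂ ] (a ~ â × b ~ b̂ × r ≈ ‖ proj₁ â -ᵈ proj₁ b̂ ‖)) (dist a b)
  dist-glb a b = inf-isGlb (_ , a , b , ~-refl {a} {a} (λ _ → F.refl) , ~-refl {b} {b} (λ _ → F.refl) , refl)
    λ { r (â , b̂ , _ , _ , r≈) → ≤-respʳ-≈ (sym r≈) (‖‖-nonneg (proj₁ â -ᵈ proj₁ b̂)) }

  toMap : Ω → LipschitzMap
  toMap f = record
    { to        = λ a pa → to f (a , primitive⇒unit pa)
    ; integral  = λ a pa → integral f (a , primitive⇒unit pa)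
    ; lipschitz = lip
    }
    where
    lip : ∀ {k a b} (pa : Primitive a) (pb : Primitive b) → Close k a b →
          ∀ i → V k (to f (a , primitive⇒unit pa) i -ᴷ to f (b , primitive⇒unit pb) i)
    -- The representative u a of the first line is used: `dist` is at most the norm of u a - b,
    -- which `close` bounds.
    lip {k} {a} {b} pa pb (u , unit , close) i = V-cong₂ (F.sym (cong f {a , primitive⇒unit pa} {a′} (u , unit , λ _ → F.refl) i)) F.refl
      (‖‖≤⇒V (λ i → to f a′ i -ᴷ to f b′ i) (≤-trans (lipschitz f a′ b′) (≤-trans
        (proj₁ (dist-glb a′ b′) _ (a′ , b′ , ~-refl {a′} {a′} (λ _ → F.refl) , ~-refl {b′} {b′} (λ _ → F.refl) , refl))
        (V⇒‖‖≤ _ λ i → V-sym (close i)))) i)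
      where
      a′ b′ : ℙ
      a′ = (λ i → u *ᴷ a i) , primitive⇒unit (scaled-primitive unit (λ _ → F.refl) pa)
      b′ = b , primitive⇒unit pb

  -- The Lipschitz bound holds because the norm of the difference of the values is a lower bound for
  -- the distances of all representatives: a congruence between these becomes `Close` for a and b
  -- after division by a unit.
  fromMap : LipschitzMap → Ω
  fromMap f = record
    { to        = λ { (a , ‖a‖≈1) → L.to f a (unit⇒primitive ‖a‖≈1) }
    ; cong      = λ { {a , ‖a‖≈1} {b , ‖b‖≈1} (u , unit , b≈) i → V⇒≈ λ k →
        L.lipschitz f (unit⇒primitive ‖a‖≈1) (unit⇒primitive ‖b‖≈1) (u , unit , λ i → V-refl (b≈ i)) i }
    ; integral  = λ { (a , ‖a‖≈1) → L.integral f a (unit⇒primitive ‖a‖≈1) }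
    ; lipschitz = λ { (a , ‖a‖≈1) (b , ‖b‖≈1) → proj₂ (dist-glb (a , ‖a‖≈1) (b , ‖b‖≈1)) _
        λ { r (â , b̂ , (u , u-unit , â≈) , (v , v-unit , b̂≈) , r≈) → ≤-respʳ-≈ (sym r≈)
          (‖‖-dominated (λ i → F.V-minus (L.integral f a _ i) (L.integral f b _ i)) λ k close →
            L.lipschitz f (unit⇒primitive ‖a‖≈1) (unit⇒primitive ‖b‖≈1)
              (let (v′ , v′-unit , vv′≈1) = unit-inverse v-unit in
               v′ *ᴷ u , unit-* v′-unit u-unit , λ i → V-unscale (â≈ i) (b̂≈ i) vv′≈1 (proj₁ v′-unit) (close i))) } }
    }

  -- Passing to `Ω` and back changes the proof of primitivity; the values agree modulo every π ^ k,
  -- hence are equal.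
  toMap-fromMap : ∀ f {a} pa pa′ i → L.to f a pa i ≈ᴷ L.to f a pa′ i
  toMap-fromMap f pa pa′ i = V⇒≈ λ k → L.lipschitz f pa pa′ (congruent⇒close λ _ → V-refl F.refl) i

  -- The same vector with its proof of norm 1 rebuilt from primitivity. Elements of `Ω` take that
  -- proof as an argument, so the two points have to be related through `cong`.
  normalised : ℙ → ℙ
  normalised a = proj₁ a , primitive⇒unit {proj₁ a} (unit⇒primitive {proj₁ a} (proj₂ a))

  infixl 6 _⊖_
  _⊖_ : Ω → Ω → Ω
  f ⊖ g = fromMap (difference (toMap f) (toMap g))

  ⊖-to : ∀ f g a i → to (f ⊖ g) a i ≈ᴷ (to f a i -ᴷ to g a i)
  ⊖-to f g a i = F.+-cong (same f) (F.-‿cong (same g))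
    where
    same : ∀ f → to f (normalised a) i ≈ᴷ to f a i
    same f = cong f (~-refl {normalised a} {a} (λ _ → F.refl)) i

  hit-cong : ∀ n f g y → (∀ a pa i → V n (L.to f a pa i -ᴷ L.to g a pa i)) → Hit n f y → Hit n g y
  hit-cong n f g y f≈g (a , pa , c , t , can , vt , close) = a , pa , c , t , can , vt ,
    λ i → V-shiftʳ (f≈g a pa i) (close i)

  KakeyaHit : ℕ → Ω → Kᵈ → Set
  KakeyaHit n f y = ∃[ x ] (x ∈ kakeya f × (∀ i → V n (y i -ᴷ x i)))

  kakeyaHit⇒hit : ∀ n f y → KakeyaHit n f y → Hit n (toMap f) y
  kakeyaHit⇒hit n f y (x , (a , c , t , (a~c , j , cⱼ≈1 , small) , vt , x≈) , close) =
    proj₁ a , unit⇒primitive {proj₁ a} (proj₂ a) , proj₁ c , t ,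
    (j , a~c , cⱼ≈1 , λ i i<j → norm<⇒V (proj₁ c i) (<-respʳ-≈ (sym radius-0) (small i i<j))) , vt ,
    λ i → V-cong₂ F.refl (F.trans (x≈ i) (F.+-congˡ
      (cong f {a} {normalised a} (~-refl {a} {normalised a} (λ _ → F.refl)) i))) (close i)

  hit⇒kakeyaHit : ∀ n f y → Hit n (toMap f) y → KakeyaHit n f y
  hit⇒kakeyaHit n f y (a , pa , c , t , (j , (u , unit , c≈) , cⱼ≈1 , small) , vt , close) =
    (λ i → (t *ᴷ c i) +ᴷ to f (a , primitive⇒unit pa) i) ,
    ((a , primitive⇒unit pa) , (c , primitive⇒unit (scaled-primitive unit c≈ pa)) , t ,
      ((u , unit , c≈) , j , cⱼ≈1 , λ i i<j → ≤-<-trans (V⇒norm≤ {1} (c i) (small i i<j)) (<-respʳ-≈ radius-0 (radius-< {0} {1} (s≤s z≤n)))) ,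
      vt , λ _ → F.refl) , close

  kakeya-nonempty : ∀ f → ∃[ x ] x ∈ kakeya f
  kakeya-nonempty f = _ , a , a , F.0# , (~-refl {a} {a} (λ _ → F.refl) , zero , F.refl , λ _ ()) , F.V-0# , λ _ → F.refl
    where
    a : ℙ
    a = embed zero (λ _ → F.0# , F.V-0#) , primitive⇒unit (embed-primitive zero (λ _ → F.0# , F.V-0#))

  kakeya-integral : ∀ {f x} → x ∈ kakeya f → x ∈ Rᵈ
  kakeya-integral {f} (a , c , t , _ , vt , x≈) i = F.V-cong (F.sym (x≈ i))
    (F.V-+ (F.V-*ˡ vt (Primitive.integral (unit⇒primitive {proj₁ c} (proj₂ c)) i)) (integral f a i))

  -- For q ^ - (p + 1) ≤ ε < q ^ - p, the ε-neighbourhood is the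
  -- neighbourhood modulo π ^ (p + 1).
  module _ {p : ℕ} {ε : ℝ} (radius≤ε : radius (suc p) ≤ ε) (ε<radius : ε < radius p) where

    private
      n = suc p

      distances : Kᵈ → Ω → Pred ℝ _
      distances y f r = ∃[ x ] (x ∈ kakeya f × r ≈ ‖ y -ᵈ x ‖)

      distances-glb : ∀ y f → IsGlb _≤_ (distances y f) (inf (distances y f))
      distances-glb y f = inf-isGlb (let (x , x∈) = kakeya-nonempty f in _ , x , x∈ , refl)
        λ { r (x , _ , r≈) → ≤-respʳ-≈ (sym r≈) (‖‖-nonneg (y -ᵈ x)) }

    Near : Ω → Kᵈ → Set
    Near f y = y ∈ neighbourhood ε (kakeya f)

    -- Attainment of the infimum is not presupposed: were all distances at least q ^ -p, the infimum
    -- would exceed ε. A distance below q ^ -p then gives a congruence modulo π ^ (p + 1) by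
    -- discreteness.
    near⇒kakeyaHit : ∀ f y → Near f y → KakeyaHit n f y
    near⇒kakeyaHit f y near with em {P = ∃[ x ] (x ∈ kakeya f × ‖ y -ᵈ x ‖ < radius p)}
    ... | yes (x , x∈ , close) = x , x∈ , ‖‖<⇒V (y -ᵈ x) close
    ... | no ¬close = contradiction (proj₂ (distances-glb y f) (radius p)
            λ { r (x , x∈ , r≈) → ≤-respʳ-≈ (sym r≈) (≮⇒≥ λ close → ¬close (x , x∈ , close)) })
            (<⇒≱ (≤-<-trans near ε<radius))

    kakeyaHit⇒near : ∀ f y → KakeyaHit n f y → Near f y
    kakeyaHit⇒near f y (x , x∈ , close) = ≤-trans (proj₁ (distances-glb y f) _ (x , x∈ , refl))
      (≤-trans (V⇒‖‖≤ (y -ᵈ x) close) radius≤ε)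

    -- The Kakeya set is integral and congruences preserve integrality, so intersecting with `Rᵈ`,
    -- of finite mass, loses nothing.
    near-integral : ∀ f {y} → Near f y → y ∈ Rᵈ
    near-integral f {y} near i = let (x , x∈ , close) = near⇒kakeyaHit f y near in
      V0-from-close (close i) (kakeya-integral {f} x∈ i)

    near-shift : ∀ f g {y} → (∀ a → ‖ to f a -ᵈ to g a ‖ ≤ radius n) → Near f y → Near g y
    near-shift f g {y} f≈g near = kakeyaHit⇒near g y (hit⇒kakeyaHit n g y
      (hit-cong n (toMap f) (toMap g) y (λ a pa → ‖‖≤⇒V _ (f≈g (a , primitive⇒unit pa))) (kakeyaHit⇒hit n f y (near⇒kakeyaHit f y near))))

    module Kᵈ = MeasureTheory em R {Kᵈ} (λ δ x y → ‖ x -ᵈ y ‖ ≤ δ) (λ x y z → z ≈ᵈ (λ i → x i +ᴷ y i))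
    module Ω′ = MeasureTheory em R {Ω} (λ δ f g → ∀ a → ‖ to f a -ᵈ to g a ‖ ≤ δ) (λ f g h → ∀ a → to h a ≈ᵈ (λ i → to f a i +ᴷ to g a i))
    module Translate = Ω′.Translation _⊖_
      (λ z g a i → F.trans (minus-plus (to z a i) (to g a i)) (F.+-congʳ (F.sym (⊖-to z g a i))))
      (λ {x} {g} {z} sum 0<δ → (λ a → ‖‖-≈0 _ 0<δ λ i → sum-minus (sum a i) (⊖-to z g a i)) ,
                               (λ a → ‖‖-≈0 _ 0<δ λ i → sum-minus′ (sum a i) (⊖-to z g a i)))
      (λ {z} {z′} g near a → ‖‖-≤-cong (λ i → minus-minus (⊖-to z g a i) (⊖-to z′ g a i)) (near a))

    borel-Rᵈ : MeasuresKᵈ.Borel Rᵈ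
    borel-Rᵈ = MeasuresKᵈ.isOpen λ x x∈ → radius 0 , radius-pos 0 ,
      λ y near i → V0-from-close (V-sym (‖‖≤⇒V {0} (x -ᵈ y) near i)) (x∈ i)

    borel-near : ∀ f → MeasuresKᵈ.Borel (Near f)
    borel-near f = MeasuresKᵈ.isOpen λ y near → radius n , radius-pos n , λ y′ y≈y′ →
      let (x , x∈ , close) = near⇒kakeyaHit f y near in
      kakeyaHit⇒near f y′ (x , x∈ , λ i → V-shift (‖‖≤⇒V {n} (y -ᵈ y′) y≈y′ i) (close i))

    module _ (μ : HaarKᵈ) (P : HaarΩ) where

      private
        module μ = MeasuresKᵈ.HaarMeasure μ
        module P = MeasuresΩ.HaarMeasure P

        N = codeCount n
        Pr = hitProbability p

        0<N : 0# < fromℕ N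
        0<N = fromℕ-pos (power-pos {k = suc s} (tree-pos n))
          where
          power-pos : ∀ {m k} → 0 ℕ.< m → 0 ℕ.< m ℕ.^ k
          power-pos {m} {k} 0<m = ℕ.m^n>0 m {{ℕ.>-nonZero 0<m}} k
          tree-pos : ∀ r → 0 ℕ.< treeCount (q ℕ.^ s) r
          tree-pos zero    = s≤s z≤n
          tree-pos (suc r) = power-pos {k = q ℕ.^ s} (ℕ.*-mono-≤ 0<q^s (tree-pos r))

        g : Fin N → Ω
        g c = fromMap (random n c)

        finite-Rᵈ : Kᵈ.Finite μ.measure Rᵈ
        finite-Rᵈ = ≈⁺⇒finite μ.normalised

        mass-Rᵈ : Kᵈ.mass μ.measure Rᵈ ≈ 1#
        mass-Rᵈ = finitePart-cong μ.normalised

        near-within : ∀ f → (Rᵈ ∩ Near f) ≐ Near f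
        near-within f = proj₂ , λ near → near-integral f near , near

        volume : Ω → ℝ
        volume f = Kᵈ.mass μ.measure (Near f)

        finite-near : ∀ f → Kᵈ.Finite μ.measure (Near f)
        finite-near f = finite-≈⁺ (μ.μ-cong (proj₂ (near-within f) , proj₁ (near-within f)))
          (Kᵈ.∩-finite μ.measure (borel-near f) borel-Rᵈ finite-Rᵈ)

        volume-simple : ∀ f → Kᵈ.Simple μ.measure Rᵈ (λ y → 𝟙 (Near f y)) (volume f)
        volume-simple f = Kᵈ.simple-resp μ.measure (λ _ _ → refl) (Kᵈ.mass-cong μ.measure (near-within f))
          (Kᵈ.simple-indicator μ.measure (borel-near f))

        volume-nonneg : ∀ f → 0# ≤ volume f
        volume-nonneg f = Kᵈ.mass-nonneg μ.measure (Near f)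

        volume-≤1 : ∀ f → volume f ≤ 1#
        volume-≤1 f = ≤-respʳ-≈ (trans (*-identityˡ _) mass-Rᵈ)
          (Kᵈ.simple-mono μ.measure borel-Rᵈ finite-Rᵈ (volume-simple f) (Kᵈ.simple-const μ.measure borel-Rᵈ 1#) λ y _ → 𝟙≤1 (Near f y))
          where
          𝟙≤1 : ∀ A → 𝟙 A ≤ 1#
          𝟙≤1 A with em {P = A}
          ... | yes _ = ≤-refl
          ... | no  _ = 0≤1

        -- The volume depends only on f modulo π ^ n, so it is locally constant and its superlevel
        -- sets are open.
        volume-measurable : ∀ a → MeasuresΩ.Borel (λ f → a ≤ volume f)
        volume-measurable a = MeasuresΩ.isOpen λ f a≤ → radius n , radius-pos n , λ f′ f≈f′ →
          ≤-trans a≤ (≤-reflexive (Kᵈ.mass-cong μ.measure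
            ((λ {y} → near-shift f f′ {y} f≈f′) , λ {y} → near-shift f′ f {y} (λ a → ‖‖-flip {to f a} {to f′ a} (f≈f′ a)))))
          where
          ‖‖-flip : ∀ {x y : Kᵈ} → ‖ x -ᵈ y ‖ ≤ radius n → ‖ y -ᵈ x ‖ ≤ radius n
          ‖‖-flip {x} {y} x≈y = V⇒‖‖≤ (y -ᵈ x) λ i → V-sym (‖‖≤⇒V {n} (x -ᵈ y) x≈y i)

        near⇔hit : ∀ h c y → 𝟙 (Near (h ⊖ g c) y) ≈ 𝟙 (Hit n (difference (toMap h) (random n c)) y)
        near⇔hit h c y = 𝟙-cong
          (λ near → hit-cong n (toMap (h ⊖ g c)) shifted y (λ a pa i → V-refl (agree a pa i)) (kakeyaHit⇒hit n (h ⊖ g c) y (near⇒kakeyaHit (h ⊖ g c) y near)))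
          (λ hit → kakeyaHit⇒near (h ⊖ g c) y (hit⇒kakeyaHit n (h ⊖ g c) y (hit-cong n shifted (toMap (h ⊖ g c)) y (λ a pa i → V-refl (F.sym (agree a pa i))) hit)))
          where
          shifted = difference (toMap h) (random n c)
          agree : ∀ a pa i → L.to (toMap (h ⊖ g c)) a pa i ≈ᴷ L.to shifted a pa i
          agree a pa i = F.trans (⊖-to h (g c) (a , primitive⇒unit pa) i)
            (F.+-congˡ (F.-‿cong (toMap-fromMap (random n c) (unit⇒primitive (primitive⇒unit pa)) pa i)))

        -- Pointwise in y the number of codes c with y near the Kakeya set of
        -- h ⊖ g c is constant; integrate over y.
        average : ∀ h → sum {N} (λ c → volume (h ⊖ g c)) ≈ fromℕ N * Pr
        average h = trans
          (Kᵈ.simple-unique μ.measure borel-Rᵈ finite-Rᵈ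
            (Kᵈ.simple-sum μ.measure N λ c → volume-simple (h ⊖ g c))
            (Kᵈ.simple-const μ.measure borel-Rᵈ (fromℕ N * Pr))
            λ y y∈ → trans (sum-cong-≋ {N} λ c → near⇔hit h c y) (count-hits p (toMap h) y y∈))
          (trans (*-congˡ mass-Rᵈ) (*-identityʳ _))

        finite-U : Ω′.Finite P.measure U
        finite-U = ≈⁺⇒finite P.normalised

        translates : ∀ {G w} → Ω′.Simple P.measure U G w →
                     Ω′.Simple P.measure U (λ h → sum {N} (λ c → G (h ⊖ g c))) (fromℕ N * w)
        translates {w = w} simple = Ω′.simple-resp P.measure (λ _ _ → refl) (sum-const N w)
          (Ω′.simple-sum P.measure N λ c → Translate.simple-⊖ P (g c) simple)

        constant : Ω′.Simple P.measure U (λ h → sum {N} (λ c → volume (h ⊖ g c))) (fromℕ N * Pr)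
        constant = Ω′.simple-resp P.measure (λ h _ → sym (average h))
          (trans (*-congˡ (finitePart-cong P.normalised)) (*-identityʳ _))
          (Ω′.simple-const P.measure Ω′.borel-U (fromℕ N * Pr))

        sum-mono : ∀ {k} {x y : Fin k → ℝ} → (∀ i → x i ≤ y i) → sum x ≤ sum y
        sum-mono {zero}  x≤y = ≤-refl
        sum-mono {suc k} x≤y = +-mono-≤ (x≤y zero) (sum-mono (x≤y ∘ suc))

      -- If G ≤ volume is a step function of integral w, summing over the N translates gives a
      -- function of integral N w, by invariance, below the constant N * Pr; hence w ≤ Pr. Step
      -- functions above the volume are treated alike.
      expectation : finitePart (𝔼 P (X μ ε)) ≈ hitProbability p
      expectation = finitePart-cong (Ω′.integral-≈ P.measure P.normalised finite-near volume-nonneg volume-≤1 volume-measurable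
        (λ simple G≤ → *-cancelˡ-≤ 0<N (Ω′.simple-mono P.measure Ω′.borel-U finite-U (translates simple) constant λ h _ → sum-mono λ c → G≤ (h ⊖ g c)))
        (λ simple ≤G → *-cancelˡ-≤ 0<N (Ω′.simple-mono P.measure Ω′.borel-U finite-U constant (translates simple) λ h _ → sum-mono λ c → ≤G (h ⊖ g c))))

-- The asymptotics as ε tends to 0.

module Limit (em : ∀ {ℓ} → ExcludedMiddle ℓ) (R : CompleteOrderedField) (𝕂 : LocalField) (s : ℕ) (1≤s : 1 ℕ.≤ s) where

  open Reals em R
  open Counting em R using (lineCount; module Survival)
  open PowerBounds em R
  open Asymptotics em R using (drift; drift-pos; drift-≈; survival-bounds; survival-rate; inverse-survival-large; eventually-≤)
  open Norms em R 𝕂 (suc s) using (1<Q; 0<Q; radius; radius-pos; radius-anti; radius-cancel; radius-0)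
  open LocalField 𝕂 using (q)
  open HitCount em R 𝕂 s using (hitProbability; module F)

  private
    Q = fromℕ q
    m = q ℕ.^ s

    2≤m : 2 ℕ.≤ m
    2≤m = ℕ.≤-trans F.1<q (ℕ.≤-trans (ℕ.≤-reflexive (≡.sym (ℕ.*-identityʳ q))) (ℕ.^-monoʳ-≤ q {{ℕ.>-nonZero (ℕ.≤-trans (s≤s z≤n) F.1<q)}} 1≤s))

    open Survival m

    M = fromℕ m
    i = M ⁻¹
    c = drift m 2≤m
    0<c = drift-pos m 2≤m

    W = fromℕ (lineCount q (suc s))
    2W = (1# + 1#) * W
    j = 2W ⁻¹
    C = binomial₂ (lineCount q (suc s))

    0<M : 0# < M
    0<M = fromℕ-pos (ℕ.≤-trans (s≤s z≤n) 2≤m)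

    0<W : 0# < W
    0<W = fromℕ-pos (ℕ.≤-trans (ℕ.m^n>0 q {{ℕ.>-nonZero (ℕ.≤-trans (s≤s z≤n) F.1<q)}} s) (ℕ.m≤m+n m _))

    0<2W : 0# < 2W
    0<2W = *-pos (+-pos 0<1 0<1) 0<W

    0<j : 0# < j
    0<j = ⁻¹-pos 0<2W

    -- The inverse of the constant of the theorem.
    B = (M - 1#) * j

    B-≈ : B ≈ (1# + 1#) * (M * c) * j
    B-≈ = *-congʳ (sym (drift-≈ m 2≤m))

    0<B : 0# < B
    0<B = *-pos (<-respʳ-≈ (drift-≈ m 2≤m) (*-pos (+-pos 0<1 0<1) (*-pos 0<M 0<c))) 0<j

  lineCount-≈ : ∀ d → (Q - 1#) * fromℕ (lineCount q d) ≈ Q ^ d - 1#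
  lineCount-≈ zero    = solve 1 (λ Q → (Q :- :1) :* :0 := :1 :- :1) refl Q
  lineCount-≈ (suc d) = begin
    (Q - 1#) * fromℕ (q ℕ.^ d ℕ.+ lineCount q d)            ≈⟨ *-congˡ (trans (fromℕ-+ (q ℕ.^ d) _) (+-congʳ (fromℕ-^ q d))) ⟩
    (Q - 1#) * (Q ^ d + fromℕ (lineCount q d))              ≈⟨ distribˡ _ _ _ ⟩
    (Q - 1#) * Q ^ d + (Q - 1#) * fromℕ (lineCount q d)     ≈⟨ +-congˡ (lineCount-≈ d) ⟩
    (Q - 1#) * Q ^ d + (Q ^ d - 1#)                         ≈⟨ solve 2 (λ Q x → (Q :- :1) :* x :+ (x :- :1) := Q :* x :- :1) refl Q (Q ^ d) ⟩
    Q * Q ^ d - 1#                                          ∎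
    where open ≈-Reasoning

  -- By Q ^ (s + 1) - 1 = (Q - 1) W and Q ^ s = M the factor Q - 1 cancels, leaving 2 W / ((M - 1)
  -- L).
  constant-≈ : ∀ {L} → 0# < L →
    (((1# + (1# + 0#)) * (Q ^ suc s - 1#)) / ((Q - 1#) * (Q ^ s - 1#)) * (1# / L)) ⁻¹ ≈ B * L
  constant-≈ {L} 0<L = sym (⁻¹-unique positive (trans (*-congʳ rewritten) main))
    where
    x = Q - 1#
    y = M - 1#
    A = 2W * x * (x * y) ⁻¹ * (1# * L ⁻¹)

    0<x : 0# < x
    0<x = <⇒0<- 1<Q

    0<y : 0# < y
    0<y = <-respʳ-≈ (drift-≈ m 2≤m) (*-pos (+-pos 0<1 0<1) (*-pos 0<M 0<c))

    den-≈ : (Q - 1#) * (Q ^ s - 1#) ≈ x * y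
    den-≈ = *-congˡ (+-congʳ (sym (fromℕ-^ q s)))

    rewritten : ((1# + (1# + 0#)) * (Q ^ suc s - 1#)) / ((Q - 1#) * (Q ^ s - 1#)) * (1# / L) ≈ A
    rewritten = *-congʳ (*-cong
      (trans (*-congˡ (sym (lineCount-≈ (suc s)))) (solve 2 (λ x w → (:1 :+ (:1 :+ :0)) :* (x :* w) := (:1 :+ :1) :* w :* x) refl x W))
      (⁻¹-cong (<-respʳ-≈ (sym den-≈) (*-pos 0<x 0<y)) den-≈))

    positive : 0# < ((1# + (1# + 0#)) * (Q ^ suc s - 1#)) / ((Q - 1#) * (Q ^ s - 1#)) * (1# / L)
    positive = <-respʳ-≈ (sym rewritten) (*-pos (*-pos (*-pos 0<2W 0<x) (⁻¹-pos (*-pos 0<x 0<y))) (*-pos 0<1 (⁻¹-pos 0<L)))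

    main : A * (B * L) ≈ 1#
    main = begin
      A * (B * L)
        ≈⟨ solve 7 (λ w x y k l j L → w :* x :* k :* (:1 :* l) :* (y :* j :* L) := (x :* y :* k) :* ((w :* j) :* (L :* l)))
             refl 2W x y ((x * y) ⁻¹) (L ⁻¹) j L ⟩
      (x * y * (x * y) ⁻¹) * ((2W * j) * (L * L ⁻¹))
        ≈⟨ *-cong (⁻¹-inverse (*-pos 0<x 0<y)) (*-cong (⁻¹-inverse 0<2W) (⁻¹-inverse 0<L)) ⟩
      1# * (1# * 1#)
        ≈⟨ solve 0 (:1 :* (:1 :* :1) := :1) refl ⟩
      1#  ∎
      where open ≈-Reasoning

  private
    module At (p : ℕ) {L : ℝ} (p≤L : fromℕ p ≤ L) (L≤1+p : L ≤ fromℕ (suc p)) where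

      ρ = survival p
      v = ρ ⁻¹
      0<ρ = proj₁ (survival-bounds m 2≤m p)
      z = ρ * i

      0≤L : 0# ≤ L
      0≤L = ≤-trans (fromℕ-nonneg p) p≤L

      0≤BL : 0# ≤ L * B
      0≤BL = *-nonneg 0≤L (<⇒≤ 0<B)

      0≤z : 0# ≤ z
      0≤z = *-nonneg (<⇒≤ 0<ρ) (<⇒≤ (⁻¹-pos 0<M))

      i≤1 : i ≤ 1#
      i≤1 = ≤-respʳ-≈ 1⁻¹≈1 (⁻¹-anti-≤ 0<1 (1≤fromℕ (ℕ.≤-trans (s≤s z≤n) 2≤m)))

      z≤ρ : z ≤ ρ
      z≤ρ = ≤-respʳ-≈ (*-identityʳ ρ) (*-monoˡ-≤ (<⇒≤ 0<ρ) i≤1)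

      z≤1 : z ≤ 1#
      z≤1 = ≤-trans z≤ρ (proj₂ (survival-bounds m 2≤m p))

      ρv≈1 : ρ * v ≈ 1#
      ρv≈1 = ⁻¹-inverse 0<ρ

      -- The main term, coming from the first-order term W z of the hitting probability. It tends to
      -- 1, because 1 / ρ grows like c p and L is within 1 of p.
      X = ρ * (c * L)

      0≤C : 0# ≤ C
      0≤C = binomial₂-nonneg (lineCount q (suc s))

      WzLB : W * z * (L * B) ≈ X
      WzLB = begin
        W * z * (L * B)
          ≈⟨ *-congˡ (*-congˡ B-≈) ⟩
        W * (ρ * i) * (L * ((1# + 1#) * (M * c) * j))
          ≈⟨ solve 7 (λ W ρ i L M c j → W :* (ρ :* i) :* (L :* ((:1 :+ :1) :* (M :* c) :* j)) :=
               ((:1 :+ :1) :* W :* j) :* ((M :* i) :* (ρ :* (c :* L)))) refl W ρ i L M c j ⟩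
        (2W * j) * ((M * i) * X)
          ≈⟨ *-cong (⁻¹-inverse 0<2W) (*-congʳ (⁻¹-inverse 0<M)) ⟩
        1# * (1# * X)
          ≈⟨ solve 1 (λ x → :1 :* (:1 :* x) := x) refl X ⟩
        X  ∎
        where open ≈-Reasoning

      -- The size C z / W of the second-order term C z ^ 2 relative to W z, as j = 1 / (2 W).
      a = (1# + 1#) * C * j * z

      CzzLB : C * (z * z) * (L * B) ≈ a * X
      CzzLB = begin
        C * (z * z) * (L * B)
          ≈⟨ *-identityˡ _ ⟨
        1# * (C * (z * z) * (L * B))
          ≈⟨ *-congʳ (⁻¹-inverse 0<2W) ⟨
        (2W * j) * (C * (z * z) * (L * B))
          ≈⟨ solve 6 (λ W j C z L B → ((:1 :+ :1) :* W :* j) :* (C :* (z :* z) :* (L :* B)) :=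
               ((:1 :+ :1) :* C :* j :* z) :* (W :* z :* (L :* B))) refl W j C z L B ⟩
        a * (W * z * (L * B))
          ≈⟨ *-congˡ WzLB ⟩
        a * X  ∎
        where open ≈-Reasoning

      upper : hitProbability p * (L * B) ≤ X
      upper = ≤-respʳ-≈ WzLB (*-monoʳ-≤ 0≤BL (0≤⇒≤ (≤⇒0≤- (bonferroni₁ 0≤z z≤1 (lineCount q (suc s))))
        (solve 2 (λ x y → y :- (:1 :- x) := x :- (:1 :- y)) refl (W * z) _)))

      lower : X - a * X ≤ hitProbability p * (L * B)
      lower = ≤-respˡ-≈
        (trans (solve 3 (λ x y l → (x :- y) :* l := x :* l :- y :* l) refl (W * z) (C * (z * z)) (L * B)) (+-cong WzLB (-‿cong CzzLB)))
        (*-monoʳ-≤ 0≤BL (0≤⇒≤ (≤⇒0≤- (bonferroni₂ 0≤z z≤1 (lineCount q (suc s))))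
          (solve 3 (λ x y w → :1 :- x :+ y :- w := :1 :- w :- (x :- y)) refl (W * z) (C * (z * z)) _)))

    :8 : ∀ {n} → Polynomial n
    :8 = :1 :+ (:1 :+ (:1 :+ (:1 :+ (:1 :+ (:1 :+ (:1 :+ (:1 :+ :0)))))))

  -- P₁ puts 1 / ρ within a factor 1 ± 2 b of c p, P₂ makes the relative second-order term at most
  -- b, and P₃ makes L at most (1 + b) p. The number 8 leaves room for 1 + b ≤ (1 + 8 b) (1 - 2 b)
  -- and 1 - 8 b ≤ (1 - b) (1 - 2 b).
  hitProbability-asymptotics : ∀ b → 0# < b → fromℕ 8 * b ≤ 1# → ∃[ P ] (∀ p → P ℕ.≤ p → ∀ {L} → fromℕ p ≤ L → L ≤ fromℕ (suc p) →
    1# - fromℕ 8 * b ≤ hitProbability p * (L * B) × hitProbability p * (L * B) ≤ 1# + fromℕ 8 * b)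
  hitProbability-asymptotics b 0<b 8b≤1 =
    let (P₁ , rate)  = survival-rate m 2≤m (c * b) (*-pos 0<c 0<b)
        (P₂ , large) = inverse-survival-large m 2≤m ((1# + 1#) * C * j * b ⁻¹)
        (P₃ , 1≤pb)  = eventually-≤ 1# 0<b
    in P₁ ℕ.+ P₂ ℕ.+ P₃ , λ p P≤p p≤L L≤1+p →
      bounds p p≤L L≤1+p (rate p (ℕ.≤-trans (ℕ.≤-trans (ℕ.m≤m+n P₁ P₂) (ℕ.m≤m+n _ P₃)) P≤p))
        (large p (ℕ.≤-trans (ℕ.≤-trans (ℕ.m≤n+m P₂ P₁) (ℕ.m≤m+n _ P₃)) P≤p)) (1≤pb p (ℕ.≤-trans (ℕ.m≤n+m P₃ _) P≤p))
    where
    bounds : ∀ p {L} → fromℕ p ≤ L → L ≤ fromℕ (suc p) →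
      (c - (c * b + c * b)) * fromℕ p ≤ survival p ⁻¹ × survival p ⁻¹ ≤ (c + (c * b + c * b)) * fromℕ p →
      (1# + 1#) * C * j * b ⁻¹ ≤ survival p ⁻¹ → 1# ≤ fromℕ p * b →
      1# - fromℕ 8 * b ≤ hitProbability p * (L * B) × hitProbability p * (L * B) ≤ 1# + fromℕ 8 * b
    bounds p {L} p≤L L≤1+p (v-lower , v-upper) v-large 1≤pb =
        ≤-trans 1-8b≤ lower , ≤-trans upper X≤
      where
      open At p p≤L L≤1+p
      n = fromℕ p
      0≤b = <⇒≤ 0<b
      0≤8 = fromℕ-nonneg 8
      0≤c = <⇒≤ 0<c
      0≤n = fromℕ-nonneg p

      X≤ : X ≤ 1# + fromℕ 8 * b
      X≤ = ≤-trans (*-monoˡ-≤ (<⇒≤ 0<ρ) (≤-trans (*-monoˡ-≤ 0≤c L≤1+p) (≤-trans growth (*-monoˡ-≤ (+-nonneg 0≤1 (*-nonneg 0≤8 0≤b)) v-lower))))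
        (≤-reflexive (trans (solve 3 (λ ρ k v → ρ :* (k :* v) := (ρ :* v) :* k) refl ρ _ v) (trans (*-congʳ ρv≈1) (*-identityˡ _))))
        where
        -- (1 + 8 b) (1 - 2 b) = 1 + b + 3 b + 2 b (1 - 8 b)
        growth : c * (1# + n) ≤ (1# + fromℕ 8 * b) * ((c - (c * b + c * b)) * n)
        growth = 0≤⇒≤
          (+-nonneg (*-nonneg 0≤c (≤⇒0≤- 1≤pb))
            (*-nonneg (*-nonneg 0≤c 0≤n) (+-nonneg (*-nonneg (+-nonneg 0≤1 (+-nonneg 0≤1 0≤1)) 0≤b)
              (*-nonneg (+-nonneg 0≤b 0≤b) (≤⇒0≤- 8b≤1)))))
          (solve 3 (λ c n b →
            c :* (n :* b :- :1) :+ c :* n :* ((:1 :+ (:1 :+ :1)) :* b :+ (b :+ b) :* (:1 :- :8 :* b)) :=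
            (:1 :+ :8 :* b) :* ((c :- (c :* b :+ c :* b)) :* n) :- c :* (:1 :+ n)) refl c n b)

      b≤1 : b ≤ 1#
      b≤1 = ≤-trans (0≤⇒≤ (*-nonneg (fromℕ-nonneg 7) 0≤b)
        (solve 1 (λ b → (:1 :+ (:1 :+ (:1 :+ (:1 :+ (:1 :+ (:1 :+ (:1 :+ :0))))))) :* b := :8 :* b :- b) refl b)) 8b≤1

      2b≤1 : b + b ≤ 1#
      2b≤1 = ≤-trans (0≤⇒≤ (*-nonneg (fromℕ-nonneg 6) 0≤b)
        (solve 1 (λ b → (:1 :+ (:1 :+ (:1 :+ (:1 :+ (:1 :+ (:1 :+ :0)))))) :* b := :8 :* b :- (b :+ b)) refl b)) 8b≤1

      a≤b : a ≤ b
      a≤b = ≤-trans (*-monoˡ-≤ 0≤K z≤ρ) (*-cancelˡ-≤ (⁻¹-pos 0<b) (≤-resp₂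
        (solve 3 (λ k r ρ → k :* r :* ρ := r :* (k :* ρ)) refl _ (b ⁻¹) ρ)
        (trans (trans (*-comm v ρ) ρv≈1) (sym (trans (*-comm _ _) (⁻¹-inverse 0<b))))
        (*-monoʳ-≤ (<⇒≤ 0<ρ) v-large)))
        where
        0≤K : 0# ≤ (1# + 1#) * C * j
        0≤K = *-nonneg (*-nonneg (+-nonneg 0≤1 0≤1) 0≤C) (<⇒≤ 0<j)

      -- Combines p ≤ L with (1 - 2 b) (1 + 2 b) ≤ 1.
      1-2b≤X : 1# - (b + b) ≤ X
      1-2b≤X = ≤-trans
        (≤-reflexive (sym (trans (solve 3 (λ ρ k v → ρ :* (k :* v) := (ρ :* v) :* k) refl ρ _ v) (trans (*-congʳ ρv≈1) (*-identityˡ _)))))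
        (*-monoˡ-≤ (<⇒≤ 0<ρ) (≤-trans (*-monoˡ-≤ (≤⇒0≤- 2b≤1) v-upper) (≤-trans
          (0≤⇒≤ (*-nonneg (*-nonneg 0≤c 0≤n) (square-nonneg (b + b)))
            (solve 3 (λ c n b → c :* n :* ((b :+ b) :* (b :+ b)) := c :* n :- (:1 :- (b :+ b)) :* ((c :+ (c :* b :+ c :* b)) :* n)) refl c n b))
          (*-monoˡ-≤ 0≤c p≤L))))

      1-8b≤ : 1# - fromℕ 8 * b ≤ X - a * X
      1-8b≤ = ≤-trans
        (0≤⇒≤ (+-nonneg (*-nonneg (fromℕ-nonneg 5) 0≤b) (+-nonneg (square-nonneg b) (square-nonneg b)))
          (solve 1 (λ b → (:1 :+ (:1 :+ (:1 :+ (:1 :+ (:1 :+ :0))))) :* b :+ (b :* b :+ b :* b) :=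
            (:1 :- b) :* (:1 :- (b :+ b)) :- (:1 :- :8 :* b)) refl b))
        (≤-trans (*-mono-≤ (≤⇒0≤- 2b≤1) (≤-trans (≤⇒0≤- b≤1) 1-b≤1-a) 1-b≤1-a 1-2b≤X)
          (≤-reflexive (solve 2 (λ a x → (:1 :- a) :* x := x :- a :* x) refl a X)))
        where
        1-b≤1-a : 1# - b ≤ 1# - a
        1-b≤1-a = +-monoʳ-≤ 1# (neg-mono-≤ a≤b)

  -- Some q ^ -n is at most ε; the descent from this n stops at the last such exponent, which is p +
  -- 1.
  scale-of : ∀ {ε} P → 0# < ε → ε < radius P → ∃[ p ] (P ℕ.≤ p × radius (suc p) ≤ ε × ε < radius p)
  scale-of {ε} P 0<ε ε<radius = let (k , ε⁻¹<) = ^-unbounded 1<Q (ε ⁻¹) in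
    search (k ℕ.+ P) (small k ε⁻¹<)
    where
    small : ∀ k → ε ⁻¹ < Q ^ k → radius (k ℕ.+ P) ≤ ε
    small k ε⁻¹< = *-cancelˡ-≤ (⁻¹-pos 0<ε) (≤-respʳ-≈ (sym (trans (*-comm _ _) (⁻¹-inverse 0<ε))) (≤-respˡ-≈ (*-comm _ _)
      (≤-trans (*-monoˡ-≤ (<⇒≤ (radius-pos (k ℕ.+ P))) (<⇒≤ ε⁻¹<))
        (≤-trans (*-monoʳ-≤ (^-nonneg k (<⇒≤ 0<Q)) (radius-anti {k} {k ℕ.+ P} (ℕ.m≤m+n k P)))
          (≤-reflexive (trans (*-comm _ _) (⁻¹-inverse (^-pos k 0<Q))))))))
    search : ∀ n → radius n ≤ ε → ∃[ p ] (P ℕ.≤ p × radius (suc p) ≤ ε × ε < radius p)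
    search zero    r≤ε = contradiction (≤-trans (radius-anti {0} {P} z≤n) r≤ε) (<⇒≱ ε<radius)
    search (suc n) r≤ε with em {P = radius n ≤ ε}
    ... | yes r≤ε′ = search n r≤ε′
    ... | no  r≰ε with P ℕ.≤? n
    ...   | yes P≤n = n , P≤n , r≤ε , ≰⇒> r≰ε
    ...   | no  P≰n = contradiction (≤-trans (radius-anti {suc n} {P} (ℕ.≰⇒> P≰n)) r≤ε) (<⇒≱ ε<radius)

  -- The fraction -(p + 1) / 1 belongs to the set whose supremum is `log`. Conversely Q ^ e ≤ ε ^ k
  -- with ε < Q ^ -p forces Q ^ e < Q ^ -(p k), so that e is negative and e / k ≤ - p.
  log-bounds : ∀ {ε} p → 0# < ε → radius (suc p) ≤ ε → ε < radius p →
               - fromℕ (suc p) ≤ log Q ε × log Q ε ≤ - fromℕ p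
  log-bounds {ε} p 0<ε radius≤ε ε<radius = sup-bounds
    (-[1+ p ] , 0 , sym (trans (*-congˡ (trans (⁻¹-cong (fromℕ-pos {1} (s≤s z≤n)) fromℕ-1) 1⁻¹≈1)) (*-identityʳ _)) ,
      ≤-respʳ-≈ (sym (*-identityʳ ε)) radius≤ε)
    λ { r (e , k , r≈ , Qᵉ≤) → ≤-respˡ-≈ (sym r≈) (exponent e k (≤-<-trans Qᵉ≤ (^-monoˡ-< k (<⇒≤ 0<ε) ε<radius))) }
    where
    exponent : ∀ e k → Q ^ᶻ e < radius p ^ suc k → fromℤ e / fromℕ (suc k) ≤ - fromℕ p
    exponent (+ n) k Qⁿ< = contradiction
      (≤-trans (≤-respʳ-≈ (1^n≈1 (suc k)) (^-monoˡ-≤ (suc k) (<⇒≤ (radius-pos p)) (≤-respʳ-≈ radius-0 (radius-anti {0} {p} z≤n)))) (1≤^ n (<⇒≤ 1<Q)))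
      (<⇒≱ Qⁿ<)
    exponent -[1+ n ] k Q⁻ⁿ< = *⁻¹-≤ (fromℕ-pos {suc k} (s≤s z≤n)) (≤-respʳ-≈
      (trans (-‿cong (fromℕ-* p (suc k))) (solve 2 (λ x y → :- (x :* y) := (:- x) :* y) refl (fromℕ p) (fromℕ (suc k))))
      (neg-mono-≤ (fromℕ-mono-≤ (radius-cancel {suc n} {p ℕ.* suc k} (≤-respʳ-≈ radius-^ (<⇒≤ Q⁻ⁿ<))))))
      where
      radius-^ : radius p ^ suc k ≈ radius (p ℕ.* suc k)
      radius-^ = trans (sym (^-⁻¹ (suc k) (^-pos p 0<Q))) (⁻¹-cong (^-pos (suc k) (^-pos p 0<Q)) (^-assocʳ Q p (suc k)))

  open Kakeya em R 𝕂 (suc s) using (HaarKᵈ; HaarΩ; X; 𝔼)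

  limit : (μ : HaarKᵈ) (P : HaarΩ) → (λ ε → finitePart (𝔼 P (X μ ε))) ∼₀⁺
    (λ ε → (fromℕ 2 * (Q ^ suc s - 1#)) / ((Q - 1#) * (Q ^ s - 1#)) * (1# / abs (log Q ε)))
  limit μ P η 0<η =
    -- Working with 1 / (k + 1) < η in place of η ensures that 8 b = 1 / (k + 1) is also at most 1.
    let (k , N⁻¹<η) = archimedean-⁻¹ 0<η
        (P₀ , asymptotics) = hitProbability-asymptotics (fromℕ (suc k) ⁻¹ * fromℕ 8 ⁻¹) (0<b k) (8b≤1 k)
    -- The successor guarantees p ≥ 1, so that L is positive and can be inverted.
    in radius (suc P₀) , radius-pos (suc P₀) , λ ε 0<ε ε<δ →
      let (p , P₀<p , radius≤ε , ε<radius) = scale-of (suc P₀) 0<ε ε<δ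
      in close k N⁻¹<η p (ℕ.≤-trans (s≤s z≤n) P₀<p) 0<ε radius≤ε ε<radius (asymptotics p (ℕ.≤-trans (ℕ.n≤1+n P₀) P₀<p))
    where
    0<8 : 0# < fromℕ 8
    0<8 = fromℕ-pos {8} (s≤s z≤n)

    b : ℕ → ℝ
    b k = fromℕ (suc k) ⁻¹ * fromℕ 8 ⁻¹

    0<N : ∀ k → 0# < fromℕ (suc k)
    0<N k = fromℕ-pos {suc k} (s≤s z≤n)

    0<b : ∀ k → 0# < b k
    0<b k = *-pos (⁻¹-pos (0<N k)) (⁻¹-pos 0<8)

    8b≈ : ∀ k → fromℕ 8 * b k ≈ fromℕ (suc k) ⁻¹
    8b≈ k = trans (solve 3 (λ e n i → e :* (n :* i) := (e :* i) :* n) refl (fromℕ 8) (fromℕ (suc k) ⁻¹) (fromℕ 8 ⁻¹))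
      (trans (*-congʳ (⁻¹-inverse 0<8)) (*-identityˡ _))

    8b≤1 : ∀ k → fromℕ 8 * b k ≤ 1#
    8b≤1 k = ≤-resp₂ (sym (8b≈ k)) 1⁻¹≈1 (⁻¹-anti-≤ 0<1 (1≤fromℕ {suc k} (s≤s z≤n)))

    close : ∀ k → fromℕ (suc k) ⁻¹ < η → ∀ p → 1 ℕ.≤ p → ∀ {ε} → 0# < ε → radius (suc p) ≤ ε → ε < radius p →
      (∀ {L} → fromℕ p ≤ L → L ≤ fromℕ (suc p) →
        1# - fromℕ 8 * b k ≤ hitProbability p * (L * B) × hitProbability p * (L * B) ≤ 1# + fromℕ 8 * b k) →
      abs (finitePart (𝔼 P (X μ ε)) / ((fromℕ 2 * (Q ^ suc s - 1#)) / ((Q - 1#) * (Q ^ s - 1#)) * (1# / abs (log Q ε))) - 1#) < η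
    close k N⁻¹<η p 1≤p {ε} 0<ε radius≤ε ε<radius bounds = abs-<
        (0<⇒< (+-pos-nonneg (<⇒0<- 8b<η) (≤⇒0≤- (proj₁ bounds′)))
          (trans (solve 3 (λ η e r → η :- e :+ (r :- (:1 :- e)) := r :- :1 :- :- η) refl η (fromℕ 8 * b k) _) (+-congʳ (+-congʳ (sym ratio≈)))))
        (0<⇒< (+-pos-nonneg (<⇒0<- 8b<η) (≤⇒0≤- (proj₂ bounds′)))
          (trans (solve 3 (λ η e r → η :- e :+ (:1 :+ e :- r) := η :- (r :- :1)) refl η (fromℕ 8 * b k) _) (+-congˡ (-‿cong (+-congʳ (sym ratio≈))))))
      where
      L = abs (log Q ε)
      lb = log-bounds p 0<ε radius≤ε ε<radius

      8b<η : fromℕ 8 * b k < η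
      8b<η = ≤-<-trans (≤-reflexive (8b≈ k)) N⁻¹<η

      L≈ : L ≈ - log Q ε
      L≈ = abs-nonpos (≤-trans (proj₂ lb) (≤-respʳ-≈ -0#≈0# (neg-mono-≤ (fromℕ-nonneg p))))

      p≤L : fromℕ p ≤ L
      p≤L = ≤-resp₂ (-‿involutive _) (sym L≈) (neg-mono-≤ (proj₂ lb))

      L≤1+p : L ≤ fromℕ (suc p)
      L≤1+p = ≤-resp₂ (sym L≈) (-‿involutive _) (neg-mono-≤ (proj₁ lb))

      bounds′ = bounds p≤L L≤1+p

      ratio≈ : finitePart (𝔼 P (X μ ε)) / ((fromℕ 2 * (Q ^ suc s - 1#)) / ((Q - 1#) * (Q ^ s - 1#)) * (1# / L)) ≈ hitProbability p * (L * B)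
      ratio≈ = *-cong (RandomKakeya.expectation em R 𝕂 s {p} radius≤ε ε<radius μ P)
        (trans (constant-≈ (<-≤-trans (fromℕ-pos 1≤p) p≤L)) (*-comm B L))

theorem2 : (em : ∀ {ℓ} → ExcludedMiddle ℓ) (R : CompleteOrderedField)
    (𝕂 : LocalField) (d : ℕ) → 2 ℕ.≤ d →
    let open Kakeya em R 𝕂 d in
    (μ : HaarKᵈ) (P : HaarΩ) →
    (λ ε → finitePart (𝔼 P (X μ ε)))
    ∼₀⁺
    (λ ε → (fromℕ 2 * (fromℕ q ^ d - 1#))
    / ((fromℕ q - 1#) * (fromℕ q ^ (d ∸ 1) - 1#))
    * (1# / abs (log (fromℕ q) ε)))
theorem2 em R 𝕂 (suc s) (s≤s 1≤s) = Limit.limit em R 𝕂 s 1≤s
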